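{- Let $n\ge 4$ be an integer, let $d=\lfloor n/2\rfloor$, and let $z_n^*$ be the leftmost (smallest) zero of the polynomial $D_n(x)=\sum_{k\ge1}D(n,k)x^k$, all of whose zeros are real. Then $$|z_n^*|\le\frac{D(n,d-1)}{d\,D(n,d)}+\frac{d-1}{d}\sqrt{\left(\frac{D(n,d-1)}{D(n,d)}\right)^2-\frac{2d}{d-1}\cdot\frac{D(n,d-2)}{D(n,d)}}.$$
   Context: For an integer $n\ge1$ and an integer $k\ge 0$, $D(n,k)$ denotes the number of partitions of $[n]=\{1,\dots,n\}$ into exactly $k$ blocks, each block consisting of more than one element (so $D(n,0)=0$ for $n\ge1$). -}

module Defs where

open import Algebra.Bundles using (RawSemiring)
import Algebra.Definitions.RawSemiring as SemiringOps
open import Data.Fin.Base using (Fin; toℕ)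
import Data.Fin.Properties as Fin
open import Data.Fin.Subset using (Subset; inside; outside; _∈_; _∩_; ∣_∣; Nonempty; Empty)
open import Data.Fin.Subset.Properties using (_∈?_; nonempty?)
open import Data.Integer.Base using (+_)
open import Data.List.Base using (List; []; _∷_; _++_; map; filter; length)
open import Data.List.Relation.Unary.All using (All; all?)
open import Data.List.Relation.Unary.AllPairs using (AllPairs; allPairs?)
open import Data.List.Relation.Unary.Any using (Any; any?)
open import Data.Nat.Base as ℕ using (ℕ; zero; suc)
import Data.Nat.Properties as ℕ
open import Data.Product.Base using (∃-syntax; _×_; _,_)
open import Data.Rational.Base as ℚ using (ℚ; 0ℚ; 1ℚ; ½; Positive)
import Data.Rational.Properties as ℚ
open import Data.Sum.Base using (inj₁; inj₂)
import Data.Vec.Base as Vec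
open import Level using (0ℓ)
open import Relation.Binary.PropositionalEquality using (_≡_; refl; sym; trans; cong; subst)
open import Relation.Nullary.Decidable using (map′; _×-dec_; ¬?; dec⇒maybe)
open import Relation.Unary using (Decidable)
open import Tactic.RingSolver using (solve-∀)
open import Tactic.RingSolver.Core.AlmostCommutativeRing using (AlmostCommutativeRing; fromCommutativeRing)

sublists : ∀ {a} {A : Set a} → List A → List (List A)
sublists []       = [] ∷ []
sublists (x ∷ xs) = map (x ∷_) (sublists xs) ++ sublists xs

-- Every subset of Fin n occurs exactly once in this list, so the sublists of
-- it represent the families of subsets of Fin n, each exactly once.
allSubsets : ∀ n → List (Subset n)
allSubsets zero    = Vec.[] ∷ []
allSubsets (suc n) =
  map (inside Vec.∷_) (allSubsets n) ++ map (outside Vec.∷_) (allSubsets n)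

record IsPartition {n} (π : List (Subset n)) : Set where
  constructor mkIsPartition
  field
    nonempty : All Nonempty π
    disjoint : AllPairs (λ A B → Empty (A ∩ B)) π
    covers   : ∀ (i : Fin n) → Any (i ∈_) π

isPartition? : ∀ {n} → Decidable (IsPartition {n})
isPartition? π = map′
  (λ (a , b , c) → mkIsPartition a b c)
  (λ (mkIsPartition a b c) → a , b , c)
  (all? nonempty? π
    ×-dec allPairs? (λ A B → ¬? (nonempty? (A ∩ B))) π
    ×-dec Fin.all? (λ i → any? (i ∈?_) π))

IsDPartition : ∀ {n} → ℕ → List (Subset n) → Set
IsDPartition k π = IsPartition π × length π ≡ k × All (λ B → 1 ℕ.< ∣ B ∣) π

isDPartition? : ∀ {n} k → Decidable (IsDPartition {n} k)
isDPartition? k π =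
  isPartition? π ×-dec length π ℕ.≟ k ×-dec all? (λ B → 1 ℕ.<? ∣ B ∣) π

D : ℕ → ℕ → ℕ
D n k = length (filter (isDPartition? k) (sublists (allSubsets n)))

-- The sum over k ≥ 1 stops at k = n: a partition of an n-element set has at
-- most n blocks, so D n k = 0 for k > n.
Dpoly : ∀ {c ℓ} (R : RawSemiring c ℓ) → ℕ → RawSemiring.Carrier R → RawSemiring.Carrier R
Dpoly R n x = sum {n} (λ i → let k = suc (toℕ i) in D n k · x ^ k)
  where open SemiringOps R using (sum; _^_) renaming (_×_ to _·_)

IsCauchy : (ℕ → ℚ) → Set
IsCauchy s = ∀ ε → 0ℚ ℚ.< ε →
  ∃[ N ] (∀ m n → N ℕ.≤ m → N ℕ.≤ n → ℚ.∣ s m ℚ.- s n ∣ ℚ.< ε)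

record ℝ : Set where
  no-eta-equality
  constructor mkℝ
  field
    seq    : ℕ → ℚ
    cauchy : IsCauchy seq

open ℝ public

infix 4 _≃_ _≤_

record _≃_ (x y : ℝ) : Set where
  no-eta-equality
  constructor mk≃
  field
    close : ∀ ε → 0ℚ ℚ.< ε → ∃[ N ] (∀ n → N ℕ.≤ n → ℚ.∣ seq x n ℚ.- seq y n ∣ ℚ.< ε)

record _≤_ (x y : ℝ) : Set where
  no-eta-equality
  constructor mk≤
  field
    below : ∀ ε → 0ℚ ℚ.< ε → ∃[ N ] (∀ n → N ℕ.≤ n → seq x n ℚ.< seq y n ℚ.+ ε)

module CauchySequences where
  open import Data.Rational.Base using (_+_; _*_; _-_; -_; _<_)

  ℚ-ring : AlmostCommutativeRing 0ℓ 0ℓ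
  ℚ-ring = fromCommutativeRing ℚ.+-*-commutativeRing (λ q → dec⇒maybe (0ℚ ℚ.≟ q))

  +-sub : ∀ a b c d → (a + b) - (c + d) ≡ (a - c) + (b - d)
  +-sub = solve-∀ ℚ-ring

  *-sub : ∀ a b c d → a * b - c * d ≡ a * (b - d) + d * (a - c)
  *-sub = solve-∀ ℚ-ring

  add-sub : ∀ a b → b + (a - b) ≡ a
  add-sub = solve-∀ ℚ-ring

  sub-add : ∀ a b → (a + b) - a ≡ b
  sub-add = solve-∀ ℚ-ring

  neg-sub : ∀ a b → - (a - b) ≡ b - a
  neg-sub = solve-∀ ℚ-ring

  half-pos : ∀ {ε} → 0ℚ < ε → 0ℚ < ½ * ε
  half-pos {ε} ε>0 = ℚ.positive⁻¹ (½ * ε) {{ℚ.pos*pos⇒pos ½ ε {{ℚ.positive ε>0}}}}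

  halves : ∀ ε → ½ * ε + ½ * ε ≡ ε
  halves ε = trans (sym (ℚ.*-distribʳ-+ ε ½ ½)) (trans (cong (_* ε) ½+½≡1) (ℚ.*-identityˡ ε))
    where
    ½+½≡1 : ½ + ½ ≡ 1ℚ
    ½+½≡1 = refl

  const-cauchy : ∀ q → IsCauchy (λ _ → q)
  const-cauchy q ε ε>0 =
    0 , λ _ _ _ _ → subst (_< ε) (sym (cong ℚ.∣_∣ (ℚ.+-inverseʳ q))) ε>0

  +-cauchy : ∀ {s t} → IsCauchy s → IsCauchy t → IsCauchy (λ n → s n + t n)
  +-cauchy {s} {t} cs ct ε ε>0
    with cs (½ * ε) (half-pos ε>0) | ct (½ * ε) (half-pos ε>0)
  ... | M , f | N , g = M ℕ.⊔ N , λ m n p q →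
    let open ℚ.≤-Reasoning in begin-strict
    ℚ.∣ (s m + t m) - (s n + t n) ∣
      ≡⟨ cong ℚ.∣_∣ (+-sub (s m) (t m) (s n) (t n)) ⟩
    ℚ.∣ (s m - s n) + (t m - t n) ∣
      ≤⟨ ℚ.∣p+q∣≤∣p∣+∣q∣ (s m - s n) (t m - t n) ⟩
    ℚ.∣ s m - s n ∣ + ℚ.∣ t m - t n ∣
      <⟨ ℚ.+-mono-<
           (f m n (ℕ.m⊔n≤o⇒m≤o M N p) (ℕ.m⊔n≤o⇒m≤o M N q))
           (g m n (ℕ.m⊔n≤o⇒n≤o M N p) (ℕ.m⊔n≤o⇒n≤o M N q)) ⟩
    ½ * ε + ½ * ε
      ≡⟨ halves ε ⟩
    ε ∎

  neg-cauchy : ∀ {s} → IsCauchy s → IsCauchy (λ n → - s n)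
  neg-cauchy {s} cs ε ε>0 with cs ε ε>0
  ... | N , f = N , λ m n p q → subst (_< ε)
    (trans (sym (ℚ.∣-p∣≡∣p∣ (s m - s n))) (cong ℚ.∣_∣ (ℚ.neg-distrib-+ (s m) (- s n))))
    (f m n p q)

  ∣p∣≤∣q∣+∣p-q∣ : ∀ p q → ℚ.∣ p ∣ ℚ.≤ ℚ.∣ q ∣ + ℚ.∣ p - q ∣
  ∣p∣≤∣q∣+∣p-q∣ p q = subst (λ r → ℚ.∣ r ∣ ℚ.≤ ℚ.∣ q ∣ + ℚ.∣ p - q ∣)
    (add-sub p q)
    (ℚ.∣p+q∣≤∣p∣+∣q∣ q (p - q))

  ∣p-q∣≡∣q-p∣ : ∀ p q → ℚ.∣ p - q ∣ ≡ ℚ.∣ q - p ∣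
  ∣p-q∣≡∣q-p∣ p q = trans (sym (ℚ.∣-p∣≡∣p∣ (p - q)))
    (cong ℚ.∣_∣ (neg-sub p q))

  ∣p∣-∣q∣≤∣p-q∣ : ∀ p q → ℚ.∣ p ∣ - ℚ.∣ q ∣ ℚ.≤ ℚ.∣ p - q ∣
  ∣p∣-∣q∣≤∣p-q∣ p q = subst (ℚ.∣ p ∣ - ℚ.∣ q ∣ ℚ.≤_)
    (sub-add ℚ.∣ q ∣ ℚ.∣ p - q ∣)
    (ℚ.+-monoˡ-≤ (- ℚ.∣ q ∣) (∣p∣≤∣q∣+∣p-q∣ p q))

  ∣∣p∣-∣q∣∣≤∣p-q∣ : ∀ p q → ℚ.∣ ℚ.∣ p ∣ - ℚ.∣ q ∣ ∣ ℚ.≤ ℚ.∣ p - q ∣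
  ∣∣p∣-∣q∣∣≤∣p-q∣ p q with ℚ.∣p∣≡p∨∣p∣≡-p (ℚ.∣ p ∣ - ℚ.∣ q ∣)
  ... | inj₁ e = subst (ℚ._≤ ℚ.∣ p - q ∣) (sym e) (∣p∣-∣q∣≤∣p-q∣ p q)
  ... | inj₂ e = subst (ℚ._≤ ℚ.∣ p - q ∣)
    (sym (trans e (neg-sub ℚ.∣ p ∣ ℚ.∣ q ∣)))
    (subst (ℚ.∣ q ∣ - ℚ.∣ p ∣ ℚ.≤_) (∣p-q∣≡∣q-p∣ q p) (∣p∣-∣q∣≤∣p-q∣ q p))

  abs-cauchy : ∀ {s} → IsCauchy s → IsCauchy (λ n → ℚ.∣ s n ∣)
  abs-cauchy {s} cs ε ε>0 with cs ε ε>0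
  ... | N , f = N , λ m n p q → ℚ.≤-<-trans (∣∣p∣-∣q∣∣≤∣p-q∣ (s m) (s n)) (f m n p q)

  bounded : ∀ {s} → IsCauchy s →
    ∃[ B ] (Positive B × ∃[ N ] (∀ n → N ℕ.≤ n → ℚ.∣ s n ∣ ℚ.≤ B))
  bounded {s} cs with cs 1ℚ (ℚ.positive⁻¹ 1ℚ)
  ... | N , f = ℚ.∣ s N ∣ + 1ℚ
    , ℚ.nonNeg+pos⇒pos ℚ.∣ s N ∣ {{ℚ.∣-∣-nonNeg (s N)}} 1ℚ
    , N , λ n p → ℚ.≤-trans (∣p∣≤∣q∣+∣p-q∣ (s n) (s N))
        (ℚ.+-monoʳ-≤ ℚ.∣ s N ∣ (ℚ.<⇒≤ (f n N p ℕ.≤-refl)))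

  split : ∀ A B ε → Positive A → Positive B → 0ℚ < ε → ∃[ δ ] (0ℚ < δ × A * δ + B * δ ≡ ε)
  split A B ε A>0 B>0 ε>0 = C⁻¹ * ε , δ>0 , eq
    where
    C>0 : Positive (A + B)
    C>0 = ℚ.pos+pos⇒pos A {{A>0}} B {{B>0}}
    C≢0 : ℚ.NonZero (A + B)
    C≢0 = ℚ.pos⇒nonZero (A + B) {{C>0}}
    C⁻¹ : ℚ
    C⁻¹ = (ℚ.1/ (A + B)) {{C≢0}}
    δ>0 : 0ℚ < C⁻¹ * ε
    δ>0 = ℚ.positive⁻¹ (C⁻¹ * ε)
      {{ℚ.pos*pos⇒pos C⁻¹ {{ℚ.1/pos⇒pos (A + B) {{C>0}}}} ε {{ℚ.positive ε>0}}}}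
    eq : A * (C⁻¹ * ε) + B * (C⁻¹ * ε) ≡ ε
    eq = trans (sym (ℚ.*-distribʳ-+ (C⁻¹ * ε) A B))
      (trans (sym (ℚ.*-assoc (A + B) C⁻¹ ε))
        (trans (cong (_* ε) (ℚ.*-inverseʳ (A + B) {{C≢0}})) (ℚ.*-identityˡ ε)))

  scale : ∀ p q B δ → Positive B → ℚ.∣ p ∣ ℚ.≤ B → ℚ.∣ q ∣ < δ → ℚ.∣ p * q ∣ < B * δ
  scale p q B δ B>0 p≤B q<δ = let open ℚ.≤-Reasoning in begin-strict
    ℚ.∣ p * q ∣         ≡⟨ ℚ.∣p*q∣≡∣p∣*∣q∣ p q ⟩
    ℚ.∣ p ∣ * ℚ.∣ q ∣   ≤⟨ ℚ.*-monoʳ-≤-nonNeg ℚ.∣ q ∣ {{ℚ.∣-∣-nonNeg q}} p≤B ⟩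
    B * ℚ.∣ q ∣         <⟨ ℚ.*-monoʳ-<-pos B {{B>0}} q<δ ⟩
    B * δ               ∎

  *-close : ∀ {A B δ} a b c d → Positive A → Positive B →
    ℚ.∣ a ∣ ℚ.≤ A → ℚ.∣ d ∣ ℚ.≤ B → ℚ.∣ b - d ∣ < δ → ℚ.∣ a - c ∣ < δ →
    ℚ.∣ a * b - c * d ∣ < A * δ + B * δ
  *-close {A} {B} {δ} a b c d A>0 B>0 a≤A d≤B b-d<δ a-c<δ =
    subst (λ r → ℚ.∣ r ∣ < A * δ + B * δ) (sym (*-sub a b c d))
      (ℚ.≤-<-trans (ℚ.∣p+q∣≤∣p∣+∣q∣ (a * (b - d)) (d * (a - c)))
        (ℚ.+-mono-< {ℚ.∣ a * (b - d) ∣} {A * δ} {ℚ.∣ d * (a - c) ∣} {B * δ}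
          (scale a (b - d) A δ A>0 a≤A b-d<δ)
          (scale d (a - c) B δ B>0 d≤B a-c<δ)))

  *-cauchy : ∀ {s t} → IsCauchy s → IsCauchy t → IsCauchy (λ n → s n * t n)
  *-cauchy {s} {t} cs ct ε ε>0 =
    let A , A>0 , K , a   = bounded {s} cs
        B , B>0 , L , b   = bounded {t} ct
        δ , δ>0 , Aδ+Bδ≡ε = split A B ε A>0 B>0 ε>0
        M , f             = cs δ δ>0
        N , g             = ct δ δ>0
    in (K ℕ.⊔ L) ℕ.⊔ (M ℕ.⊔ N) , λ m n p q →
    let pl = ℕ.m⊔n≤o⇒m≤o (K ℕ.⊔ L) (M ℕ.⊔ N) p
        pr = ℕ.m⊔n≤o⇒n≤o (K ℕ.⊔ L) (M ℕ.⊔ N) p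
        ql = ℕ.m⊔n≤o⇒m≤o (K ℕ.⊔ L) (M ℕ.⊔ N) q
        qr = ℕ.m⊔n≤o⇒n≤o (K ℕ.⊔ L) (M ℕ.⊔ N) q
    in subst (ℚ.∣ s m * t m - s n * t n ∣ <_) Aδ+Bδ≡ε
      (*-close {A} {B} {δ} (s m) (t m) (s n) (t n) A>0 B>0
        (a m (ℕ.m⊔n≤o⇒m≤o K L pl)) (b n (ℕ.m⊔n≤o⇒n≤o K L ql))
        (g m n (ℕ.m⊔n≤o⇒n≤o M N pr) (ℕ.m⊔n≤o⇒n≤o M N qr))
        (f m n (ℕ.m⊔n≤o⇒m≤o M N pr) (ℕ.m⊔n≤o⇒m≤o M N qr)))

abstract
  const-isCauchy : ∀ q → IsCauchy (λ _ → q)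
  const-isCauchy = CauchySequences.const-cauchy

  +-isCauchy : ∀ x y → IsCauchy (λ n → seq x n ℚ.+ seq y n)
  +-isCauchy x y = CauchySequences.+-cauchy {seq x} {seq y} (cauchy x) (cauchy y)

  *-isCauchy : ∀ x y → IsCauchy (λ n → seq x n ℚ.* seq y n)
  *-isCauchy x y = CauchySequences.*-cauchy {seq x} {seq y} (cauchy x) (cauchy y)

  neg-isCauchy : ∀ x → IsCauchy (λ n → ℚ.- seq x n)
  neg-isCauchy x = CauchySequences.neg-cauchy {seq x} (cauchy x)

  abs-isCauchy : ∀ x → IsCauchy (λ n → ℚ.∣ seq x n ∣)
  abs-isCauchy x = CauchySequences.abs-cauchy {seq x} (cauchy x)

infixl 6 _+ᴿ_ _-ᴿ_
infixl 7 _*ᴿ_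
infix  8 -ᴿ_

fromℚ : ℚ → ℝ
fromℚ q = mkℝ (λ _ → q) (const-isCauchy q)

_+ᴿ_ _*ᴿ_ : ℝ → ℝ → ℝ
x +ᴿ y = mkℝ (λ n → seq x n ℚ.+ seq y n) (+-isCauchy x y)
x *ᴿ y = mkℝ (λ n → seq x n ℚ.* seq y n) (*-isCauchy x y)

-ᴿ_ : ℝ → ℝ
-ᴿ x = mkℝ (λ n → ℚ.- seq x n) (neg-isCauchy x)

_-ᴿ_ : ℝ → ℝ → ℝ
x -ᴿ y = x +ᴿ (-ᴿ y)

∣_∣ᴿ : ℝ → ℝ
∣ x ∣ᴿ = mkℝ (λ n → ℚ.∣ seq x n ∣) (abs-isCauchy x)

0ᴿ 1ᴿ : ℝ
0ᴿ = fromℚ 0ℚ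
1ᴿ = fromℚ 1ℚ

ℝ-rawSemiring : RawSemiring 0ℓ 0ℓ
ℝ-rawSemiring = record
  { Carrier = ℝ ; _≈_ = _≃_ ; _+_ = _+ᴿ_ ; _*_ = _*ᴿ_ ; 0# = 0ᴿ ; 1# = 1ᴿ }

record _IsSqrtOf_ (s x : ℝ) : Set where
  constructor mkIsSqrtOf
  field
    nonNegative : 0ᴿ ≤ s
    square      : s *ᴿ s ≃ x

record ℂ : Set where
  constructor mkℂ
  field
    re im : ℝ

open ℂ public

ℂ-rawSemiring : RawSemiring 0ℓ 0ℓ
ℂ-rawSemiring = record
  { Carrier = ℂ
  ; _≈_     = λ w z → re w ≃ re z × im w ≃ im z
  ; _+_     = λ w z → mkℂ (re w +ᴿ re z) (im w +ᴿ im z)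
  ; _*_     = λ w z → mkℂ (re w *ᴿ re z -ᴿ im w *ᴿ im z) (re w *ᴿ im z +ᴿ im w *ᴿ re z)
  ; 0#      = mkℂ 0ᴿ 0ᴿ
  ; 1#      = mkℂ 1ᴿ 0ᴿ
  }

IsZero : ∀ {c ℓ} (R : RawSemiring c ℓ) → ℕ → RawSemiring.Carrier R → Set ℓ
IsZero R n x = Dpoly R n x ≈ 0#
  where open RawSemiring R

AllZerosReal : ℕ → Set
AllZerosReal n = ∀ w → IsZero ℂ-rawSemiring n w → im w ≃ 0ᴿ

record IsLeftmostZero (n : ℕ) (z : ℝ) : Set where
  constructor mkIsLeftmostZero
  field
    isZero   : IsZero ℝ-rawSemiring n z
    leftmost : ∀ w → IsZero ℝ-rawSemiring n w → z ≤ w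

-- Quotient of natural numbers, with the value 0 for a zero denominator.  It is
-- only applied to denominators d, d - 1, D n d and d * D n d with d = ⌊n/2⌋ and
-- n ≥ 4, all of which are positive.
infixl 7 _÷_

_÷_ : ℕ → ℕ → ℚ
p ÷ zero  = 0ℚ
p ÷ suc q = (+ p) ℚ./ suc q

{-# OPTIONS --safe #-}

-- Write F_n = D_n(x)/x.  Splitting off the block of one element gives
-- D(n+1,k) = k D(n,k) + n D(n−1,k−1), that is
-- F_{n+1} = (x F_n)′ + n x F_{n−1}.  Inductively F_n has the maximal number of
-- roots 0 > z₀ > z₁ > ⋯, and F_{n−1} has at z_i the same sign (−1)ⁱ as F_n′;
-- hence F_{n+1} alternates in sign along 0, z₀, z₁, ⋯ (and at −∞, when the degree
-- grows), so its roots interlace the z_i and the induction continues.  Bisection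
-- runs on rational points, where signs of rational polynomials are decidable.
-- The resulting factorisation of D_n makes every complex zero real, and the
-- bound is Samuelson's inequality: Cauchy–Schwarz applied to the d − 1 roots
-- other than the leftmost one, with e₁ and e₂ read off the coefficients.

module Submission where

open import Algebra.Bundles using (CommutativeRing; Semiring)

-- The order on Cauchy reals is undecidable, and this shapes the statements. Strict inequalities
-- carry a rational margin (`Pos`); the final bound and the vanishing of imaginary parts come from
-- refuting such a margin. Distinctness of roots is recorded as cancellability of their differences,
-- so splitting off linear factors uses no inverses and works over ℝ and ℂ alike. Calculus is
-- replaced by algebra: the derivative at a root z is the value at z of the quotient by X - z, a
-- double Horner scheme, and continuity appears as an explicit Lipschitz constant. Since signs
-- cannot be tested at the real points z_i, each search for a root starts from rational points close
-- to them. The origin is itself a zero of D_n, which is why d zeros enter Samuelson's inequality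
-- although F_n has degree d - 1. On the combinatorial side, `D` filters sublists of a list of all
-- subsets; its predicate is first replaced by one that can be followed along that list.

-- Associated Stirling numbers and their recurrence

module Counting where

  open import Defs using (D; sublists; allSubsets; mkIsPartition; IsDPartition; isDPartition?)
  open import Algebra.Properties.CommutativeSemigroup using (interchange)
  open import Data.Nat.Base
  open import Data.Nat.Properties
  open import Data.Bool.Base using (Bool; true; false; if_then_else_)
  open import Data.Empty using (⊥-elim)
  open import Data.Fin.Base using (zero; suc)
  open import Data.Fin.Subset using (Subset; inside; outside; _∈_; _∉_; _⊆_; _∩_; _─_; ∣_∣; Nonempty; Empty; ⊤)
  open import Data.Fin.Subset.Properties
  open import Data.List.Base using (List; []; _∷_; _++_; map; filter; length)
  open import Data.List.Properties using (length-++; filter-++; filter-≐; filter-none; map-++; map-∘; map-cong)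
  open import Data.List.Relation.Unary.All as All using (All; []; _∷_)
  open import Data.List.Relation.Unary.AllPairs using (AllPairs; []; _∷_)
  open import Data.List.Relation.Unary.Any using (Any; here; there)
  open import Data.Nat.ListAction using (sum)
  open import Data.Nat.ListAction.Properties using (sum-++)
  open import Data.Product.Base using (_×_; _,_)
  import Data.Vec.Base as Vec
  open import Function.Base using (_∘_)
  open import Relation.Binary.PropositionalEquality
  open import Relation.Nullary using (yes; no; ¬_)
  open import Relation.Nullary.Decidable using (map′; _×-dec_; ¬?)
  open import Relation.Unary using (Pred; Decidable)

  -- S n g is the sum of g ∣B∣ (n − ∣B∣) over all subsets B of an n-element set.
  S : ℕ → (ℕ → ℕ → ℕ) → ℕ
  S zero    g = g 0 0
  S (suc n) g = S n (λ i j → g (suc i) j) + S n (λ i j → g i (suc j))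

  S-cong : ∀ n {f g : ℕ → ℕ → ℕ} → (∀ i j → f i j ≡ g i j) → S n f ≡ S n g
  S-cong zero    e = e 0 0
  S-cong (suc n) e = cong₂ _+_ (S-cong n (λ i j → e (suc i) j)) (S-cong n (λ i j → e i (suc j)))

  S-+ : ∀ n (f g : ℕ → ℕ → ℕ) → S n (λ i j → f i j + g i j) ≡ S n f + S n g
  S-+ zero    f g = refl
  S-+ (suc n) f g = trans
    (cong₂ _+_ (S-+ n (λ i j → f (suc i) j) (λ i j → g (suc i) j))
               (S-+ n (λ i j → f i (suc j)) (λ i j → g i (suc j))))
    (interchange +-commutativeSemigroup (S n (λ i j → f (suc i) j)) (S n (λ i j → g (suc i) j)) _ _)

  S-* : ∀ n c (f : ℕ → ℕ → ℕ) → S n (λ i j → c * f i j) ≡ c * S n f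
  S-* zero    c f = refl
  S-* (suc n) c f = trans
    (cong₂ _+_ (S-* n c (λ i j → f (suc i) j)) (S-* n c (λ i j → f i (suc j))))
    (sym (*-distribˡ-+ c (S n (λ i j → f (suc i) j)) _))

  S-zero : ∀ n → S n (λ _ _ → 0) ≡ 0
  S-zero zero    = refl
  S-zero (suc n) = cong₂ _+_ (S-zero n) (S-zero n)

  -- Both sides run over ordered pairs of disjoint subsets; they differ in which set is chosen
  -- first.
  S-swap : ∀ n (h : ℕ → ℕ → ℕ → ℕ) →
    S n (λ i j → S j (λ i′ → h i i′)) ≡ S n (λ i′ j → S j (λ i → h i i′))
  S-swap zero    h = refl
  S-swap (suc n) h = begin
    S n (λ i j → S j (h (suc i))) + S n (λ i j → S j (λ i′ → h i (suc i′)) + S j (λ i′ k → h i i′ (suc k)))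
      ≡⟨ cong₂ _+_ (S-swap n (λ i → h (suc i))) (S-+ n (λ i j → S j (λ i′ → h i (suc i′))) _) ⟩
    S n (λ i′ j → S j (λ i → h (suc i) i′)) + (S n (λ i j → S j (λ i′ → h i (suc i′))) + S n (λ i j → S j (λ i′ k → h i i′ (suc k))))
      ≡⟨ cong₂ (λ a b → S n (λ i′ j → S j (λ i → h (suc i) i′)) + (a + b))
           (S-swap n (λ i i′ → h i (suc i′))) (S-swap n (λ i i′ k → h i i′ (suc k))) ⟩
    A + (B + C)
      ≡⟨ sym (+-assoc A B C) ⟩
    (A + B) + C
      ≡⟨ cong (_+ C) (+-comm A B) ⟩
    (B + A) + C
      ≡⟨ +-assoc B A C ⟩
    B + (A + C)
      ≡⟨ cong (B +_) (sym (S-+ n (λ i′ j → S j (λ i → h (suc i) i′)) _)) ⟩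
    B + S n (λ i′ j → S j (λ i → h (suc i) i′) + S j (λ i k → h i i′ (suc k)))
      ∎
    where
    open ≡-Reasoning
    -- The pairs in which the added element lies in the first set, in the second, or in neither.
    A B C : ℕ
    A = S n (λ i′ j → S j (λ i → h (suc i) i′))
    B = S n (λ i′ j → S j (λ i → h i (suc i′)))
    C = S n (λ i′ j → S j (λ i k → h i i′ (suc k)))

  -- Iverson brackets used as guards. In `E` the index `i` counts the companions of the fixed
  -- element, so `[ i ≥1]` says that its block has at least two elements.
  [_≥1]_ [_≥2]_ [_≡1]_ : ℕ → ℕ → ℕ
  [ zero  ≥1] x = 0
  [ suc _ ≥1] x = x
  [ zero  ≥2] x = 0
  [ suc i ≥2] x = [ i ≥1] x
  [ 1 ≡1] x = x
  [ _ ≡1] x = 0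

  -- The associated Stirling numbers, by the size of the block of a fixed element.
  E : ℕ → ℕ → ℕ
  E zero    zero    = 1
  E (suc _) zero    = 0
  E zero    (suc _) = 0
  E (suc m) (suc k) = S m (λ i j → [ i ≥1] E j k)

  [≥1]-0 : ∀ i → [ i ≥1] 0 ≡ 0
  [≥1]-0 zero    = refl
  [≥1]-0 (suc i) = refl

  [≥2]-0 : ∀ i → [ i ≥2] 0 ≡ 0
  [≥2]-0 zero    = refl
  [≥2]-0 (suc i) = [≥1]-0 i

  [≥1]-S : ∀ i n f → [ i ≥1] S n f ≡ S n (λ a b → [ i ≥1] f a b)
  [≥1]-S zero    n f = sym (S-zero n)
  [≥1]-S (suc i) n f = refl

  [≥2]-S : ∀ i n f → [ i ≥2] S n f ≡ S n (λ a b → [ i ≥2] f a b)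
  [≥2]-S zero    n f = sym (S-zero n)
  [≥2]-S (suc i) n f = [≥1]-S i n f

  [≥1]-* : ∀ i c x → [ i ≥1] (c * x) ≡ c * [ i ≥1] x
  [≥1]-* zero    c x = sym (*-zeroʳ c)
  [≥1]-* (suc i) c x = refl

  [≥1]-[≥2]-comm : ∀ i j x → [ i ≥2] ([ j ≥1] x) ≡ [ j ≥1] ([ i ≥2] x)
  [≥1]-[≥2]-comm i zero    x = [≥2]-0 i
  [≥1]-[≥2]-comm i (suc j) x = refl

  -- Both sides count partitions with a distinguished block.
  marked-block : ∀ k n → S n (λ i j → [ i ≥2] E j k) ≡ suc k * E n (suc k)
  marked-block k       zero    = sym (*-zeroʳ (suc k))
  marked-block zero    (suc n) = cong (E (suc n) 1 +_)
    (trans (S-cong n (λ i j → [≥2]-0 i)) (S-zero n))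
  -- The split-off summand has the new element in the distinguished block. Otherwise that element
  -- has a block of its own; `S-swap` chooses this one first, and the induction hypothesis applies
  -- to the rest.
  marked-block (suc k) (suc n) = cong (E (suc n) (2 + k) +_) (begin
    S n (λ i j → [ i ≥2] S j (λ i′ j′ → [ i′ ≥1] E j′ k))
      ≡⟨ S-cong n (λ i j → [≥2]-S i j _) ⟩
    S n (λ i j → S j (λ i′ j′ → [ i ≥2] ([ i′ ≥1] E j′ k)))
      ≡⟨ S-swap n (λ i i′ j′ → [ i ≥2] ([ i′ ≥1] E j′ k)) ⟩
    S n (λ i′ j → S j (λ i j′ → [ i ≥2] ([ i′ ≥1] E j′ k)))
      ≡⟨ S-cong n (λ i′ j → trans (S-cong j (λ i j′ → [≥1]-[≥2]-comm i i′ _)) (sym ([≥1]-S i′ j _))) ⟩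
    S n (λ i′ j → [ i′ ≥1] S j (λ i j′ → [ i ≥2] E j′ k))
      ≡⟨ S-cong n (λ i′ j → trans (cong ([ i′ ≥1]_) (marked-block k j)) ([≥1]-* i′ (suc k) _)) ⟩
    S n (λ i′ j → suc k * [ i′ ≥1] E j (suc k))
      ≡⟨ S-* n (suc k) _ ⟩
    suc k * E (suc n) (2 + k) ∎)
    where open ≡-Reasoning

  -- Only singletons contribute; there are `n` of them, each leaving `pred n` elements.
  S-[≡1] : ∀ n (f : ℕ → ℕ) → S n (λ i j → [ i ≡1] f j) ≡ n * f (pred n)
  S-[≡1] zero    f = refl
  S-[≡1] (suc n) f = cong₂ _+_ (S-[≡0] n f) (trans (S-[≡1] n (f ∘ suc)) (lem n))
    where
    S-[≡0] : ∀ n f → S n (λ i j → [ suc i ≡1] f j) ≡ f n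
    S-[≡0] zero    f = refl
    S-[≡0] (suc n) f = trans (cong (_+ S n (λ i j → [ suc i ≡1] f (suc j))) (S-zero n)) (S-[≡0] n (f ∘ suc))
    lem : ∀ n → n * f (suc (pred n)) ≡ n * f n
    lem zero    = refl
    lem (suc n) = refl

  [≥1]-split : ∀ i x → [ i ≥1] x ≡ [ i ≥2] x + [ i ≡1] x
  [≥1]-split 0 x = refl
  [≥1]-split 1 x = refl
  [≥1]-split (suc (suc i)) x = sym (+-identityʳ x)

  -- Delete the fixed element. If it had at least two companions, a partition of the other `n`
  -- elements with one marked block remains; if it had one, their block goes too, and the companion
  -- can be chosen in `n` ways.
  E-rec : ∀ n k → E (suc n) (suc k) ≡ suc k * E n (suc k) + n * E (pred n) k
  E-rec n k = begin
    S n (λ i j → [ i ≥1] E j k)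
      ≡⟨ S-cong n (λ i j → [≥1]-split i (E j k)) ⟩
    S n (λ i j → [ i ≥2] E j k + [ i ≡1] E j k)
      ≡⟨ S-+ n (λ i j → [ i ≥2] E j k) _ ⟩
    S n (λ i j → [ i ≥2] E j k) + S n (λ i j → [ i ≡1] E j k)
      ≡⟨ cong₂ _+_ (marked-block k n) (S-[≡1] n (λ j → E j k)) ⟩
    suc k * E n (suc k) + n * E (pred n) k ∎
    where open ≡-Reasoning

  E-one : ∀ n → E (2 + n) 1 ≡ 1
  E-one zero    = refl
  E-one (suc n) = trans (E-rec (2 + n) 0)
    (cong₂ _+_ (trans (*-identityˡ (E (2 + n) 1)) (E-one n)) (*-zeroʳ n))

  -- Both terms of the recurrence preserve the inequality: one lowers `n` alone, the other lowers
  -- `n` by two and `k` by one.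
  E-vanish : ∀ n k → n < k + k → E n k ≡ 0
  E-vanish zero    (suc k) _ = refl
  E-vanish (suc zero) (suc k) _ = trans (E-rec 0 k) (cong (_+ 0) (*-zeroʳ (suc k)))
  E-vanish (suc (suc n)) (suc k) (s≤s p) = trans (E-rec (suc n) k) (cong₂ _+_
    (trans (cong (suc k *_) (E-vanish (suc n) (suc k) (m≤n⇒m≤1+n p))) (*-zeroʳ (suc k)))
    (trans (cong (suc n *_) (E-vanish n k (≤-pred (subst (suc (suc n) ≤_) (+-suc k k) p)))) (*-zeroʳ (suc n))))

  -- The second term of the recurrence suffices: it adds a block of two elements. The number of
  -- blocks here is the largest possible.
  E-pos : ∀ t → 0 < E (2 + t) (suc ⌊ t /2⌋)
  E-pos zero          = s≤s z≤n
  E-pos (suc zero)    = s≤s z≤n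
  E-pos (suc (suc t)) = subst (0 <_) (sym (E-rec (3 + t) (suc ⌊ t /2⌋)))
    (<-≤-trans (*-mono-≤ {1} {3 + t} (s≤s z≤n) (E-pos t)) (m≤n+m _ ((2 + ⌊ t /2⌋) * E (3 + t) (2 + ⌊ t /2⌋))))

  -- Counting partitions along the list of all subsets

  module _ {a p} {A : Set a} {P : Pred A p} (P? : Decidable P) where

    count : List A → ℕ
    count xs = length (filter P? xs)

    count-++ : ∀ xs ys → count (xs ++ ys) ≡ count xs + count ys
    count-++ xs ys = trans (cong length (filter-++ P? xs ys)) (length-++ (filter P? xs))

    count-none : (∀ x → ¬ P x) → ∀ xs → count xs ≡ 0
    count-none ¬P xs = cong length (filter-none P? (All.universal ¬P xs))

  count-map : ∀ {a b p} {A : Set a} {B : Set b} {P : Pred B p} (P? : Decidable P) (f : A → B) xs →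
    count P? (map f xs) ≡ count (λ x → P? (f x)) xs
  count-map P? f [] = refl
  count-map P? f (x ∷ xs) with P? (f x)
  ... | yes _ = cong suc (count-map P? f xs)
  ... | no  _ = count-map P? f xs

  count-≐ : ∀ {a p q} {A : Set a} {P : Pred A p} {Q : Pred A q} (P? : Decidable P) (Q? : Decidable Q) →
    (∀ x → P x → Q x) → (∀ x → Q x → P x) → ∀ xs → count P? xs ≡ count Q? xs
  count-≐ P? Q? f g xs = cong length (filter-≐ P? Q? ((λ {x} → f x) , (λ {x} → g x)) xs)

  count-[x] : ∀ {a b p q} {A : Set a} {B : Set b} {P : Pred A p} {Q : Pred B q}
    (P? : Decidable P) (Q? : Decidable Q) {x y} → (P x → Q y) → (Q y → P x) →
    count P? (x ∷ []) ≡ count Q? (y ∷ [])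
  count-[x] P? Q? {x} {y} f g with P? x | Q? y
  ... | yes _  | yes _  = refl
  ... | no  _  | no  _  = refl
  ... | yes px | no ¬qy = ⊥-elim (¬qy (f px))
  ... | no ¬px | yes qy = ⊥-elim (¬px (g qy))

  -- Tiles U k π says that the k sets in π form, in this order, a partition of U
  -- into blocks of size at least two.
  data Tiles {n} (U : Subset n) : ℕ → List (Subset n) → Set where
    done  : Empty U → Tiles U 0 []
    place : ∀ {B k π} → B ⊆ U → 1 < ∣ B ∣ → Tiles (U ─ B) k π → Tiles U (suc k) (B ∷ π)

  tiles? : ∀ {n} (U : Subset n) k → Decidable (Tiles U k)
  tiles? U zero    []      = map′ (λ ne → done ne) (λ { (done ne) → ne }) (¬? (nonempty? U))
  tiles? U zero    (B ∷ π) = no λ ()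
  tiles? U (suc k) []      = no λ ()
  tiles? U (suc k) (B ∷ π) = map′ (λ (a , b , c) → place (λ {x} → a {x}) b c) (λ { (place a b c) → (λ {x} → a {x}) , b , c })
    (B ⊆? U ×-dec 1 <? ∣ B ∣ ×-dec tiles? (U ─ B) k π)

  x∈p─q⇒x∉q : ∀ {n} {p q : Subset n} {x} → x ∈ p ─ q → x ∉ q
  x∈p─q⇒x∉q {p = _ Vec.∷ _} {inside  Vec.∷ _} {zero}  ()
  x∈p─q⇒x∉q {p = _ Vec.∷ _} {outside Vec.∷ _} {zero}  _ ()
  x∈p─q⇒x∉q {p = _ Vec.∷ _} {_ Vec.∷ _}       {suc x} (Vec.there i) (Vec.there j) = x∈p─q⇒x∉q i j

  0<∣p∣⇒nonempty : ∀ {n} (p : Subset n) → 0 < ∣ p ∣ → Nonempty p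
  0<∣p∣⇒nonempty (inside  Vec.∷ p) _ = zero , Vec.here
  0<∣p∣⇒nonempty (outside Vec.∷ p) q with 0<∣p∣⇒nonempty p q
  ... | i , i∈p = suc i , Vec.there i∈p

  partition⇒tiles : ∀ {n} {U : Subset n} {π} → AllPairs (λ A B → Empty (A ∩ B)) π →
    All (λ B → 1 < ∣ B ∣) π → All (_⊆ U) π → (∀ i → i ∈ U → Any (i ∈_) π) → Tiles U (length π) π
  partition⇒tiles {π = []} _ _ _ cov = done λ (i , i∈U) → case-[] (cov i i∈U)
    where
    case-[] : ∀ {i} → ¬ Any (i ∈_) []
    case-[] ()
  partition⇒tiles {U = U} {π = B ∷ π} (dB ∷ dis) (sB ∷ size) (B⊆U ∷ sub) cov =
    place B⊆U sB (partition⇒tiles dis size (shrink dB sub) cov′)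
    where
    shrink : ∀ {ρ} → All (λ C → Empty (B ∩ C)) ρ → All (_⊆ U) ρ → All (_⊆ (U ─ B)) ρ
    shrink []       []       = []
    shrink (e ∷ es) (s ∷ ss) =
      (λ i∈C → x∈p∧x∉q⇒x∈p─q (s i∈C) (λ i∈B → e (_ , x∈p∩q⁺ (i∈B , i∈C)))) ∷ shrink es ss
    cov′ : ∀ i → i ∈ U ─ B → Any (i ∈_) π
    cov′ i i∈U─B with cov i (p─q⊆p U B i∈U─B)
    ... | here i∈B = ⊥-elim (x∈p─q⇒x∉q i∈U─B i∈B)
    ... | there c  = c

  module _ {n : ℕ} where

    tiles⇒length : ∀ {U : Subset n} {k π} → Tiles U k π → length π ≡ k
    tiles⇒length (done _)      = refl
    tiles⇒length (place _ _ t) = cong suc (tiles⇒length t)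

    tiles⇒size : ∀ {U : Subset n} {k π} → Tiles U k π → All (λ B → 1 < ∣ B ∣) π
    tiles⇒size (done _)      = []
    tiles⇒size (place _ s t) = s ∷ tiles⇒size t

    tiles⇒⊆ : ∀ {U : Subset n} {k π} → Tiles U k π → All (_⊆ U) π
    tiles⇒⊆ (done _)                  = []
    tiles⇒⊆ {U} (place {B} B⊆U _ t) = B⊆U ∷ All.map widen (tiles⇒⊆ t)
      where
      widen : ∀ {C} → C ⊆ U ─ B → C ⊆ U
      widen s i∈C = p─q⊆p U B (s i∈C)

    tiles⇒disjoint : ∀ {U : Subset n} {k π} → Tiles U k π → AllPairs (λ A B → Empty (A ∩ B)) π
    tiles⇒disjoint (done _)               = []
    tiles⇒disjoint {U} (place {B} _ _ t) = All.map apart (tiles⇒⊆ t) ∷ tiles⇒disjoint t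
      where
      apart : ∀ {C} → C ⊆ U ─ B → Empty (B ∩ C)
      apart {C} s (i , i∈B∩C) = let i∈B , i∈C = x∈p∩q⁻ B C i∈B∩C in x∈p─q⇒x∉q (s i∈C) i∈B

    tiles⇒covers : ∀ {U : Subset n} {k π} → Tiles U k π → ∀ i → i ∈ U → Any (i ∈_) π
    tiles⇒covers (done e) i i∈U = ⊥-elim (e (i , i∈U))
    tiles⇒covers (place {B} _ _ t) i i∈U with i ∈? B
    ... | yes i∈B = here i∈B
    ... | no  i∉B = there (tiles⇒covers t i (x∈p∧x∉q⇒x∈p─q i∈U i∉B))

  tilings : ∀ {n} → List (Subset n) → Subset n → ℕ → ℕ
  tilings L U k = count (tiles? U k) (sublists L)

  -- Peeling off the sets in list order turns the pairwise conditions on a partition into conditions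
  -- relative to the part still uncovered, which recursion on the list can track.
  D≡tilings : ∀ n k → D n k ≡ tilings (allSubsets n) ⊤ k
  D≡tilings n k = count-≐ (isDPartition? k) (tiles? ⊤ k) to from (sublists (allSubsets n))
    where
    top : ∀ B → B ⊆ ⊤
    top _ _ = ∈⊤
    to : ∀ π → IsDPartition k π → Tiles ⊤ k π
    to π (mkIsPartition _ dis cov , len , size) = subst (λ j → Tiles ⊤ j π) len
      (partition⇒tiles dis size (All.universal top π) (λ i _ → cov i))
    from : ∀ π → Tiles ⊤ k π → IsDPartition k π
    from π t = mkIsPartition
        (All.map (λ {B} 1<∣B∣ → 0<∣p∣⇒nonempty B (<⇒≤ 1<∣B∣)) (tiles⇒size t))
        (tiles⇒disjoint t) (λ i → tiles⇒covers t i ∈⊤)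
      , tiles⇒length t , tiles⇒size t

  module _ {n} (B : Subset n) (L : List (Subset n)) (U : Subset n) where

    tilings-∷ : ∀ {k} → tilings (B ∷ L) U k ≡
      count (λ π → tiles? U k (B ∷ π)) (sublists L) + tilings L U k
    tilings-∷ {k} = trans (count-++ (tiles? U k) (map (B ∷_) (sublists L)) (sublists L))
      (cong (_+ tilings L U k) (count-map (tiles? U k) (B ∷_) (sublists L)))

    tilings-fit : ∀ {k} → B ⊆ U → 1 < ∣ B ∣ →
      tilings (B ∷ L) U (suc k) ≡ tilings L (U ─ B) k + tilings L U (suc k)
    tilings-fit {k} s 1< = trans tilings-∷ (cong (_+ tilings L U (suc k))
      (count-≐ (λ π → tiles? U (suc k) (B ∷ π)) (tiles? (U ─ B) k)
        (λ { _ (place _ _ t) → t }) (λ _ → place s 1<) (sublists L)))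

    tilings-unfit : ∀ {k} → ¬ (B ⊆ U × 1 < ∣ B ∣) → tilings (B ∷ L) U k ≡ tilings L U k
    tilings-unfit {k} unfit = trans tilings-∷ (cong (_+ tilings L U k)
      (count-none (λ π → tiles? U k (B ∷ π)) (λ { _ (place s 1< _) → unfit (s , 1<) }) (sublists L)))

    tilings-zero : tilings (B ∷ L) U 0 ≡ tilings L U 0
    tilings-zero = trans tilings-∷ (cong (_+ tilings L U 0)
      (count-none (λ π → tiles? U 0 (B ∷ π)) (λ _ ()) (sublists L)))

  infix 4 _⊑_
  -- A Boolean test that reduces on the two heads, so that the sum in `subset-sum` splits by
  -- computation.
  _⊑_ : ∀ {n} → Subset n → Subset n → Bool
  Vec.[]              ⊑ Vec.[]              = true
  (inside  Vec.∷ B) ⊑ (inside  Vec.∷ U) = B ⊑ U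
  (inside  Vec.∷ B) ⊑ (outside Vec.∷ U) = false
  (outside Vec.∷ B) ⊑ (_       Vec.∷ U) = B ⊑ U

  ⊑⇒⊆ : ∀ {n} (B U : Subset n) → (B ⊑ U) ≡ true → B ⊆ U
  ⊑⇒⊆ (inside  Vec.∷ B) (inside  Vec.∷ U) e Vec.here      = Vec.here
  ⊑⇒⊆ (inside  Vec.∷ B) (inside  Vec.∷ U) e (Vec.there i) = Vec.there (⊑⇒⊆ B U e i)
  ⊑⇒⊆ (outside Vec.∷ B) (_       Vec.∷ U) e (Vec.there i) = Vec.there (⊑⇒⊆ B U e i)

  ⋢⇒⊈ : ∀ {n} (B U : Subset n) → (B ⊑ U) ≡ false → ¬ (B ⊆ U)
  ⋢⇒⊈ Vec.[] Vec.[] ()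
  ⋢⇒⊈ (inside  Vec.∷ B) (inside  Vec.∷ U) e s = ⋢⇒⊈ B U e (drop-∷-⊆ s)
  ⋢⇒⊈ (inside  Vec.∷ B) (outside Vec.∷ U) e s with s Vec.here
  ... | ()
  ⋢⇒⊈ (outside Vec.∷ B) (_       Vec.∷ U) e s = ⋢⇒⊈ B U e (drop-∷-⊆ s)

  module _ {n : ℕ} where

    out : Subset n → Subset (suc n)
    out = outside Vec.∷_

    inn : Subset n → Subset (suc n)
    inn = inside Vec.∷_

    out-⊆ : ∀ {B U : Subset n} {s} → B ⊆ U → out B ⊆ (s Vec.∷ U)
    out-⊆ s (Vec.there i) = Vec.there (s i)

    tilings-out-out : ∀ L (U : Subset n) k → tilings (map out L) (out U) k ≡ tilings L U k
    tilings-out-out [] U k = count-[x] (tiles? (out U) k) (tiles? U k) to from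
      where
      to : Tiles (out U) k [] → Tiles U k []
      to (done e) = done λ (i , i∈U) → e (suc i , Vec.there i∈U)
      from : Tiles U k [] → Tiles (out U) k []
      from (done e) = done λ { (suc i , Vec.there i∈U) → e (i , i∈U) }
    tilings-out-out (B ∷ L) U zero    = trans (tilings-zero (out B) (map out L) (out U))
      (trans (tilings-out-out L U 0) (sym (tilings-zero B L U)))
    tilings-out-out (B ∷ L) U (suc k) with B ⊆? U ×-dec 1 <? ∣ B ∣
    ... | yes (s , 1<) = trans (tilings-fit (out B) (map out L) (out U) (out-⊆ s) 1<)
      (trans (cong₂ _+_ (tilings-out-out L (U ─ B) k) (tilings-out-out L U (suc k))) (sym (tilings-fit B L U s 1<)))
    ... | no unfit = trans (tilings-unfit (out B) (map out L) (out U) (λ (s , 1<) → unfit (drop-∷-⊆ s , 1<)))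
      (trans (tilings-out-out L U (suc k)) (sym (tilings-unfit B L U unfit)))

    tilings-inn-out : ∀ L M (U : Subset n) k → tilings (map inn L ++ M) (out U) k ≡ tilings M (out U) k
    tilings-inn-out []      M U k = refl
    tilings-inn-out (B ∷ L) M U k = trans (tilings-unfit (inn B) (map inn L ++ M) (out U) λ (s , _) → case (s Vec.here))
      (tilings-inn-out L M U k)
      where
      case : ¬ (zero ∈ out U)
      case ()

    tilings-out-inn : ∀ L (U : Subset n) k → tilings (map out L) (inn U) k ≡ 0
    tilings-out-inn [] U k = cong length (filter-none (tiles? (inn U) k) {[] ∷ []} ((λ { (done e) → e (zero , Vec.here) }) ∷ []))
    tilings-out-inn (B ∷ L) U zero = trans (tilings-zero (out B) (map out L) (inn U)) (tilings-out-inn L U 0)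
    tilings-out-inn (B ∷ L) U (suc k) with out B ⊆? inn U ×-dec 1 <? ∣ B ∣
    ... | yes (s , 1<) = trans (tilings-fit (out B) (map out L) (inn U) s 1<) (cong₂ _+_ (tilings-out-inn L (U ─ B) k) (tilings-out-inn L U (suc k)))
    ... | no unfit     = trans (tilings-unfit (out B) (map out L) (inn U) unfit) (tilings-out-inn L U (suc k))

    -- Once a set containing element zero is placed, the other such sets no longer fit and only `M`
    -- is left to choose from. The last summand, in which none is placed, disappears in `tilings≡E`
    -- by `tilings-out-inn`.
    tilings-inn-inn : ∀ L M (U : Subset n) k →
      tilings (map inn L ++ M) (inn U) (suc k) ≡
      sum (map (λ B → if B ⊑ U then [ ∣ B ∣ ≥1] tilings M (out (U ─ B)) k else 0) L) + tilings M (inn U) (suc k)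
    tilings-inn-inn [] M U k = refl
    tilings-inn-inn (B ∷ L) M U k = trans (head (B ⊑ U) refl ∣ B ∣ refl)
      (trans (cong (w +_) (tilings-inn-inn L M U k)) (sym (+-assoc w _ _)))
      where
      w : ℕ
      w = if B ⊑ U then [ ∣ B ∣ ≥1] tilings M (out (U ─ B)) k else 0
      -- Generalising over the inclusion test and the size makes both guards in `w` reduce.
      head : ∀ b → (B ⊑ U) ≡ b → ∀ c → ∣ B ∣ ≡ c →
        tilings (map inn (B ∷ L) ++ M) (inn U) (suc k) ≡
        (if b then [ c ≥1] tilings M (out (U ─ B)) k else 0) + tilings (map inn L ++ M) (inn U) (suc k)
      head false e c       q = tilings-unfit (inn B) (map inn L ++ M) (inn U) λ (s , _) → ⋢⇒⊈ B U e (drop-∷-⊆ s)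
      head true  e zero    q = tilings-unfit (inn B) (map inn L ++ M) (inn U) λ (_ , 1<) → <⇒≢ (≤-pred 1<) (sym q)
      head true  e (suc c) q = trans
        (tilings-fit (inn B) (map inn L ++ M) (inn U) (⊑⇒⊆ (inn B) (inn U) e) (s≤s (subst (1 ≤_) (sym q) (s≤s z≤n))))
        (cong (_+ tilings (map inn L ++ M) (inn U) (suc k)) (tilings-inn-out L M (U ─ B) k))

  tilings-nonempty-zero : ∀ {n} (L : List (Subset n)) U → Nonempty U → tilings L U 0 ≡ 0
  tilings-nonempty-zero []      U ne = cong length (filter-none (tiles? U 0) {[] ∷ []} ((λ { (done e) → e ne }) ∷ []))
  tilings-nonempty-zero (B ∷ L) U ne = trans (tilings-zero B L U) (tilings-nonempty-zero L U ne)

  sum-map-cong : ∀ {a} {A : Set a} {f g : A → ℕ} → (∀ x → f x ≡ g x) → ∀ L → sum (map f L) ≡ sum (map g L)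
  sum-map-cong e L = cong sum (map-cong e L)

  sum-map-++ : ∀ {a b} {A : Set a} {B : Set b} (f : B → ℕ) (g h : A → B) L M →
    sum (map f (map g L ++ map h M)) ≡ sum (map (f ∘ g) L) + sum (map (f ∘ h) M)
  sum-map-++ f g h L M = begin
    sum (map f (map g L ++ map h M))              ≡⟨ cong sum (map-++ f (map g L) (map h M)) ⟩
    sum (map f (map g L) ++ map f (map h M))      ≡⟨ sum-++ (map f (map g L)) _ ⟩
    sum (map f (map g L)) + sum (map f (map h M)) ≡⟨ sym (cong₂ (λ a b → sum a + sum b) (map-∘ L) (map-∘ M)) ⟩
    sum (map (f ∘ g) L) + sum (map (f ∘ h) M)     ∎
    where open ≡-Reasoning

  sum-map-0 : ∀ {a} {A : Set a} (L : List A) → sum (map (λ _ → 0) L) ≡ 0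
  sum-map-0 []      = refl
  sum-map-0 (x ∷ L) = sum-map-0 L

  -- The summand depends on cardinalities only, so `U` enters through its size alone; this is the
  -- link to `S`.
  subset-sum : ∀ {n} (U : Subset n) g →
    sum (map (λ B → if B ⊑ U then g ∣ B ∣ ∣ U ─ B ∣ else 0) (allSubsets n)) ≡ S ∣ U ∣ g
  subset-sum Vec.[] g = +-identityʳ (g 0 0)
  subset-sum {suc n} (inside Vec.∷ U) g = trans (sum-map-++ _ inn out (allSubsets n) (allSubsets n))
    (cong₂ _+_ (subset-sum U (λ i j → g (suc i) j)) (subset-sum U (λ i j → g i (suc j))))
  subset-sum {suc n} (outside Vec.∷ U) g = trans (sum-map-++ _ inn out (allSubsets n) (allSubsets n))
    (cong₂ _+_ (sum-map-0 (allSubsets n)) (subset-sum U g))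

  -- Stated for every `U`, because removing a block from `⊤` leaves an arbitrary subset.
  tilings≡E : ∀ n (U : Subset n) k → tilings (allSubsets n) U k ≡ E ∣ U ∣ k
  tilings≡E zero Vec.[] zero    = refl
  tilings≡E zero Vec.[] (suc k) = tilings-unfit Vec.[] [] Vec.[] {suc k} (λ { (_ , ()) })
  tilings≡E (suc n) (outside Vec.∷ U) k = trans (tilings-inn-out (allSubsets n) _ U k)
    (trans (tilings-out-out (allSubsets n) U k) (tilings≡E n U k))
  tilings≡E (suc n) (inside Vec.∷ U) zero = tilings-nonempty-zero (allSubsets (suc n)) _ (zero , Vec.here)
  tilings≡E (suc n) (inside Vec.∷ U) (suc k) = begin
    tilings (allSubsets (suc n)) (inn U) (suc k)
      ≡⟨ tilings-inn-inn (allSubsets n) M U k ⟩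
    sum (map (λ B → if B ⊑ U then [ ∣ B ∣ ≥1] tilings M (out (U ─ B)) k else 0) (allSubsets n)) + tilings M (inn U) (suc k)
      ≡⟨ cong₂ _+_ (sum-map-cong (λ B → cong (λ t → if B ⊑ U then [ ∣ B ∣ ≥1] t else 0)
           (trans (tilings-out-out (allSubsets n) (U ─ B) k) (tilings≡E n (U ─ B) k))) (allSubsets n))
           (tilings-out-inn (allSubsets n) U (suc k)) ⟩
    sum (map (λ B → if B ⊑ U then [ ∣ B ∣ ≥1] E ∣ U ─ B ∣ k else 0) (allSubsets n)) + 0
      ≡⟨ +-identityʳ _ ⟩
    sum (map (λ B → if B ⊑ U then [ ∣ B ∣ ≥1] E ∣ U ─ B ∣ k else 0) (allSubsets n))
      ≡⟨ subset-sum U (λ i j → [ i ≥1] E j k) ⟩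
    S ∣ U ∣ (λ i j → [ i ≥1] E j k) ∎
    where
    open ≡-Reasoning
    M : List (Subset (suc n))
    M = map out (allSubsets n)

  D≡E : ∀ n k → D n k ≡ E n k
  D≡E n k = trans (D≡tilings n k) (trans (tilings≡E n ⊤ k) (cong (λ m → E m k) (∣⊤∣≡n n)))

-- Polynomial division, factorisation and symmetric functions over a commutative ring

module Horner {c ℓ} (R : CommutativeRing c ℓ) where

  open import Data.Fin.Base using (toℕ)
  open import Data.Nat.Base as ℕ using (ℕ; zero; suc; _∸_; _≤_; _<_; z≤n; s≤s)
  import Data.Nat.Properties as ℕ
  open import Data.Product.Base using (_×_; _,_)
  open import Function.Base using (_∘_)
  open import Level using (_⊔_)
  import Relation.Binary.PropositionalEquality as ≡
  open CommutativeRing R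
  open import Algebra.Definitions.RawSemiring (Semiring.rawSemiring semiring) using (sum; _^_) renaming (_×_ to _·_)
  open import Algebra.Properties.Monoid.Mult +-monoid using (×-congʳ)
  open import Algebra.Properties.Semiring.Mult semiring using (×-comm-*)
  open import Algebra.Solver.Ring.NaturalCoefficients.Default commutativeSemiring using (solve; _:=_; _:+_; _:*_; con)
  open import Relation.Binary.Reasoning.Setoid setoid

  -- The value at x of p 0 xᵐ + p 1 xᵐ⁻¹ + ⋯ + p m: coefficients are listed from
  -- the top.  Consequently horner p z is itself the coefficient sequence of the
  -- quotient by X − z.
  horner : (ℕ → Carrier) → Carrier → ℕ → Carrier
  horner p x zero    = p 0
  horner p x (suc m) = x * horner p x m + p (suc m)

  horner-cong : ∀ {p q x y} m → (∀ j → j ≤ m → p j ≈ q j) → x ≈ y → horner p x m ≈ horner q y m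
  horner-cong zero    e x≈y = e 0 z≤n
  horner-cong (suc m) e x≈y = +-cong
    (*-cong x≈y (horner-cong m (λ j j≤m → e j (ℕ.m≤n⇒m≤1+n j≤m)) x≈y)) (e (suc m) ℕ.≤-refl)

  horner-divide : ∀ p x z m →
    horner p x (suc m) ≈ (x - z) * horner (horner p z) x m + horner p z (suc m)
  horner-divide p x z m = trans (horner-cong (suc m) (λ _ _ → refl) x≈)
    (trans (shifted m) (+-congʳ (*-congˡ (horner-cong m (λ _ _ → refl) (sym x≈)))))
    where
    w : Carrier
    w = x - z
    x≈ : x ≈ w + z
    x≈ = sym (trans (+-assoc x (- z) z) (trans (+-congˡ (-‿inverseˡ z)) (+-identityʳ x)))
    -- Written with `w + z` in place of `x`, the identity has no subtraction, and the semiring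
    -- solver applies.
    shifted : ∀ m → horner p (w + z) (suc m) ≈ w * horner (horner p z) (w + z) m + horner p z (suc m)
    shifted zero    = solve 4 (λ w z a b → (w :+ z) :* a :+ b := w :* a :+ (z :* a :+ b)) refl w z (p 0) (p 1)
    shifted (suc m) = trans (+-congʳ (*-congˡ (shifted m)))
      (solve 5 (λ w z q h b → (w :+ z) :* (w :* q :+ h) :+ b := w :* ((w :+ z) :* q :+ h) :+ (z :* h :+ b)) refl
        w z (horner (horner p z) (w + z) m) (horner p z (suc m)) (p (suc (suc m))))

  -- What factoring asks of the difference of two roots; it stands in for invertibility or apartness
  -- in a general commutative ring.
  Cancellable : Carrier → Set _
  Cancellable a = ∀ b → a * b ≈ 0# → b ≈ 0#

  quotient-root : ∀ p {y z} m → horner p z (suc m) ≈ 0# → horner p y (suc m) ≈ 0# →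
    Cancellable (y - z) → horner (horner p z) y m ≈ 0#
  quotient-root p {y} {z} m pz py can = can _ (begin
    (y - z) * horner (horner p z) y m                       ≈⟨ +-identityʳ _ ⟨
    (y - z) * horner (horner p z) y m + 0#                  ≈⟨ +-congˡ pz ⟨
    (y - z) * horner (horner p z) y m + horner p z (suc m)  ≈⟨ horner-divide p y z m ⟨
    horner p y (suc m)                                      ≈⟨ py ⟩
    0# ∎)

  prod : (ℕ → Carrier) → ℕ → Carrier → Carrier
  prod z zero    x = 1#
  prod z (suc m) x = prod z m x * (x - z m)

  record Roots (p z : ℕ → Carrier) (m : ℕ) : Set (c ⊔ ℓ) where
    constructor mkRoots
    field
      root        : ∀ j → j < m → horner p (z j) m ≈ 0#
      cancellable : ∀ i j → i < j → j < m → Cancellable (z i - z j)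

  quotient-roots : ∀ {p z m} → Roots p z (suc m) → Roots (horner p (z m)) z m
  quotient-roots {p} {z} {m} (mkRoots root can) = mkRoots
    (λ j j<m → quotient-root p m (root m ℕ.≤-refl) (root j (ℕ.m≤n⇒m≤1+n j<m)) (can j m j<m ℕ.≤-refl))
    (λ i j i<j j<m → can i j i<j (ℕ.m≤n⇒m≤1+n j<m))

  factor : ∀ {p z m} → Roots p z m → ∀ x → horner p x m ≈ p 0 * prod z m x
  factor {p} {z} {zero}  _  x = sym (*-identityʳ (p 0))
  factor {p} {z} {suc m} rs x = begin
    horner p x (suc m)
      ≈⟨ horner-divide p x (z m) m ⟩
    (x - z m) * horner (horner p (z m)) x m + horner p (z m) (suc m)
      ≈⟨ +-cong (*-congˡ (factor (quotient-roots rs) x)) (Roots.root rs m ℕ.≤-refl) ⟩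
    (x - z m) * (p 0 * prod z m x) + 0#
      ≈⟨ lemma (x - z m) (p 0) (prod z m x) ⟩
    p 0 * (prod z m x * (x - z m)) ∎
    where
    lemma : ∀ a b d → a * (b * d) + 0# ≈ b * (d * a)
    lemma = solve 3 (λ a b d → a :* (b :* d) :+ con 0 := b :* (d :* a)) refl

  e₁ e₂ p₂ : (ℕ → Carrier) → ℕ → Carrier
  e₁ z zero    = 0#
  e₁ z (suc m) = e₁ z m + z m
  e₂ z zero    = 0#
  e₂ z (suc m) = e₂ z m + z m * e₁ z m
  p₂ z zero    = 0#
  p₂ z (suc m) = p₂ z m + z m * z m

  newton₂ : ∀ z m → e₁ z m * e₁ z m ≈ p₂ z m + (e₂ z m + e₂ z m)
  newton₂ z zero    = lemma
    where
    lemma : 0# * 0# ≈ 0# + (0# + 0#)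
    lemma = solve 0 (con 0 :* con 0 := con 0 :+ (con 0 :+ con 0)) refl
  newton₂ z (suc m) = begin
    (e₁ z m + z m) * (e₁ z m + z m)
      ≈⟨ lemma₁ (e₁ z m) (z m) ⟩
    e₁ z m * e₁ z m + (z m * z m + (z m * e₁ z m + z m * e₁ z m))
      ≈⟨ +-congʳ (newton₂ z m) ⟩
    (p₂ z m + (e₂ z m + e₂ z m)) + (z m * z m + (z m * e₁ z m + z m * e₁ z m))
      ≈⟨ lemma₂ (p₂ z m) (e₂ z m) (z m * z m) (z m * e₁ z m) ⟩
    (p₂ z m + z m * z m) + ((e₂ z m + z m * e₁ z m) + (e₂ z m + z m * e₁ z m)) ∎
    where
    lemma₁ : ∀ a b → (a + b) * (a + b) ≈ a * a + (b * b + (b * a + b * a))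
    lemma₁ = solve 2 (λ a b → (a :+ b) :* (a :+ b) := a :* a :+ (b :* b :+ (b :* a :+ b :* a))) refl
    lemma₂ : ∀ a b d e → (a + (b + b)) + (d + (e + e)) ≈ (a + d) + ((b + e) + (b + e))
    lemma₂ = solve 4 (λ a b d e → (a :+ (b :+ b)) :+ (d :+ (e :+ e)) := (a :+ d) :+ ((b :+ e) :+ (b :+ e))) refl

  -- The vanishing hypothesis gives `p 1` and `p 2` their meaning when `m` is below two. The
  -- quotient inherits it: its entry at `suc m` is the remainder, zero, and each later entry is
  -- `z m` times the previous one plus zero.
  vieta : ∀ {p z m} → Roots p z m → (∀ j → m < j → p j ≈ 0#) →
    p 1 + p 0 * e₁ z m ≈ 0# × p 2 ≈ p 0 * e₂ z m
  vieta {p} {z} {zero} rs van =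
      trans (+-cong (van 1 (s≤s z≤n)) (zeroʳ (p 0))) (+-identityˡ 0#)
    , trans (van 2 (s≤s z≤n)) (sym (zeroʳ (p 0)))
  vieta {p} {z} {suc m} rs van with vieta (quotient-roots rs) van′
    where
    van″ : ∀ i → horner p (z m) (i ℕ.+ suc m) ≈ 0#
    van″ zero    = Roots.root rs m ℕ.≤-refl
    van″ (suc i) = trans (+-cong (trans (*-congˡ (van″ i)) (zeroʳ (z m))) (van _ (s≤s (ℕ.m≤n+m (suc m) i))))
      (+-identityˡ 0#)
    van′ : ∀ j → m < j → horner p (z m) j ≈ 0#
    van′ j m<j = ≡.subst (λ k → horner p (z m) k ≈ 0#) (ℕ.m∸n+n≡m m<j) (van″ (j ∸ suc m))
  ... | h₁ , h₂ = trans
      (solve 4 (λ t a b s → b :+ a :* (s :+ t) := (t :* a :+ b) :+ a :* s) refl t (p 0) (p 1) (e₁ z m)) h₁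
    , (begin
    p 2
      ≈⟨ +-identityʳ (p 2) ⟨
    p 2 + 0#
      ≈⟨ +-congˡ (trans (*-congˡ h₁) (zeroʳ t)) ⟨
    p 2 + t * (q₁ + p 0 * e₁ z m)
      ≈⟨ solve 5 (λ t a q b s → b :+ t :* (q :+ a :* s) := (t :* q :+ b) :+ a :* (t :* s)) refl t (p 0) q₁ (p 2) (e₁ z m) ⟩
    (t * q₁ + p 2) + p 0 * (t * e₁ z m)
      ≈⟨ +-congʳ h₂ ⟩
    p 0 * e₂ z m + p 0 * (t * e₁ z m)
      ≈⟨ distribˡ (p 0) (e₂ z m) (t * e₁ z m) ⟨
    p 0 * (e₂ z m + t * e₁ z m) ∎)
    where
    t q₁ : Carrier
    t  = z m
    q₁ = t * p 0 + p 1

  -- Indexing coefficients by the power allows polynomials of different degrees, padded with zeros,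
  -- to be added termwise; the top-down indexing of `horner` does not.
  ascending : (ℕ → Carrier) → ℕ → Carrier → Carrier
  ascending a zero    x = 0#
  ascending a (suc n) x = a 0 + x * ascending (a ∘ suc) n x

  ascending-cong : ∀ {a b} n x → (∀ i → a i ≈ b i) → ascending a n x ≈ ascending b n x
  ascending-cong zero    x e = refl
  ascending-cong (suc n) x e = +-cong (e 0) (*-congˡ (ascending-cong n x (e ∘ suc)))

  ascending-+ : ∀ a b n x → ascending (λ i → a i + b i) n x ≈ ascending a n x + ascending b n x
  ascending-+ a b zero    x = sym (+-identityˡ 0#)
  ascending-+ a b (suc n) x = trans (+-congˡ (*-congˡ (ascending-+ (a ∘ suc) (b ∘ suc) n x)))
    (lemma (a 0) (b 0) x (ascending (a ∘ suc) n x) (ascending (b ∘ suc) n x))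
    where
    lemma : ∀ a b x p q → (a + b) + x * (p + q) ≈ (a + x * p) + (b + x * q)
    lemma = solve 5 (λ a b x p q → (a :+ b) :+ x :* (p :+ q) := (a :+ x :* p) :+ (b :+ x :* q)) refl

  ascending-0 : ∀ a n x → (∀ i → a i ≈ 0#) → ascending a n x ≈ 0#
  ascending-0 a zero    x e = refl
  ascending-0 a (suc n) x e = trans (+-cong (e 0) (trans (*-congˡ (ascending-0 (a ∘ suc) n x (e ∘ suc))) (zeroʳ x)))
    (+-identityˡ 0#)

  ascending-· : ∀ k a n x → ascending (λ i → k · a i) n x ≈ k · ascending a n x
  ascending-· zero    a n x = ascending-0 (λ _ → 0#) n x (λ _ → refl)
  ascending-· (suc k) a n x = trans (ascending-+ a (λ i → k · a i) n x) (+-congˡ (ascending-· k a n x))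

  ascending-truncate : ∀ a m k x → (∀ i → m ≤ i → a i ≈ 0#) → ascending a (m ℕ.+ k) x ≈ ascending a m x
  ascending-truncate a zero    k x e = ascending-0 a k x (λ i → e i z≤n)
  ascending-truncate a (suc m) k x e =
    +-congˡ (*-congˡ (ascending-truncate (a ∘ suc) m k x (λ i m≤i → e (suc i) (s≤s m≤i))))

  ascending≈horner : ∀ a m x → ascending a (suc m) x ≈ horner (λ j → a (m ∸ j)) x m
  ascending≈horner a zero    x = trans (+-congˡ (zeroʳ x)) (+-identityʳ (a 0))
  ascending≈horner a (suc m) x = begin
    a 0 + x * ascending (a ∘ suc) (suc m) x
      ≈⟨ +-comm _ _ ⟩
    x * ascending (a ∘ suc) (suc m) x + a 0
      ≈⟨ +-cong (*-congˡ (ascending≈horner (a ∘ suc) m x)) (reflexive (≡.cong a (≡.sym (ℕ.n∸n≡0 m)))) ⟩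
    x * horner (λ j → a (suc (m ∸ j))) x m + a (m ∸ m)
      ≈⟨ +-congʳ (*-congˡ (horner-cong m (λ j j≤m → reflexive (≡.cong a (≡.sym (ℕ.+-∸-assoc 1 j≤m)))) refl)) ⟩
    x * horner (λ j → a (suc m ∸ j)) x m + a (m ∸ m) ∎

  -- The left-hand side is the derivative of X · ascending a (suc m).
  derivative≈horner² : ∀ a m x →
    ascending (λ i → suc i · a i) (suc m) x ≈ horner (horner (λ j → a (m ∸ j)) x) x m
  derivative≈horner² a zero x = lemma (a 0) x
    where
    lemma : ∀ a x → (a + 0#) + x * 0# ≈ a
    lemma = solve 2 (λ a x → (a :+ con 0) :+ x :* con 0 := a) refl
  derivative≈horner² a (suc m) x = begin
    (a 0 + 0#) + x * ascending (λ i → suc (suc i) · a (suc i)) (suc m) x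
      ≈⟨ +-congˡ (*-congˡ (ascending-+ (a ∘ suc) (λ i → suc i · a (suc i)) (suc m) x)) ⟩
    (a 0 + 0#) + x * (ascending (a ∘ suc) (suc m) x + ascending (λ i → suc i · a (suc i)) (suc m) x)
      ≈⟨ lemma (a 0) x (ascending (a ∘ suc) (suc m) x) _ ⟩
    x * ascending (λ i → suc i · a (suc i)) (suc m) x + ascending a (suc (suc m)) x
      ≈⟨ +-cong (*-congˡ (derivative≈horner² (a ∘ suc) m x)) (ascending≈horner a (suc m) x) ⟩
    x * horner (horner (λ j → a (suc (m ∸ j))) x) x m + horner (λ j → a (suc m ∸ j)) x (suc m)
      ≈⟨ +-congʳ (*-congˡ (horner-cong m (λ k k≤m → horner-cong k
           (λ j j≤k → reflexive (≡.cong a (≡.sym (ℕ.+-∸-assoc 1 (ℕ.≤-trans j≤k k≤m))))) refl) refl)) ⟩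
    horner (horner (λ j → a (suc m ∸ j)) x) x (suc m) ∎
    where
    lemma : ∀ a x p q → (a + 0#) + x * (p + q) ≈ x * q + (a + x * p)
    lemma = solve 4 (λ a x p q → (a :+ con 0) :+ x :* (p :+ q) := x :* q :+ (a :+ x :* p)) refl

  sum≈ascending : ∀ n (k : ℕ → ℕ) (u : ℕ → Carrier) x → (∀ i → u (suc i) ≈ x * u i) →
    sum {n} (λ i → k (toℕ i) · u (toℕ i)) ≈ u 0 * ascending (λ i → k i · 1#) n x
  sum≈ascending zero    k u x step = sym (zeroʳ (u 0))
  sum≈ascending (suc n) k u x step = begin
    k 0 · u 0 + sum {n} (λ i → k (suc (toℕ i)) · u (suc (toℕ i)))
      ≈⟨ +-cong (trans (×-congʳ (k 0) (sym (*-identityʳ (u 0)))) (sym (×-comm-* (k 0) (u 0) 1#)))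
           (sum≈ascending n (k ∘ suc) (u ∘ suc) x (step ∘ suc)) ⟩
    u 0 * (k 0 · 1#) + u 1 * ascending (λ i → k (suc i) · 1#) n x
      ≈⟨ +-congˡ (*-congʳ (step 0)) ⟩
    u 0 * (k 0 · 1#) + (x * u 0) * ascending (λ i → k (suc i) · 1#) n x
      ≈⟨ lemma (u 0) (k 0 · 1#) x _ ⟩
    u 0 * (k 0 · 1# + x * ascending (λ i → k (suc i) · 1#) n x) ∎
    where
    lemma : ∀ u a x b → u * a + (x * u) * b ≈ u * (a + x * b)
    lemma = solve 4 (λ u a x b → u :* a :+ (x :* u) :* b := u :* (a :+ x :* b)) refl

-- Cauchy reals: ring structure, strict positivity, roots of rational polynomials

module RealAnalysis where

  open import Defs hiding (_≤_; D; Dpoly)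
  open CauchySequences using (ℚ-ring; halves; half-pos; bounded; split; *-close; ∣p-q∣≡∣q-p∣; ∣p∣≤∣q∣+∣p-q∣)
  open import Algebra.Structures using (IsCommutativeRing)
  open import Data.Empty using (⊥-elim)
  open import Data.Nat.Base as ℕ using (ℕ; zero; suc)
  import Data.Nat.Properties as ℕ
  open import Data.Product.Base using (_×_; _,_; ∃-syntax; proj₁; proj₂; Σ-syntax)
  open import Data.Rational.Base hiding (_≃_; _÷_)
  open import Data.Rational.Properties hiding (≃-sym)
  open import Data.Sum.Base using (inj₁; inj₂)
  open import Level using (0ℓ)
  open import Relation.Binary.PropositionalEquality
  open import Relation.Nullary using (¬_; yes; no)
  open import Tactic.RingSolver using (solve-∀)
  open import Algebra.Definitions.RawMonoid using () renaming (_×_ to multiple)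
  open import Data.Integer.Base as ℤ using (-[1+_])
  import Data.Integer.Properties as ℤ
  import Data.Rational.Unnormalised.Base as ℚᵘ
  import Data.Rational.Unnormalised.Properties as ℚᵘ
  open import Function.Base using (_∘_)

  -- Inequalities are proved by exhibiting the difference of the two sides as a
  -- nonnegative (positive) expression.
  ≤-by : ∀ {p q} r → 0ℚ ≤ r → p + r ≡ q → p ≤ q
  ≤-by {p} r 0≤r e = subst₂ _≤_ (+-identityʳ p) e (+-monoʳ-≤ p 0≤r)

  <-by : ∀ {p q} r → 0ℚ < r → p + r ≡ q → p < q
  <-by {p} r 0<r e = subst₂ _<_ (+-identityʳ p) e (+-monoʳ-< p 0<r)

  p<q⇒0<q-p : ∀ {p q} → p < q → 0ℚ < q - p
  p<q⇒0<q-p {p} {q} h = subst (_< q - p) (+-inverseʳ p) (+-monoˡ-< (- p) h)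

  p≤q⇒0≤q-p : ∀ {p q} → p ≤ q → 0ℚ ≤ q - p
  p≤q⇒0≤q-p {p} {q} h = subst (_≤ q - p) (+-inverseʳ p) (+-monoˡ-≤ (- p) h)

  0<+ : ∀ {p q} → 0ℚ < p → 0ℚ < q → 0ℚ < p + q
  0<+ = +-mono-<

  0≤+ : ∀ {p q} → 0ℚ ≤ p → 0ℚ ≤ q → 0ℚ ≤ p + q
  0≤+ = +-mono-≤

  0<* : ∀ {p q} → 0ℚ < p → 0ℚ < q → 0ℚ < p * q
  0<* {p} {q} a b = positive⁻¹ (p * q) {{pos*pos⇒pos p {{positive a}} q {{positive b}}}}

  0≤* : ∀ {p q} → 0ℚ ≤ p → 0ℚ ≤ q → 0ℚ ≤ p * q
  0≤* {p} {q} a b = nonNegative⁻¹ (p * q) {{nonNeg*nonNeg⇒nonNeg p {{nonNegative a}} q {{nonNegative b}}}}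

  *-mono-≤ : ∀ {p q r s} → 0ℚ ≤ p → p ≤ q → 0ℚ ≤ r → r ≤ s → p * r ≤ q * s
  *-mono-≤ {p} {q} {r} {s} 0≤p p≤q 0≤r r≤s = ≤-trans
    (*-monoʳ-≤-nonNeg r {{nonNegative 0≤r}} p≤q)
    (*-monoˡ-≤-nonNeg q {{nonNegative (≤-trans 0≤p p≤q)}} r≤s)

  0<½ : 0ℚ < ½
  0<½ = positive⁻¹ ½

  0<1 : 0ℚ < 1ℚ
  0<1 = positive⁻¹ 1ℚ

  p≤∣p∣ : ∀ p → p ≤ ∣ p ∣
  p≤∣p∣ p with ≤-total 0ℚ p
  ... | inj₁ 0≤p = ≤-reflexive (sym (0≤p⇒∣p∣≡p 0≤p))
  ... | inj₂ p≤0 = ≤-trans p≤0 (0≤∣p∣ p)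

  -p≤∣p∣ : ∀ p → - p ≤ ∣ p ∣
  -p≤∣p∣ p = subst (- p ≤_) (∣-p∣≡∣p∣ p) (p≤∣p∣ (- p))

  ∣p∣<⁺ : ∀ {p q} → p < q → - p < q → ∣ p ∣ < q
  ∣p∣<⁺ {p} {q} a b with ∣p∣≡p∨∣p∣≡-p p
  ... | inj₁ e = subst (_< q) (sym e) a
  ... | inj₂ e = subst (_< q) (sym e) b

  ∣p∣≤⁺ : ∀ {p q} → p ≤ q → - p ≤ q → ∣ p ∣ ≤ q
  ∣p∣≤⁺ {p} {q} a b with ∣p∣≡p∨∣p∣≡-p p
  ... | inj₁ e = subst (_≤ q) (sym e) a
  ... | inj₂ e = subst (_≤ q) (sym e) b

  0≤p² : ∀ p → 0ℚ ≤ p * p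
  0≤p² p with ≤-total 0ℚ p
  ... | inj₁ 0≤p = 0≤* 0≤p 0≤p
  ... | inj₂ p≤0 = subst (0ℚ ≤_) (lemma p) (0≤* (p≤q⇒0≤q-p p≤0) (p≤q⇒0≤q-p p≤0))
    where
    lemma : ∀ p → (0ℚ - p) * (0ℚ - p) ≡ p * p
    lemma = solve-∀ ℚ-ring

  Eventually : (ℕ → Set) → Set
  Eventually P = ∃[ N ] (∀ n → N ℕ.≤ n → P n)

  eventually-map : ∀ {P Q : ℕ → Set} → (∀ n → P n → Q n) → Eventually P → Eventually Q
  eventually-map f (N , h) = N , λ n N≤n → f n (h n N≤n)

  eventually-map₂ : ∀ {P Q R : ℕ → Set} → (∀ n → P n → Q n → R n) → Eventually P → Eventually Q → Eventually R
  eventually-map₂ f (M , g) (N , h) = M ℕ.⊔ N , λ n l →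
    f n (g n (ℕ.m⊔n≤o⇒m≤o M N l)) (h n (ℕ.m⊔n≤o⇒n≤o M N l))

  open _≃_ using (close)

  pointwise : ∀ {x y} → (∀ n → seq x n ≡ seq y n) → x ≃ y
  pointwise {x} {y} e = mk≃ λ ε 0<ε → 0 , λ n _ → subst (_< ε)
    (sym (cong ∣_∣ (trans (cong (_- seq y n) (e n)) (+-inverseʳ (seq y n))))) 0<ε

  ≃-refl : ∀ {x} → x ≃ x
  ≃-refl = pointwise λ _ → refl

  ≃-sym : ∀ {x y} → x ≃ y → y ≃ x
  ≃-sym {x} {y} h = mk≃ λ ε 0<ε →
    eventually-map (λ n → subst (_< ε) (∣p-q∣≡∣q-p∣ (seq x n) (seq y n))) (close h ε 0<ε)

  ≃-trans : ∀ {x y z} → x ≃ y → y ≃ z → x ≃ z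
  ≃-trans {x} {y} {z} f g = mk≃ λ ε 0<ε →
    eventually-map₂ (λ n a b → begin-strict
      ∣ seq x n - seq z n ∣                          ≡⟨ cong ∣_∣ (lemma (seq x n) (seq y n) (seq z n)) ⟩
      ∣ (seq x n - seq y n) + (seq y n - seq z n) ∣  ≤⟨ ∣p+q∣≤∣p∣+∣q∣ (seq x n - seq y n) (seq y n - seq z n) ⟩
      ∣ seq x n - seq y n ∣ + ∣ seq y n - seq z n ∣  <⟨ +-mono-< a b ⟩
      ½ * ε + ½ * ε                                  ≡⟨ halves ε ⟩
      ε                                              ∎)
    (close f (½ * ε) (half-pos 0<ε)) (close g (½ * ε) (half-pos 0<ε))
    where
    open ≤-Reasoning
    lemma : ∀ a b c → a - c ≡ (a - b) + (b - c)
    lemma = solve-∀ ℚ-ring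

  +ᴿ-cong : ∀ {x y u v} → x ≃ y → u ≃ v → x +ᴿ u ≃ y +ᴿ v
  +ᴿ-cong {x} {y} {u} {v} f g = mk≃ λ ε 0<ε →
    eventually-map₂ (λ n a b → begin-strict
      ∣ (seq x n + seq u n) - (seq y n + seq v n) ∣  ≡⟨ cong ∣_∣ (lemma (seq x n) (seq y n) (seq u n) (seq v n)) ⟩
      ∣ (seq x n - seq y n) + (seq u n - seq v n) ∣  ≤⟨ ∣p+q∣≤∣p∣+∣q∣ (seq x n - seq y n) (seq u n - seq v n) ⟩
      ∣ seq x n - seq y n ∣ + ∣ seq u n - seq v n ∣  <⟨ +-mono-< a b ⟩
      ½ * ε + ½ * ε                                  ≡⟨ halves ε ⟩
      ε                                              ∎)
    (close f (½ * ε) (half-pos 0<ε)) (close g (½ * ε) (half-pos 0<ε))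
    where
    open ≤-Reasoning
    lemma : ∀ a b c d → (a + c) - (b + d) ≡ (a - b) + (c - d)
    lemma = solve-∀ ℚ-ring

  -ᴿ-cong : ∀ {x y} → x ≃ y → -ᴿ x ≃ -ᴿ y
  -ᴿ-cong {x} {y} f = mk≃ λ ε 0<ε → eventually-map (λ n → subst (_< ε) (begin
      ∣ seq x n - seq y n ∣          ≡⟨ ∣p-q∣≡∣q-p∣ (seq x n) (seq y n) ⟩
      ∣ seq y n - seq x n ∣          ≡⟨ cong ∣_∣ (lemma (seq x n) (seq y n)) ⟩
      ∣ - seq x n - (- seq y n) ∣    ∎)) (close f ε 0<ε)
    where
    open ≡-Reasoning
    lemma : ∀ a b → b - a ≡ - a - (- b)
    lemma = solve-∀ ℚ-ring

  *ᴿ-cong : ∀ {x y u v} → x ≃ y → u ≃ v → x *ᴿ u ≃ y *ᴿ v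
  *ᴿ-cong {x} {y} {u} {v} f g = mk≃ λ ε 0<ε →
    let A , A>0 , a = bounded {seq x} (cauchy x)
        B , B>0 , b = bounded {seq v} (cauchy v)
        δ , 0<δ , e = split A B ε A>0 B>0 0<ε
    in eventually-map₂ (λ n (xA , vB) (uv , xy) → subst (∣ seq x n * seq u n - seq y n * seq v n ∣ <_) e
         (*-close {A} {B} {δ} (seq x n) (seq u n) (seq y n) (seq v n) A>0 B>0 xA vB uv xy))
       (eventually-map₂ (λ _ → _,_) a b) (eventually-map₂ (λ _ → _,_) (close g δ 0<δ) (close f δ 0<δ))

  ℝ-isCommutativeRing : IsCommutativeRing _≃_ _+ᴿ_ _*ᴿ_ -ᴿ_ 0ᴿ 1ᴿ
  ℝ-isCommutativeRing = record
    { isRing = record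
      { +-isAbelianGroup = record
        { isGroup = record
          { isMonoid = record
            { isSemigroup = record
              { isMagma = record
                { isEquivalence = record { refl = ≃-refl ; sym = ≃-sym ; trans = ≃-trans }
                ; ∙-cong = +ᴿ-cong }
              ; assoc = λ x y z → pointwise λ n → +-assoc (seq x n) (seq y n) (seq z n) }
            ; identity = (λ x → pointwise λ n → +-identityˡ (seq x n)) , (λ x → pointwise λ n → +-identityʳ (seq x n)) }
          ; inverse = (λ x → pointwise λ n → +-inverseˡ (seq x n)) , (λ x → pointwise λ n → +-inverseʳ (seq x n))
          ; ⁻¹-cong = -ᴿ-cong }
        ; comm = λ x y → pointwise λ n → +-comm (seq x n) (seq y n) }
      ; *-cong = *ᴿ-cong
      ; *-assoc = λ x y z → pointwise λ n → *-assoc (seq x n) (seq y n) (seq z n)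
      ; *-identity = (λ x → pointwise λ n → *-identityˡ (seq x n)) , (λ x → pointwise λ n → *-identityʳ (seq x n))
      ; distrib = (λ x y z → pointwise λ n → *-distribˡ-+ (seq x n) (seq y n) (seq z n))
                , (λ x y z → pointwise λ n → *-distribʳ-+ (seq x n) (seq y n) (seq z n)) }
    ; *-comm = λ x y → pointwise λ n → *-comm (seq x n) (seq y n) }

  ℝ-ring : CommutativeRing 0ℓ 0ℓ
  ℝ-ring = record { isCommutativeRing = ℝ-isCommutativeRing }

  -- The rational lower bound is the constructive content: it locates rational points and justifies
  -- cancellation.
  record Pos (x : ℝ) : Set where
    constructor mkPos
    field
      bound   : ℚ
      bound>0 : 0ℚ < bound
      above   : Eventually λ n → bound < seq x n

  Pos-resp : ∀ {x y} → x ≃ y → Pos x → Pos y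
  Pos-resp {x} {y} f (mkPos ε 0<ε g) = mkPos (½ * ε) (half-pos 0<ε)
    (eventually-map₂ (λ n a b → <-by ((seq x n - ε) + (½ * ε - (seq x n - seq y n)))
        (0<+ (p<q⇒0<q-p a) (p<q⇒0<q-p (≤-<-trans (p≤∣p∣ (seq x n - seq y n)) b)))
        (lemma (seq x n) (seq y n) ε))
      g (close f (½ * ε) (half-pos 0<ε)))
    where
    lemma : ∀ x y ε → ½ * ε + ((x - ε) + (½ * ε - (x - y))) ≡ y
    lemma = solve-∀ ℚ-ring

  Pos-+ : ∀ {x y} → Pos x → Pos y → Pos (x +ᴿ y)
  Pos-+ (mkPos ε 0<ε f) (mkPos δ 0<δ g) = mkPos (ε + δ) (0<+ 0<ε 0<δ) (eventually-map₂ (λ n → +-mono-<) f g)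

  Pos-* : ∀ {x y} → Pos x → Pos y → Pos (x *ᴿ y)
  Pos-* {x} {y} (mkPos ε 0<ε f) (mkPos δ 0<δ g) = mkPos (ε * δ) (0<* 0<ε 0<δ)
    (eventually-map₂ (λ n a b → <-≤-trans (*-monoˡ-<-pos δ {{positive 0<δ}} a)
      (*-monoˡ-≤-nonNeg (seq x n) {{nonNegative (<⇒≤ (<-trans 0<ε a))}} (<⇒≤ b))) f g)

  Pos-fromℚ : ∀ {q} → 0ℚ < q → Pos (fromℚ q)
  Pos-fromℚ {q} 0<q = mkPos (½ * q) (half-pos 0<q)
    (0 , λ _ _ → <-by (½ * q) (half-pos 0<q) (halves q))

  Pos-fromℚ⁻ : ∀ {q} → Pos (fromℚ q) → 0ℚ < q
  Pos-fromℚ⁻ (mkPos ε 0<ε (N , h)) = <-trans 0<ε (h N ℕ.≤-refl)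

  Pos⇒≄0 : ∀ {x} → Pos x → ¬ (x ≃ 0ᴿ)
  Pos⇒≄0 p x≃0 = <-irrefl refl (Pos-fromℚ⁻ (Pos-resp x≃0 p))

  -- Since `x` eventually exceeds a fixed ε, a product smaller than ε η forces the other factor
  -- below η.
  Pos-cancel : ∀ {x} y → Pos x → x *ᴿ y ≃ 0ᴿ → y ≃ 0ᴿ
  Pos-cancel {x} y (mkPos ε 0<ε f) g = mk≃ λ η 0<η →
    eventually-map₂ (λ n a b → *-cancelˡ-<-nonNeg ε {{nonNegative (<⇒≤ 0<ε)}} (begin-strict
      ε * ∣ seq y n - 0ℚ ∣        ≡⟨ cong (λ t → ε * ∣ t ∣) (lemma (seq y n)) ⟩
      ε * ∣ seq y n ∣             ≤⟨ *-monoʳ-≤-nonNeg ∣ seq y n ∣ {{∣-∣-nonNeg (seq y n)}} (<⇒≤ (<-≤-trans a (p≤∣p∣ (seq x n)))) ⟩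
      ∣ seq x n ∣ * ∣ seq y n ∣   ≡⟨ ∣p*q∣≡∣p∣*∣q∣ (seq x n) (seq y n) ⟨
      ∣ seq x n * seq y n ∣       ≡⟨ cong ∣_∣ (sym (lemma (seq x n * seq y n))) ⟩
      ∣ seq x n * seq y n - 0ℚ ∣  <⟨ b ⟩
      ε * η                       ∎)) f (close g (ε * η) (0<* 0<ε 0<η))
    where
    open ≤-Reasoning
    lemma : ∀ y → y - 0ℚ ≡ y
    lemma = solve-∀ ℚ-ring

  -- Comparing one sufficiently late pair of terms decides between x ≤ y + ε and y < x.
  ¬Pos⇒≤ : ∀ x y → ¬ Pos (x -ᴿ y) → x Defs.≤ y
  ¬Pos⇒≤ x y ¬pos = mk≤ go
    where
    lemma₁ : ∀ δ a b → δ + ((a - (δ + δ)) + (δ - (a - b))) ≡ b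
    lemma₁ = solve-∀ ℚ-ring
    lemma₂ : ∀ δ a x y → x + ((((δ + δ) - a) + (δ - ((x - y) - a))) + δ) ≡ y + ((δ + δ) + (δ + δ))
    lemma₂ = solve-∀ ℚ-ring
    quarters : ∀ ε → (½ * (½ * ε) + ½ * (½ * ε)) + (½ * (½ * ε) + ½ * (½ * ε)) ≡ ε
    quarters = solve-∀ ℚ-ring
    go : ∀ ε → 0ℚ < ε → Eventually λ n → seq x n < seq y n + ε
    go ε 0<ε with cauchy (x -ᴿ y) (½ * (½ * ε)) (half-pos (half-pos 0<ε))
    ... | N , h with ½ * (½ * ε) + ½ * (½ * ε) ≤? (seq x N - seq y N)
    ...   | yes big = ⊥-elim (¬pos (mkPos δ 0<δ (N , λ n N≤n → <-by _
              (+-mono-≤-< (p≤q⇒0≤q-p big) (p<q⇒0<q-p (≤-<-trans (p≤∣p∣ _) (h N n ℕ.≤-refl N≤n))))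
              (lemma₁ δ (seq x N - seq y N) (seq x n - seq y n)))))
      where
      δ : ℚ
      δ = ½ * (½ * ε)
      0<δ : 0ℚ < δ
      0<δ = half-pos (half-pos 0<ε)
    ...   | no ¬big = N , λ n N≤n → <-by _
              (0<+ (0<+ (p<q⇒0<q-p (≰⇒> ¬big)) (p<q⇒0<q-p (≤-<-trans (p≤∣p∣ _) (h n N N≤n ℕ.≤-refl)))) 0<δ)
              (trans (lemma₂ δ (seq x N - seq y N) (seq x n) (seq y n)) (cong (seq y n +_) (quarters ε)))
      where
      δ : ℚ
      δ = ½ * (½ * ε)
      0<δ : 0ℚ < δ
      0<δ = half-pos (half-pos 0<ε)

  -- The same iterated addition as in `Dpoly`, so that integer coefficients in ℝ agree with it entry
  -- by entry.
  nat : ℕ → ℚ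
  nat k = multiple +-0-rawMonoid k 1ℚ

  0≤nat : ∀ k → 0ℚ ≤ nat k
  0≤nat zero    = ≤-refl
  0≤nat (suc k) = 0≤+ (<⇒≤ 0<1) (0≤nat k)

  0<nat : ∀ {k} → 0 ℕ.< k → 0ℚ < nat k
  0<nat {suc k} _ = +-mono-<-≤ 0<1 (0≤nat k)

  nat-+ : ∀ j k → nat (j ℕ.+ k) ≡ nat j + nat k
  nat-+ zero    k = sym (+-identityˡ (nat k))
  nat-+ (suc j) k = trans (cong (1ℚ +_) (nat-+ j k)) (sym (+-assoc 1ℚ (nat j) (nat k)))

  nat-* : ∀ j k → nat (j ℕ.* k) ≡ nat j * nat k
  nat-* zero    k = sym (*-zeroˡ (nat k))
  nat-* (suc j) k = trans (nat-+ k (j ℕ.* k)) (trans (cong (nat k +_) (nat-* j k)) (lemma (nat j) (nat k)))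
    where
    lemma : ∀ a b → b + a * b ≡ (1ℚ + a) * b
    lemma = solve-∀ ℚ-ring

  nat-mono : ∀ {j k} → j ℕ.≤ k → nat j ≤ nat k
  nat-mono {j} {k} j≤k = ≤-by (nat (k ℕ.∸ j)) (0≤nat (k ℕ.∸ j))
    (trans (sym (nat-+ j (k ℕ.∸ j))) (cong nat (ℕ.m+[n∸m]≡n j≤k)))

  toℚᵘ-nat : ∀ k → toℚᵘ (nat k) ℚᵘ.≃ ℚᵘ.mkℚᵘ (ℤ.+ k) 0
  toℚᵘ-nat zero    = ℚᵘ.≃-refl
  toℚᵘ-nat (suc k) = ℚᵘ.≃-trans (toℚᵘ-homo-+ 1ℚ (nat k))
    (ℚᵘ.≃-trans (ℚᵘ.+-congʳ (toℚᵘ 1ℚ) (toℚᵘ-nat k)) (ℚᵘ.*≡* (cong (λ t → (ℤ.+ 1 ℤ.+ t) ℤ.* ℤ.+ 1) (ℤ.*-identityʳ (ℤ.+ k)))))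

  ÷-* : ∀ p {q} → 0 ℕ.< q → (p ÷ q) * nat q ≡ nat p
  ÷-* p {suc q} _ = toℚᵘ-injective (begin
    toℚᵘ ((ℤ.+ p / suc q) * nat (suc q))                 ≈⟨ toℚᵘ-homo-* (ℤ.+ p / suc q) (nat (suc q)) ⟩
    toℚᵘ (ℤ.+ p / suc q) ℚᵘ.* toℚᵘ (nat (suc q))         ≈⟨ ℚᵘ.*-cong (toℚᵘ-fromℚᵘ (ℚᵘ.mkℚᵘ (ℤ.+ p) q)) (toℚᵘ-nat (suc q)) ⟩
    ℚᵘ.mkℚᵘ (ℤ.+ p) q ℚᵘ.* ℚᵘ.mkℚᵘ (ℤ.+ suc q) 0           ≈⟨ ℚᵘ.*≡* (cross p) ⟩
    ℚᵘ.mkℚᵘ (ℤ.+ p) 0                                    ≈⟨ toℚᵘ-nat p ⟨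
    toℚᵘ (nat p)                                       ∎)
    where
    open ℚᵘ.≃-Reasoning
    cross : ∀ p → (ℤ.+ p ℤ.* ℤ.+ suc q) ℤ.* ℤ.+ 1 ≡ ℤ.+ p ℤ.* (ℤ.+ suc q ℤ.* ℤ.+ 1)
    cross p = ℤ.*-assoc (ℤ.+ p) (ℤ.+ suc q) (ℤ.+ 1)

  archimedean : ∀ p → ∃[ k ] (p < nat k)
  archimedean p@(mkℚ (ℤ.+ n) d-1 _) = suc n , toℚᵘ-cancel-< (ℚᵘ.<-respʳ-≃ (ℚᵘ.≃-sym (toℚᵘ-nat (suc n)))
    (ℚᵘ.*<* (ℤ.<-≤-trans (ℤ.≤-<-trans (ℤ.≤-reflexive (ℤ.*-identityʳ (ℤ.+ n))) (ℤ.+<+ (ℕ.n<1+n n)))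
      (subst (ℤ.+ suc n ℤ.≤_) (ℤ.pos-* (suc n) (suc d-1)) (ℤ.+≤+ (ℕ.m≤m*n (suc n) (suc d-1)))))))
  archimedean p@(mkℚ (-[1+ n ]) d-1 _) = 0 , negative⁻¹ p

  halfpow : ℕ → ℚ
  halfpow zero    = 1ℚ
  halfpow (suc n) = ½ * halfpow n

  0<halfpow : ∀ n → 0ℚ < halfpow n
  0<halfpow zero    = 0<1
  0<halfpow (suc n) = half-pos (0<halfpow n)

  halfpow≤1 : ∀ n → halfpow n ≤ 1ℚ
  halfpow≤1 zero    = ≤-refl
  halfpow≤1 (suc n) = ≤-by _ (0≤+ (<⇒≤ 0<½) (0≤* (<⇒≤ 0<½) (p≤q⇒0≤q-p (halfpow≤1 n)))) (lemma (halfpow n))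
    where
    lemma : ∀ h → ½ * h + (½ + ½ * (1ℚ - h)) ≡ 1ℚ
    lemma = solve-∀ ℚ-ring

  -- The bound n ≤ 2ⁿ, which lets the Archimedean property yield convergence of repeated halving.
  halfpow*nat≤1 : ∀ n → halfpow n * nat n ≤ 1ℚ
  halfpow*nat≤1 zero    = <⇒≤ 0<1
  halfpow*nat≤1 (suc n) = ≤-by _
    (0≤+ (0≤* (<⇒≤ 0<½) (p≤q⇒0≤q-p (halfpow≤1 n))) (0≤* (<⇒≤ 0<½) (p≤q⇒0≤q-p (halfpow*nat≤1 n))))
    (lemma (halfpow n) (nat n))
    where
    lemma : ∀ h k → (½ * h) * (1ℚ + k) + (½ * (1ℚ - h) + ½ * (1ℚ - h * k)) ≡ 1ℚ
    lemma = solve-∀ ℚ-ring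

  halfpow-small : ∀ C ε → 0ℚ < ε → Eventually λ n → halfpow n * C < ε
  halfpow-small C ε 0<ε with archimedean (C * ε⁻¹)
    where
    instance
      ε≢0 : NonZero ε
      ε≢0 = pos⇒nonZero ε {{positive 0<ε}}
    ε⁻¹ : ℚ
    ε⁻¹ = 1/ ε
  ... | k , C/ε<k = k , λ n k≤n → begin-strict
    halfpow n * C               <⟨ *-monoʳ-<-pos (halfpow n) {{positive (0<halfpow n)}} C<kε ⟩
    halfpow n * (nat k * ε)     ≤⟨ *-monoˡ-≤-nonNeg (halfpow n) {{nonNegative (<⇒≤ (0<halfpow n))}}
                                     (*-monoʳ-≤-nonNeg ε {{nonNegative (<⇒≤ 0<ε)}} (nat-mono k≤n)) ⟩
    halfpow n * (nat n * ε)     ≡⟨ *-assoc (halfpow n) (nat n) ε ⟨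
    (halfpow n * nat n) * ε     ≤⟨ *-monoʳ-≤-nonNeg ε {{nonNegative (<⇒≤ 0<ε)}} (halfpow*nat≤1 n) ⟩
    1ℚ * ε                      ≡⟨ *-identityˡ ε ⟩
    ε                           ∎
    where
    open ≤-Reasoning
    instance
      ε≢0 : NonZero ε
      ε≢0 = pos⇒nonZero ε {{positive 0<ε}}
    C<kε : C < nat k * ε
    C<kε = subst (_< nat k * ε)
      (trans (*-assoc C (1/ ε) ε) (trans (cong (C *_) (*-inverseˡ ε)) (*-identityʳ C)))
      (*-monoˡ-<-pos ε {{positive 0<ε}} C/ε<k)

  l≤midpoint : ∀ {l r} → l ≤ r → l ≤ ½ * (l + r)
  l≤midpoint {l} {r} l≤r = ≤-by _ (0≤* (<⇒≤ 0<½) (p≤q⇒0≤q-p l≤r)) (lemma l r)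
    where
    lemma : ∀ l r → l + ½ * (r - l) ≡ ½ * (l + r)
    lemma = solve-∀ ℚ-ring

  midpoint≤r : ∀ {l r} → l ≤ r → ½ * (l + r) ≤ r
  midpoint≤r {l} {r} l≤r = ≤-by _ (0≤* (<⇒≤ 0<½) (p≤q⇒0≤q-p l≤r)) (lemma l r)
    where
    lemma : ∀ l r → ½ * (l + r) + ½ * (r - l) ≡ r
    lemma = solve-∀ ℚ-ring

  -- Bisection for Lipschitz functions on rational points

  module Bisection (f : ℚ → ℚ) (a b K : ℚ) (a≤b : a ≤ b)
    (lipschitz : ∀ x y → a ≤ x → x ≤ b → a ≤ y → y ≤ b → ∣ f x - f y ∣ ≤ K * ∣ x - y ∣)
    (fa≤0 : f a ≤ 0ℚ) (0≤fb : 0ℚ ≤ f b) where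

    record Bracket : Set where
      constructor mkBracket
      field
        lo hi : ℚ
        a≤lo  : a ≤ lo
        lo≤hi : lo ≤ hi
        hi≤b  : hi ≤ b
        flo≤0 : f lo ≤ 0ℚ
        0≤fhi : 0ℚ ≤ f hi

    open Bracket

    halve : ∀ B → Σ[ B′ ∈ Bracket ] (lo B ≤ lo B′ × hi B′ ≤ hi B × hi B′ - lo B′ ≡ ½ * (hi B - lo B))
    halve (mkBracket l r a≤l l≤r r≤b fl fr) with f (½ * (l + r)) ≤? 0ℚ
    ... | yes fm≤0 =
      mkBracket (½ * (l + r)) r (≤-trans a≤l (l≤midpoint l≤r)) (midpoint≤r l≤r) r≤b fm≤0 fr
        , l≤midpoint l≤r , ≤-refl , lemma l r
      where
      lemma : ∀ l r → r - ½ * (l + r) ≡ ½ * (r - l)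
      lemma = solve-∀ ℚ-ring
    ... | no fm≰0 =
      mkBracket l (½ * (l + r)) a≤l (l≤midpoint l≤r) (≤-trans (midpoint≤r l≤r) r≤b) fl (<⇒≤ (≰⇒> fm≰0))
        , ≤-refl , midpoint≤r l≤r , lemma l r
      where
      lemma : ∀ l r → ½ * (l + r) - l ≡ ½ * (r - l)
      lemma = solve-∀ ℚ-ring

    bracket : ℕ → Bracket
    bracket zero    = mkBracket a b ≤-refl a≤b ≤-refl fa≤0 0≤fb
    bracket (suc n) = proj₁ (halve (bracket n))

    l r : ℕ → ℚ
    l n = lo (bracket n)
    r n = hi (bracket n)

    width : ∀ n → r n - l n ≡ halfpow n * (b - a)
    width zero    = sym (*-identityˡ (b - a))
    width (suc n) = trans (proj₂ (proj₂ (proj₂ (halve (bracket n)))))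
      (trans (cong (½ *_) (width n)) (sym (*-assoc ½ (halfpow n) (b - a))))

    l-mono : ∀ N k → l N ≤ l (k ℕ.+ N)
    l-mono N zero    = ≤-refl
    l-mono N (suc k) = ≤-trans (l-mono N k) (proj₁ (proj₂ (halve (bracket (k ℕ.+ N)))))

    r-mono : ∀ N k → r (k ℕ.+ N) ≤ r N
    r-mono N zero    = ≤-refl
    r-mono N (suc k) = ≤-trans (proj₁ (proj₂ (proj₂ (halve (bracket (k ℕ.+ N)))))) (r-mono N k)

    l-bounds : ∀ N n → N ℕ.≤ n → l N ≤ l n × l n ≤ r N
    l-bounds N n N≤n = subst (λ m → l N ≤ l m) (ℕ.m∸n+n≡m N≤n) (l-mono N (n ℕ.∸ N))
      , ≤-trans (lo≤hi (bracket n)) (subst (λ m → r m ≤ r N) (ℕ.m∸n+n≡m N≤n) (r-mono N (n ℕ.∸ N)))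

    l-cauchy : IsCauchy l
    l-cauchy ε 0<ε with halfpow-small (b - a) ε 0<ε
    ... | N , h = N , λ m n N≤m N≤n →
      let lm , mr = l-bounds N m N≤m
          ln , nr = l-bounds N n N≤n
          w<ε     = subst (_< ε) (sym (width N)) (h N ℕ.≤-refl)
      in ∣p∣<⁺ (≤-<-trans (≤-by _ (0≤+ (p≤q⇒0≤q-p ln) (p≤q⇒0≤q-p mr)) (lemma (l N) (r N) (l m) (l n))) w<ε)
        (≤-<-trans (≤-by _ (0≤+ (p≤q⇒0≤q-p lm) (p≤q⇒0≤q-p nr)) (lemma′ (l N) (r N) (l m) (l n))) w<ε)
      where
      lemma : ∀ l r x y → (x - y) + ((y - l) + (r - x)) ≡ r - l
      lemma = solve-∀ ℚ-ring
      lemma′ : ∀ l r x y → - (x - y) + ((x - l) + (r - y)) ≡ r - l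
      lemma′ = solve-∀ ℚ-ring

    limit : ℝ
    limit = mkℝ l l-cauchy

    a≤limit : ∀ n → a ≤ seq limit n
    a≤limit n = a≤lo (bracket n)

    limit≤b : ∀ n → seq limit n ≤ b
    limit≤b n = ≤-trans (lo≤hi (bracket n)) (hi≤b (bracket n))

    -- The ends of a bracket have values of opposite sign, so either value is bounded by their
    -- difference, which is at most `K` times the width.
    f-limit : ∀ ε → 0ℚ < ε → Eventually λ n → ∣ f (seq limit n) ∣ < ε
    f-limit ε 0<ε = eventually-map (λ n small → ≤-<-trans (bound n) (subst (_< ε) (lemma (halfpow n) K (b - a)) small))
      (halfpow-small (K * (b - a)) ε 0<ε)
      where
      lemma : ∀ h K d → h * (K * d) ≡ K * (h * d)
      lemma = solve-∀ ℚ-ring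
      lemma₁ : ∀ x y → - x + y ≡ y - x
      lemma₁ = solve-∀ ℚ-ring
      bound : ∀ n → ∣ f (l n) ∣ ≤ K * (halfpow n * (b - a))
      bound n = let B = bracket n in begin
        ∣ f (l n) ∣                    ≤⟨ ∣p∣≤⁺ (≤-trans (flo≤0 B) (p≤q⇒0≤q-p (≤-trans (flo≤0 B) (0≤fhi B)))) (≤-by _ (0≤fhi B) (lemma₁ (f (l n)) (f (r n)))) ⟩
        f (r n) - f (l n)              ≤⟨ p≤∣p∣ (f (r n) - f (l n)) ⟩
        ∣ f (r n) - f (l n) ∣          ≤⟨ lipschitz (r n) (l n) (≤-trans (a≤lo B) (lo≤hi B)) (hi≤b B) (a≤lo B) (≤-trans (lo≤hi B) (hi≤b B)) ⟩
        K * ∣ r n - l n ∣              ≡⟨ cong (K *_) (trans (0≤p⇒∣p∣≡p (p≤q⇒0≤q-p (lo≤hi B))) (width n)) ⟩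
        K * (halfpow n * (b - a))      ∎
        where open ≤-Reasoning

  module ℚ[X] = Horner +-*-commutativeRing
  module ℝ[X] = Horner ℝ-ring
  open ℚ[X] using (horner)

  horner-bound : ∀ {p q x M} m → (∀ j → ∣ p j ∣ ≤ q j) → ∣ x ∣ ≤ M → ∣ horner p x m ∣ ≤ horner q M m
  horner-bound zero    p≤q x≤M = p≤q 0
  horner-bound {p} {q} {x} {M} (suc m) p≤q x≤M = begin
    ∣ x * horner p x m + p (suc m) ∣          ≤⟨ ∣p+q∣≤∣p∣+∣q∣ (x * horner p x m) (p (suc m)) ⟩
    ∣ x * horner p x m ∣ + ∣ p (suc m) ∣      ≡⟨ cong (_+ ∣ p (suc m) ∣) (∣p*q∣≡∣p∣*∣q∣ x (horner p x m)) ⟩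
    ∣ x ∣ * ∣ horner p x m ∣ + ∣ p (suc m) ∣  ≤⟨ +-mono-≤ (*-mono-≤ (0≤∣p∣ x) x≤M (0≤∣p∣ (horner p x m)) (horner-bound m p≤q x≤M)) (p≤q (suc m)) ⟩
    M * horner q M m + q (suc m)              ∎
    where open ≤-Reasoning

  -- By `horner-divide` the difference quotient of `p` is a double Horner scheme; this is its
  -- majorant, with absolute values of the coefficients and `M` for both points.
  lipschitzConstant : (ℕ → ℚ) → ℕ → ℚ → ℚ
  lipschitzConstant p zero    M = 0ℚ
  lipschitzConstant p (suc m) M = horner (horner (∣_∣ ∘ p) M) M m

  horner-lipschitz : ∀ p m M {x y} → ∣ x ∣ ≤ M → ∣ y ∣ ≤ M →
    ∣ horner p x m - horner p y m ∣ ≤ lipschitzConstant p m M * ∣ x - y ∣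
  horner-lipschitz p zero    M {x} {y} _ _ = ≤-reflexive
    (trans (cong ∣_∣ (+-inverseʳ (p 0))) (sym (*-zeroˡ ∣ x - y ∣)))
  horner-lipschitz p (suc m) M {x} {y} x≤M y≤M = begin
    ∣ horner p x (suc m) - horner p y (suc m) ∣
      ≡⟨ cong (λ t → ∣ t - horner p y (suc m) ∣) (ℚ[X].horner-divide p x y m) ⟩
    ∣ ((x - y) * horner (horner p y) x m + horner p y (suc m)) - horner p y (suc m) ∣
      ≡⟨ cong ∣_∣ (lemma (x - y) (horner (horner p y) x m) (horner p y (suc m))) ⟩
    ∣ horner (horner p y) x m * (x - y) ∣
      ≡⟨ ∣p*q∣≡∣p∣*∣q∣ (horner (horner p y) x m) (x - y) ⟩
    ∣ horner (horner p y) x m ∣ * ∣ x - y ∣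
      ≤⟨ *-monoʳ-≤-nonNeg ∣ x - y ∣ {{∣-∣-nonNeg (x - y)}}
           (horner-bound m (λ j → horner-bound j (λ _ → ≤-refl) y≤M) x≤M) ⟩
    horner (horner (∣_∣ ∘ p) M) M m * ∣ x - y ∣ ∎
    where
    open ≤-Reasoning
    lemma : ∀ a b c → (a * b + c) - c ≡ b * a
    lemma = solve-∀ ℚ-ring

  0≤lipschitzConstant : ∀ p m {M} → 0ℚ ≤ M → 0ℚ ≤ lipschitzConstant p m M
  0≤lipschitzConstant p zero    0≤M = ≤-refl
  0≤lipschitzConstant p (suc m) {M} 0≤M = 0≤horner m (λ j → 0≤horner j (λ i → 0≤∣p∣ (p i)))
    where
    0≤horner : ∀ {q} m → (∀ j → 0ℚ ≤ q j) → 0ℚ ≤ horner q M m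
    0≤horner zero    0≤q = 0≤q 0
    0≤horner (suc m) 0≤q = 0≤+ (0≤* 0≤M (0≤horner m 0≤q)) (0≤q (suc m))

  eval : (ℕ → ℚ) → ℕ → ℝ → ℝ
  eval p m x = ℝ[X].horner (fromℚ ∘ p) x m

  seq-eval : ∀ p m x n → seq (eval p m x) n ≡ horner p (seq x n) m
  seq-eval p zero    x n = refl
  seq-eval p (suc m) x n = cong (λ t → seq x n * t + p (suc m)) (seq-eval p m x n)

  horner-neg : ∀ p x m → horner (-_ ∘ p) x m ≡ - horner p x m
  horner-neg p x zero    = refl
  horner-neg p x (suc m) = trans (cong (λ t → x * t + - p (suc m)) (horner-neg p x m))
    (lemma x (horner p x m) (p (suc m)))
    where
    lemma : ∀ x h a → x * (- h) + - a ≡ - (x * h + a)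
    lemma = solve-∀ ℚ-ring

  abstract
    polynomial-root : ∀ p m {a b} → a ≤ b → horner p a m ≤ 0ℚ → 0ℚ ≤ horner p b m →
      ∃[ w ] ((∀ n → a ≤ seq w n) × (∀ n → seq w n ≤ b) × eval p m w ≃ 0ᴿ)
    polynomial-root p m {a} {b} a≤b pa pb = limit , a≤limit , limit≤b , mk≃ λ ε 0<ε →
      eventually-map (λ n → subst (λ t → ∣ t ∣ < ε)
        (trans (sym (seq-eval p m limit n)) (sym (+-identityʳ (seq (eval p m limit) n))))) (f-limit ε 0<ε)
      where
      M : ℚ
      M = ∣ a ∣ + ∣ b ∣
      in-range : ∀ {x} → a ≤ x → x ≤ b → ∣ x ∣ ≤ M
      in-range {x} a≤x x≤b = ∣p∣≤⁺
        (≤-trans x≤b (≤-trans (p≤∣p∣ b) (≤-by ∣ a ∣ (0≤∣p∣ a) (+-comm ∣ b ∣ ∣ a ∣))))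
        (≤-trans (neg-antimono-≤ a≤x) (≤-trans (-p≤∣p∣ a) (≤-by ∣ b ∣ (0≤∣p∣ b) refl)))
      open Bisection (λ x → horner p x m) a b (lipschitzConstant p m M) a≤b
        (λ x y a≤x x≤b a≤y y≤b → horner-lipschitz p m M (in-range a≤x x≤b) (in-range a≤y y≤b)) pa pb

  -- Rational points on either side of `z`, closer than `η`, at which `p` keeps its positive sign:
  -- substitutes for `z` as ends of a bisection.
  record Near (p : ℕ → ℚ) (m : ℕ) (z : ℝ) (η : ℚ) : Set where
    field
      left right  : ℚ
      left-pos    : 0ℚ < horner p left m
      right-pos   : 0ℚ < horner p right m
      left<z      : Pos (z -ᴿ fromℚ left)
      z<right     : Pos (fromℚ right -ᴿ z)
      z-η<left    : Pos (fromℚ left -ᴿ (z -ᴿ fromℚ η))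
      right<z+η   : Pos ((z +ᴿ fromℚ η) -ᴿ fromℚ right)

  0<⊓ : ∀ {p q} → 0ℚ < p → 0ℚ < q → 0ℚ < p ⊓ q
  0<⊓ {p} {q} 0<p 0<q with ≤-total p q
  ... | inj₁ p≤q = subst (0ℚ <_) (sym (p≤q⇒p⊓q≡p p≤q)) 0<p
  ... | inj₂ q≤p = subst (0ℚ <_) (sym (p≥q⇒p⊓q≡q q≤p)) 0<q

  abstract
    near : ∀ p m z → Pos (eval p m z) → ∀ η → 0ℚ < η → Near p m z η
    near p m z (mkPos ε 0<ε (N₁ , pos)) η 0<η = record
      { left      = zN - δ
      ; right     = zN + δ
      ; left-pos  = sign-near (zN - δ) (trans (cong ∣_∣ (lemma₁ zN δ)) ∣δ∣≡δ)
      ; right-pos = sign-near (zN + δ) (trans (cong ∣_∣ (lemma₂ zN δ)) (trans (∣-p∣≡∣p∣ δ) ∣δ∣≡δ))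
      ; left<z    = mkPos (½ * δ) (half-pos 0<δ) (N , λ k N≤k → <-by _ (p<q⇒0<q-p (late- k N≤k)) (lemma₃ zN (seq z k) δ))
      ; z<right   = mkPos (½ * δ) (half-pos 0<δ) (N , λ k N≤k → <-by _ (p<q⇒0<q-p (late+ k N≤k)) (lemma₄ zN (seq z k) δ))
      ; z-η<left  = mkPos (½ * δ) (half-pos 0<δ) (N , λ k N≤k →
          <-by _ (+-mono-<-≤ (p<q⇒0<q-p (late+ k N≤k)) (p≤q⇒0≤q-p 2δ≤η)) (lemma₅ zN (seq z k) δ η))
      ; right<z+η = mkPos (½ * δ) (half-pos 0<δ) (N , λ k N≤k →
          <-by _ (+-mono-<-≤ (p<q⇒0<q-p (late- k N≤k)) (p≤q⇒0≤q-p 2δ≤η)) (lemma₆ zN (seq z k) δ η))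
      }
      where
      B : ℚ
      B = proj₁ (bounded {seq z} (cauchy z))
      N₂ : ℕ
      N₂ = proj₁ (proj₂ (proj₂ (bounded {seq z} (cauchy z))))
      M K : ℚ
      M = B + 1ℚ
      0≤B : 0ℚ ≤ B
      0≤B = <⇒≤ (positive⁻¹ B {{proj₁ (proj₂ (bounded {seq z} (cauchy z)))}})
      K = lipschitzConstant p m M
      0≤K : 0ℚ ≤ K
      0≤K = 0≤lipschitzConstant p m (0≤+ 0≤B (<⇒≤ 0<1))
      0<K+1 : 0ℚ < K + 1ℚ
      0<K+1 = +-mono-≤-< 0≤K 0<1
      instance
        K+1≢0 : NonZero (K + 1ℚ)
        K+1≢0 = pos⇒nonZero (K + 1ℚ) {{positive 0<K+1}}
      -- Three demands on `δ`: `δ + δ ≤ η` keeps the points close to `z`, `δ ≤ 1ℚ` keeps them where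
      -- the Lipschitz constant for `M` is valid, and `K * δ ≤ ε` preserves the sign. `K + 1ℚ` is
      -- inverted because `K` may be zero.
      ρ Δ δ : ℚ
      ρ = ε * 1/ (K + 1ℚ)
      Δ = (η ⊓ 1ℚ) ⊓ ρ
      δ = ½ * Δ
      0<ρ : 0ℚ < ρ
      0<ρ = 0<* 0<ε (positive⁻¹ (1/ (K + 1ℚ)) {{1/pos⇒pos (K + 1ℚ) {{positive 0<K+1}}}})
      0<Δ : 0ℚ < Δ
      0<Δ = 0<⊓ (0<⊓ 0<η 0<1) 0<ρ
      0<δ : 0ℚ < δ
      0<δ = half-pos 0<Δ
      ∣δ∣≡δ : ∣ δ ∣ ≡ δ
      ∣δ∣≡δ = 0≤p⇒∣p∣≡p (<⇒≤ 0<δ)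
      δ≤Δ : δ ≤ Δ
      δ≤Δ = ≤-by δ (<⇒≤ 0<δ) (halves Δ)
      2δ≤η : δ + δ ≤ η
      2δ≤η = subst (_≤ η) (sym (halves Δ)) (≤-trans (p⊓q≤p (η ⊓ 1ℚ) ρ) (p⊓q≤p η 1ℚ))
      δ≤1 : δ ≤ 1ℚ
      δ≤1 = ≤-trans δ≤Δ (≤-trans (p⊓q≤p (η ⊓ 1ℚ) ρ) (p⊓q≤q η 1ℚ))
      Kδ≤ε : K * δ ≤ ε
      Kδ≤ε = begin
        K * δ                            ≤⟨ *-mono-≤ 0≤K (≤-by 1ℚ (<⇒≤ 0<1) refl) (<⇒≤ 0<δ) (≤-trans δ≤Δ (p⊓q≤q (η ⊓ 1ℚ) ρ)) ⟩
        (K + 1ℚ) * (ε * 1/ (K + 1ℚ))     ≡⟨ lemma (K + 1ℚ) ε (1/ (K + 1ℚ)) ⟩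
        ε * ((K + 1ℚ) * 1/ (K + 1ℚ))     ≡⟨ cong (ε *_) (*-inverseʳ (K + 1ℚ)) ⟩
        ε * 1ℚ                           ≡⟨ *-identityʳ ε ⟩
        ε                                ∎
        where
        open ≤-Reasoning
        lemma : ∀ a b c → a * (b * c) ≡ b * (a * c)
        lemma = solve-∀ ℚ-ring
      N₃ N : ℕ
      N₃ = proj₁ (cauchy z (½ * δ) (half-pos 0<δ))
      N = N₁ ℕ.⊔ (N₂ ℕ.⊔ N₃)
      N₂⊔N₃≤N : N₂ ℕ.⊔ N₃ ℕ.≤ N
      N₂⊔N₃≤N = ℕ.m≤n⊔m N₁ (N₂ ℕ.⊔ N₃)
      zN : ℚ
      zN = seq z N
      late : ∀ k → N ℕ.≤ k → ∣ seq z k - zN ∣ < ½ * δ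
      late k N≤k = proj₂ (cauchy z (½ * δ) (half-pos 0<δ)) k N
        (ℕ.≤-trans (ℕ.≤-trans (ℕ.m≤n⊔m N₂ N₃) N₂⊔N₃≤N) N≤k) (ℕ.≤-trans (ℕ.m≤n⊔m N₂ N₃) N₂⊔N₃≤N)
      late+ : ∀ k → N ℕ.≤ k → seq z k - zN < ½ * δ
      late+ k N≤k = ≤-<-trans (p≤∣p∣ (seq z k - zN)) (late k N≤k)
      late- : ∀ k → N ℕ.≤ k → - (seq z k - zN) < ½ * δ
      late- k N≤k = ≤-<-trans (-p≤∣p∣ (seq z k - zN)) (late k N≤k)
      zN≤B : ∣ zN ∣ ≤ B
      zN≤B = proj₂ (proj₂ (proj₂ (bounded {seq z} (cauchy z)))) N (ℕ.≤-trans (ℕ.m≤m⊔n N₂ N₃) N₂⊔N₃≤N)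
      sign-near : ∀ x → ∣ zN - x ∣ ≡ δ → 0ℚ < horner p x m
      sign-near x e = <-by _ (+-mono-<-≤
          (p<q⇒0<q-p (subst (ε <_) (seq-eval p m z N) (pos N (ℕ.m≤m⊔n N₁ (N₂ ℕ.⊔ N₃)))))
          (p≤q⇒0≤q-p (≤-trans (p≤∣p∣ _) (≤-trans (horner-lipschitz p m M zN≤M x≤M)
            (subst (λ t → K * t ≤ ε) (sym e) Kδ≤ε)))))
        (lemma (horner p zN m) (horner p x m) ε)
        where
        lemma : ∀ a b ε → 0ℚ + ((a - ε) + (ε - (a - b))) ≡ b
        lemma = solve-∀ ℚ-ring
        zN≤M : ∣ zN ∣ ≤ M
        zN≤M = ≤-trans zN≤B (≤-by 1ℚ (<⇒≤ 0<1) refl)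
        x≤M : ∣ x ∣ ≤ M
        x≤M = ≤-trans (∣p∣≤∣q∣+∣p-q∣ x zN)
          (+-mono-≤ zN≤B (subst (_≤ 1ℚ) (trans (sym e) (∣p-q∣≡∣q-p∣ zN x)) δ≤1))
      lemma₁ : ∀ z δ → z - (z - δ) ≡ δ
      lemma₁ = solve-∀ ℚ-ring
      lemma₂ : ∀ z δ → z - (z + δ) ≡ - δ
      lemma₂ = solve-∀ ℚ-ring
      lemma₃ : ∀ a z δ → ½ * δ + (½ * δ - (- (z - a))) ≡ z - (a - δ)
      lemma₃ = solve-∀ ℚ-ring
      lemma₄ : ∀ a z δ → ½ * δ + (½ * δ - (z - a)) ≡ (a + δ) - z
      lemma₄ = solve-∀ ℚ-ring
      lemma₅ : ∀ a z δ η → ½ * δ + ((½ * δ - (z - a)) + (η - (δ + δ))) ≡ (a - δ) - (z - η)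
      lemma₅ = solve-∀ ℚ-ring
      lemma₆ : ∀ a z δ η → ½ * δ + ((½ * δ - (- (z - a))) + (η - (δ + δ))) ≡ (z + η) - (a + δ)
      lemma₆ = solve-∀ ℚ-ring

  Pos-mono : ∀ {x y} → (∀ n → seq x n ≤ seq y n) → Pos x → Pos y
  Pos-mono x≤y (mkPos ε 0<ε f) = mkPos ε 0<ε (eventually-map (λ n h → <-≤-trans h (x≤y n)) f)

  abstract
    -- Both ends are first moved inwards to rational points by less than half of the gap `γ`: they
    -- stay in order, keep their signs, and make the root strictly interior.
    root-between : ∀ p m a b → Pos (b -ᴿ a) → Pos (-ᴿ eval p m a) → Pos (eval p m b) →
      ∃[ w ] (Pos (w -ᴿ a) × Pos (b -ᴿ w) × eval p m w ≃ 0ᴿ)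
    root-between p m a b (mkPos γ 0<γ gap) pa pb =
      let w , a′≤w , w≤b′ , root = polynomial-root p m (<⇒≤ a′<b′) pa′≤0 (<⇒≤ (Near.left-pos nb))
      in w , Pos-mono (λ n → +-monoˡ-≤ (- seq a n) (a′≤w n)) (Near.z<right na)
           , Pos-mono (λ n → +-monoʳ-≤ (seq b n) (neg-antimono-≤ (w≤b′ n))) (Near.left<z nb) , root
      where
      η : ℚ
      η = ½ * γ
      na : Near (-_ ∘ p) m a η
      na = near (-_ ∘ p) m a (Pos-resp (pointwise λ n → trans (cong -_ (seq-eval p m a n))
        (trans (sym (horner-neg p (seq a n) m)) (sym (seq-eval (-_ ∘ p) m a n)))) pa) η (half-pos 0<γ)
      nb : Near p m b η
      nb = near p m b pb η (half-pos 0<γ)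
      a′ b′ : ℚ
      a′ = Near.right na
      b′ = Near.left nb
      pa′≤0 : horner p a′ m ≤ 0ℚ
      pa′≤0 = ≤-by _ (<⇒≤ (Near.right-pos na))
        (trans (cong (horner p a′ m +_) (horner-neg p a′ m)) (+-inverseʳ (horner p a′ m)))
      a′<b′ : a′ < b′
      a′<b′ = <-by _ (Pos-fromℚ⁻ {b′ - a′}
        (mkPos _ (Pos.bound>0 sum) (eventually-map₂ (λ n g s → <-trans s
          (<-by _ (p<q⇒0<q-p g) (lemma (seq a n) (seq b n) a′ b′ γ))) gap (Pos.above sum)))) (add a′ b′)
        where
        sum : Pos (((a +ᴿ fromℚ η) -ᴿ fromℚ a′) +ᴿ (fromℚ b′ -ᴿ (b -ᴿ fromℚ η)))
        sum = Pos-+ (Near.right<z+η na) (Near.z-η<left nb)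
        lemma : ∀ a b a′ b′ γ → (((a + ½ * γ) - a′) + (b′ - (b - ½ * γ))) + ((b - a) - γ) ≡ b′ - a′
        lemma = solve-∀ ℚ-ring
        add : ∀ a b → a + (b - a) ≡ b
        add = solve-∀ ℚ-ring

  -- Square roots of nonnegative rationals

  module _ {q : ℚ} (0≤q : 0ℚ ≤ q) where

    private
      p : ℕ → ℚ
      p 0 = 1ℚ
      p 1 = 0ℚ
      p _ = - q

      horner-p : ∀ x → horner p x 2 ≡ x * x - q
      horner-p x = lemma x q
        where
        lemma : ∀ x q → x * (x * 1ℚ + 0ℚ) + - q ≡ x * x - q
        lemma = solve-∀ ℚ-ring

      root : ∃[ s ] ((∀ n → 0ℚ ≤ seq s n) × (∀ n → seq s n ≤ q + 1ℚ) × eval p 2 s ≃ 0ᴿ)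
      -- The right end is `q + 1ℚ` because the square of `q` itself may be less than `q`.
      root = polynomial-root p 2 {0ℚ} {q + 1ℚ} (0≤+ 0≤q (<⇒≤ 0<1))
        (subst (_≤ 0ℚ) (sym (horner-p 0ℚ)) (≤-by q 0≤q (lemma₁ q)))
        (subst (0ℚ ≤_) (sym (horner-p (q + 1ℚ))) (≤-by _ (0≤+ (0≤+ (0≤* 0≤q 0≤q) 0≤q) (<⇒≤ 0<1)) (lemma₂ q)))
        where
        lemma₁ : ∀ q → (0ℚ * 0ℚ - q) + q ≡ 0ℚ
        lemma₁ = solve-∀ ℚ-ring
        lemma₂ : ∀ q → 0ℚ + ((q * q + q) + 1ℚ) ≡ (q + 1ℚ) * (q + 1ℚ) - q
        lemma₂ = solve-∀ ℚ-ring

      s : ℝ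
      s = proj₁ root

      s²≃q : s *ᴿ s ≃ fromℚ q
      s²≃q = ≃-trans (pointwise λ n → trans (lemma (seq s n) q)
          (cong (_+ q) (sym (trans (seq-eval p 2 s n) (horner-p (seq s n))))))
        (≃-trans (+ᴿ-cong (proj₂ (proj₂ (proj₂ root))) (≃-refl {fromℚ q})) (pointwise λ n → +-identityˡ q))
        where
        lemma : ∀ s q → s * s ≡ (s * s - q) + q
        lemma = solve-∀ ℚ-ring

    -- Entrywise nonnegativity of this representative is kept because Samuelson's bound compares
    -- sequences entry by entry.
    sqrt : ∃[ s ] (s IsSqrtOf fromℚ q × (∀ n → 0ℚ ≤ seq s n))
    sqrt = s , mkIsSqrtOf (mk≤ λ ε 0<ε → 0 , λ n _ → +-mono-≤-< (0≤s n) 0<ε) s²≃q , 0≤s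
      where
      0≤s : ∀ n → 0ℚ ≤ seq s n
      0≤s = proj₁ (proj₂ root)

-- Sign changes and interlacing roots

module Interlacing where

  open import Defs hiding (_≤_; D; Dpoly)
  open CauchySequences using (ℚ-ring; bounded)
  open import Algebra.Definitions.RawMonoid using () renaming (_×_ to multiple)
  open import Data.Empty using (⊥-elim)
  open import Data.Nat.Base as ℕ using (ℕ; zero; suc; _∸_; ⌊_/2⌋; z≤n; s≤s)
  import Data.Nat.Properties as ℕ
  open import Data.Product.Base using (_×_; _,_; ∃-syntax; Σ-syntax; proj₁; proj₂)
  open import Data.Rational.Base hiding (_≃_; _÷_)
  open import Data.Rational.Properties hiding (≃-sym)
  open import Data.Sum.Base using (_⊎_; inj₁; inj₂)
  open import Function.Base using (_∘_)
  open import Relation.Binary.PropositionalEquality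
  open import Relation.Nullary using (yes; no)
  open import Tactic.RingSolver using (solve-∀)
  open Counting using (E; E-rec; E-one; E-vanish; E-pos)
  open RealAnalysis
  open ℚ[X] using (horner)
  open ℝ[X] using (prod; Roots; mkRoots; ascending)

  infix 4 _<ᴿ_
  _<ᴿ_ : ℝ → ℝ → Set
  x <ᴿ y = Pos (y -ᴿ x)

  <ᴿ-trans : ∀ {x y z} → x <ᴿ y → y <ᴿ z → x <ᴿ z
  <ᴿ-trans {x} {y} {z} p q = Pos-resp (pointwise λ n → lemma (seq x n) (seq y n) (seq z n)) (Pos-+ p q)
    where
    lemma : ∀ x y z → (y - x) + (z - y) ≡ z - x
    lemma = solve-∀ ℚ-ring

  <ᴿ⇒cancellable : ∀ {x y} → x <ᴿ y → ℝ[X].Cancellable (y -ᴿ x)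
  <ᴿ⇒cancellable p b = Pos-cancel b p

  >ᴿ⇒cancellable : ∀ {x y} → x <ᴿ y → ℝ[X].Cancellable (x -ᴿ y)
  >ᴿ⇒cancellable {x} {y} p b e = Pos-cancel b p (≃-trans
    (pointwise λ n → lemma (seq x n) (seq y n) (seq b n)) (≃-trans (-ᴿ-cong e) (pointwise λ _ → refl)))
    where
    lemma : ∀ x y b → (y - x) * b ≡ - ((x - y) * b)
    lemma = solve-∀ ℚ-ring

  sgn : ℕ → ℚ
  sgn zero    = 1ℚ
  sgn (suc i) = - sgn i

  sgn² : ∀ i → sgn i * sgn i ≡ 1ℚ
  sgn² zero    = refl
  sgn² (suc i) = trans (lemma (sgn i)) (sgn² i)
    where
    lemma : ∀ s → (- s) * (- s) ≡ s * s
    lemma = solve-∀ ℚ-ring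

  σ : ℕ → ℝ
  σ i = fromℚ (sgn i)

  -- The negative factors are exactly those with index below `i`.
  prod-sign : ∀ z m i x → i ℕ.≤ m → (∀ j → j ℕ.< i → x <ᴿ z j) → (∀ j → i ℕ.≤ j → j ℕ.< m → z j <ᴿ x) →
    Pos (σ i *ᴿ prod z m x)
  prod-sign z zero    zero x _ _ _ = Pos-resp (pointwise λ _ → refl) (Pos-fromℚ 0<1)
  prod-sign z (suc m) i x i≤1+m above below with ℕ.m≤n⇒m<n∨m≡n i≤1+m
  ... | inj₁ (s≤s i≤m) = Pos-resp (pointwise λ n → *-assoc (sgn i) (seq (prod z m x) n) (seq x n - seq (z m) n))
    (Pos-* (prod-sign z m i x i≤m above (λ j i≤j j<m → below j i≤j (ℕ.m≤n⇒m≤1+n j<m))) (below m i≤m ℕ.≤-refl))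
  ... | inj₂ refl = Pos-resp (pointwise λ n → lemma (sgn m) (seq (prod z m x) n) (seq x n) (seq (z m) n))
    (Pos-* (prod-sign z m m x ℕ.≤-refl (λ j j<m → above j (ℕ.m≤n⇒m≤1+n j<m))
      (λ j m≤j j<m → ⊥-elim (ℕ.<⇒≱ j<m m≤j))) (above m ℕ.≤-refl))
    where
    lemma : ∀ s p x z → (s * p) * (z - x) ≡ (- s) * (p * (x - z))
    lemma = solve-∀ ℚ-ring

  -- The increasing enumeration of the naturals other than `i`; it lists the roots remaining after
  -- division by X - `z i`.
  skip : ℕ → ℕ → ℕ
  skip zero    j       = suc j
  skip (suc i) zero    = zero
  skip (suc i) (suc j) = suc (skip i j)

  skip-below : ∀ {i j} → j ℕ.< i → skip i j ≡ j
  skip-below {suc i} {zero}  _         = refl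
  skip-below {suc i} {suc j} (s≤s j<i) = cong suc (skip-below j<i)

  skip-above : ∀ {i j} → i ℕ.≤ j → skip i j ≡ suc j
  skip-above {zero}  {j}     _         = refl
  skip-above {suc i} {suc j} (s≤s i≤j) = cong suc (skip-above i≤j)

  skip-mono : ∀ i {j k} → j ℕ.< k → skip i j ℕ.< skip i k
  skip-mono zero    j<k = s≤s j<k
  skip-mono (suc i) {zero}  {suc k} _         = s≤s z≤n
  skip-mono (suc i) {suc j} {suc k} (s≤s j<k) = s≤s (skip-mono i j<k)

  skip≤ : ∀ i j → skip i j ℕ.≤ suc j
  skip≤ zero    j       = ℕ.≤-refl
  skip≤ (suc i) zero    = z≤n
  skip≤ (suc i) (suc j) = s≤s (skip≤ i j)

  Descending : (ℕ → ℝ) → ℕ → Set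
  Descending y m = ∀ i → i ℕ.< m → y (suc i) <ᴿ y i

  descend : ∀ {y m} → Descending y m → ∀ {i j} → i ℕ.< j → j ℕ.≤ m → y j <ᴿ y i
  descend {y} desc {i} {suc j} (s≤s i≤j) j<m with ℕ.m≤n⇒m<n∨m≡n i≤j
  ... | inj₁ i<j  = <ᴿ-trans {y (suc j)} {y j} {y i} (desc j j<m) (descend desc i<j (ℕ.<⇒≤ j<m))
  ... | inj₂ refl = desc j j<m

  descending⇒roots : ∀ {p z m} → (∀ j → j ℕ.< m → ℝ[X].horner p (z j) m ≃ 0ᴿ) →
    (∀ i j → i ℕ.< j → j ℕ.< m → z j <ᴿ z i) → Roots p z m
  descending⇒roots {z = z} root desc = mkRoots root λ i j i<j j<m → <ᴿ⇒cancellable {z j} {z i} (desc i j i<j j<m)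

  -- The second factor is the derivative of p at the root z i.
  quotient-sign : ∀ {p z m} i → i ℕ.< suc m → Pos (p 0) →
    (∀ j → j ℕ.< suc m → ℝ[X].horner p (z j) (suc m) ≃ 0ᴿ) →
    (∀ i j → i ℕ.< j → j ℕ.< suc m → z j <ᴿ z i) →
    Pos (σ i *ᴿ ℝ[X].horner (ℝ[X].horner p (z i)) (z i) m)
  quotient-sign {p} {z} {m} i (s≤s i≤m) p₀>0 root desc = Pos-resp
    (≃-trans (pointwise λ n → lemma (seq (p 0) n) (sgn i) (seq (prod (z ∘ skip i) m (z i)) n))
      (*ᴿ-cong (≃-refl {σ i}) (≃-sym (ℝ[X].factor roots (z i)))))
    (Pos-* p₀>0 (prod-sign (z ∘ skip i) m i (z i) i≤m
      (λ j j<i → subst (λ k → z i <ᴿ z k) (sym (skip-below j<i)) (desc j i j<i (s≤s i≤m)))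
      (λ j i≤j j<m → subst (λ k → z k <ᴿ z i) (sym (skip-above i≤j)) (desc i (suc j) (s≤s i≤j) (s≤s j<m)))))
    where
    lemma : ∀ p s q → p * (s * q) ≡ s * (p * q)
    lemma = solve-∀ ℚ-ring
    in-range : ∀ {j} → j ℕ.< m → skip i j ℕ.< suc m
    in-range {j} j<m = s≤s (ℕ.≤-trans (skip≤ i j) j<m)
    cancel : ∀ j → j ℕ.< m → ℝ[X].Cancellable (z (skip i j) -ᴿ z i)
    cancel j j<m with ℕ.<-≤-connex j i
    ... | inj₁ j<i = subst (λ k → ℝ[X].Cancellable (z k -ᴿ z i)) (sym (skip-below j<i))
      (<ᴿ⇒cancellable {z i} {z j} (desc j i j<i (s≤s i≤m)))
    ... | inj₂ i≤j = subst (λ k → ℝ[X].Cancellable (z k -ᴿ z i)) (sym (skip-above i≤j))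
      (>ᴿ⇒cancellable {z (suc j)} {z i} (desc i (suc j) (s≤s i≤j) (s≤s j<m)))
    roots : Roots (ℝ[X].horner p (z i)) (z ∘ skip i) m
    roots = descending⇒roots
      (λ j j<m → ℝ[X].quotient-root p m (root i (s≤s i≤m)) (root (skip i j) (in-range j<m)) (cancel j j<m))
      (λ j k j<k k<m → desc (skip i j) (skip i k) (skip-mono i j<k) (in-range k<m))

  eval-scale : ∀ c p m x → eval (λ j → c * p j) m x ≃ fromℚ c *ᴿ eval p m x
  eval-scale c p m x = pointwise λ n → trans (seq-eval (λ j → c * p j) m x n)
    (trans (scale m (seq x n)) (cong (c *_) (sym (seq-eval p m x n))))
    where
    lemma : ∀ c x h a → x * (c * h) + c * a ≡ c * (x * h + a)
    lemma = solve-∀ ℚ-ring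
    scale : ∀ m x → horner (λ j → c * p j) x m ≡ c * horner p x m
    scale zero    x = refl
    scale (suc m) x = trans (cong (λ t → x * t + c * p (suc m)) (scale m x)) (lemma c x (horner p x m) (p (suc m)))

  Alternating : (ℕ → ℚ) → ℕ → (ℕ → ℝ) → Set
  Alternating p m y = ∀ i → i ℕ.≤ m → Pos (σ i *ᴿ eval p m (y i))

  -- Multiplying `p` by its sign at `y i` puts the negative value on the left and the positive one
  -- on the right; the sign is its own inverse, so it can be removed from the resulting equation.
  alternating-root : ∀ p m y → Descending y m → Alternating p m y → ∀ i → i ℕ.< m →
    ∃[ w ] (y (suc i) <ᴿ w × w <ᴿ y i × eval p m w ≃ 0ᴿ)
  alternating-root p m y desc alt i i<m =
    let w , l , r , root = root-between p′ m (y (suc i)) (y i) (desc i i<m)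
          (Pos-resp (≃-trans (pointwise λ n → sym (neg-distribˡ-* (sgn i) (seq (eval p m (y (suc i))) n)))
            (-ᴿ-cong (≃-sym (eval-scale (sgn i) p m (y (suc i)))))) (alt (suc i) i<m))
          (Pos-resp (≃-sym (eval-scale (sgn i) p m (y i))) (alt i (ℕ.<⇒≤ i<m)))
    in w , l , r , ≃-trans (pointwise λ n → sym (trans (sym (*-assoc (sgn i) (sgn i) (seq (eval p m w) n)))
         (trans (cong (_* seq (eval p m w) n) (sgn² i)) (*-identityˡ _))))
       (≃-trans (*ᴿ-cong (≃-refl {σ i}) (≃-trans (≃-sym (eval-scale (sgn i) p m w)) root))
         (pointwise λ n → *-zeroʳ (sgn i)))
    where
    p′ : ℕ → ℚ
    p′ j = sgn i * p j

  alternating-roots : ∀ p m y → Descending y m → Alternating p m y →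
    Σ[ w ∈ (ℕ → ℝ) ] (∀ i → i ℕ.< m → y (suc i) <ᴿ w i × w i <ᴿ y i × eval p m (w i) ≃ 0ᴿ)
  alternating-roots p m y desc alt = w , w-spec
    where
    w : ℕ → ℝ
    w i with i ℕ.<? m
    ... | yes i<m = proj₁ (alternating-root p m y desc alt i i<m)
    -- A default value; the roots are specified below `m` only.
    ... | no  _   = 0ᴿ
    w-spec : ∀ i → i ℕ.< m → y (suc i) <ᴿ w i × w i <ᴿ y i × eval p m (w i) ≃ 0ᴿ
    w-spec i i<m with i ℕ.<? m
    ... | yes i<m′ = proj₂ (alternating-root p m y desc alt i i<m′)
    ... | no  i≮m  = ⊥-elim (i≮m i<m)

  absBound : (ℕ → ℚ) → ℕ → ℚ
  absBound p zero    = ∣ p 0 ∣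
  absBound p (suc m) = absBound p m + ∣ p (suc m) ∣

  0≤absBound : ∀ p m → 0ℚ ≤ absBound p m
  0≤absBound p zero    = 0≤∣p∣ (p 0)
  0≤absBound p (suc m) = 0≤+ (0≤absBound p m) (0≤∣p∣ (p (suc m)))

  ∣sgn*∣ : ∀ i p → - ∣ p ∣ ≤ sgn i * p
  ∣sgn*∣ i p = subst (- ∣ p ∣ ≤_) (lemma (sgn i * p))
    (neg-antimono-≤ (subst (- (sgn i * p) ≤_) (∣sgn∣ i) (-p≤∣p∣ (sgn i * p))))
    where
    lemma : ∀ x → - (- x) ≡ x
    lemma = solve-∀ ℚ-ring
    ∣sgn∣ : ∀ i → ∣ sgn i * p ∣ ≡ ∣ p ∣
    ∣sgn∣ zero    = cong ∣_∣ (*-identityˡ p)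
    ∣sgn∣ (suc i) = trans (cong ∣_∣ (sym (neg-distribˡ-* (sgn i) p))) (trans (∣-p∣≡∣p∣ (sgn i * p)) (∣sgn∣ i))

  -- Cauchy's bound: beyond 1 + Σ ∣p j∣ the leading term dominates.
  sign-at-minus-infinity : ∀ p m M → 1ℚ ≤ p 0 → 1ℚ + absBound p m ≤ M → 1ℚ ≤ sgn m * horner p (- M) m
  sign-at-minus-infinity p zero    M 1≤p₀ _ = subst (1ℚ ≤_) (sym (*-identityˡ (p 0))) 1≤p₀
  sign-at-minus-infinity p (suc m) M 1≤p₀ A≤M = ≤-by _
    (0≤+ (0≤+ (0≤+ (p≤q⇒0≤q-p A≤M) (0≤absBound p m))
      (0≤* (≤-trans (0≤+ (<⇒≤ 0<1) (0≤absBound p (suc m))) A≤M) (p≤q⇒0≤q-p ih)))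
      (p≤q⇒0≤q-p (∣sgn*∣ (suc m) (p (suc m)))))
    (lemma M (sgn m) (horner p (- M) m) (p (suc m)) (absBound p m) ∣ p (suc m) ∣)
    where
    ih : 1ℚ ≤ sgn m * horner p (- M) m
    ih = sign-at-minus-infinity p m M 1≤p₀
      (≤-trans (≤-by _ (0≤∣p∣ (p (suc m))) (+-assoc 1ℚ (absBound p m) ∣ p (suc m) ∣)) A≤M)
    lemma : ∀ M s h a A b → 1ℚ + ((((M - (1ℚ + (A + b))) + A) + M * (s * h - 1ℚ)) + ((- s) * a - (- b)))
      ≡ (- s) * ((- M) * h + a)
    lemma = solve-∀ ℚ-ring

  far-left : ∀ p m x → 1ℚ ≤ p 0 → ∃[ y ] (y <ᴿ x × Pos (σ m *ᴿ eval p m y))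
  far-left p m x 1≤p₀ = fromℚ (- M)
    , mkPos 1ℚ 0<1 (eventually-map (λ n x≤B → <-by _
        (+-mono-≤-< (0≤+ (p≤q⇒0≤q-p (≤-trans (-p≤∣p∣ (seq x n)) x≤B)) (0≤absBound p m)) 0<1) (lemma (seq x n) B A))
        (proj₂ (proj₂ bd)))
    , Pos-resp (pointwise λ n → cong (sgn m *_) (sym (seq-eval p m (fromℚ (- M)) n)))
        (Pos-fromℚ (<-≤-trans 0<1 (sign-at-minus-infinity p m M 1≤p₀
          (≤-by _ (0≤+ 0≤B (<⇒≤ 0<1)) refl))))
    where
    bd : ∃[ B ] (Positive B × ∃[ N ] (∀ n → N ℕ.≤ n → ∣ seq x n ∣ ≤ B))
    bd = bounded {seq x} (cauchy x)
    A B M : ℚ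
    A = absBound p m
    B = proj₁ bd
    -- The first summand meets Cauchy's bound, the second places `- M` to the left of `x`.
    M = (1ℚ + A) + (B + 1ℚ)
    0≤B : 0ℚ ≤ B
    0≤B = <⇒≤ (positive⁻¹ B {{proj₁ (proj₂ bd)}})
    lemma : ∀ x B A → 1ℚ + (((B - (- x)) + A) + 1ℚ) ≡ x - (- ((1ℚ + A) + (B + 1ℚ)))
    lemma = solve-∀ ℚ-ring

  infixr 8 _·_
  _·_ : ℕ → ℝ → ℝ
  _·_ = multiple (CommutativeRing.+-rawMonoid ℝ-ring)

  seq-· : ∀ k x n → seq (k · x) n ≡ nat k * seq x n
  seq-· zero    x n = sym (*-zeroˡ (seq x n))
  seq-· (suc k) x n = trans (cong (λ s → seq x n + s) (seq-· k x n)) (lemma (seq x n) (nat k))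
    where
    lemma : ∀ x k → x + k * x ≡ (1ℚ + k) * x
    lemma = solve-∀ ℚ-ring

  -- With n = 2 + `t`, the top number of blocks is `suc ⌊ t /2⌋`. Past the degree the truncated
  -- subtraction reaches zero blocks, where `E` vanishes, so the sequence is padded with zeros.
  coeff : ℕ → ℕ → ℚ
  coeff t j = nat (E (2 ℕ.+ t) (suc ⌊ t /2⌋ ∸ j))

  -- F t is D₂₊ₜ(x) / x, a polynomial of degree ⌊t/2⌋.
  F : ℕ → ℝ → ℝ
  F t = eval (coeff t) ⌊ t /2⌋

  ascCoeff : ℕ → ℕ → ℝ
  ascCoeff t i = fromℚ (nat (E (2 ℕ.+ t) (suc i)))

  ⌊t/2⌋<i⇒t<2i : ∀ t {i} → ⌊ t /2⌋ ℕ.< i → t ℕ.< i ℕ.+ i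
  ⌊t/2⌋<i⇒t<2i zero          {suc i} _       = s≤s z≤n
  ⌊t/2⌋<i⇒t<2i (suc zero)    {suc i} _       = s≤s (subst (1 ℕ.≤_) (sym (ℕ.+-suc i i)) (s≤s z≤n))
  ⌊t/2⌋<i⇒t<2i (suc (suc t)) {suc i} (s≤s h) =
    s≤s (subst (2 ℕ.+ t ℕ.≤_) (sym (ℕ.+-suc i i)) (s≤s (⌊t/2⌋<i⇒t<2i t h)))

  E-high : ∀ t i → ⌊ t /2⌋ ℕ.< i → E (2 ℕ.+ t) (suc i) ≡ 0
  E-high t i h = E-vanish (2 ℕ.+ t) (suc i)
    (s≤s (subst (2 ℕ.+ t ℕ.≤_) (sym (ℕ.+-suc i i)) (s≤s (⌊t/2⌋<i⇒t<2i t h))))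

  ascCoeff-high : ∀ t i → ⌊ t /2⌋ ℕ.< i → ascCoeff t i ≃ 0ᴿ
  ascCoeff-high t i h = pointwise λ _ → cong nat (E-high t i h)

  ascCoeff≃coeff : ∀ t j → j ℕ.≤ ⌊ t /2⌋ → ascCoeff t (⌊ t /2⌋ ∸ j) ≃ fromℚ (coeff t j)
  ascCoeff≃coeff t j j≤m = pointwise λ _ → cong (λ k → nat (E (2 ℕ.+ t) k)) (sym (ℕ.+-∸-assoc 1 j≤m))

  ascending≃F : ∀ t N x → ⌊ t /2⌋ ℕ.< N → ascending (ascCoeff t) N x ≃ F t x
  ascending≃F t N x m<N = ≃-trans
    (subst (λ k → ascending (ascCoeff t) k x ≃ ascending (ascCoeff t) (suc ⌊ t /2⌋) x) (ℕ.m+[n∸m]≡n m<N)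
      (ℝ[X].ascending-truncate (ascCoeff t) (suc ⌊ t /2⌋) (N ∸ suc ⌊ t /2⌋) x (ascCoeff-high t)))
    (≃-trans (ℝ[X].ascending≈horner (ascCoeff t) ⌊ t /2⌋ x)
      (ℝ[X].horner-cong ⌊ t /2⌋ (ascCoeff≃coeff t) ≃-refl))

  -- F′ t is the derivative of x F t(x), that is of D₂₊ₜ.
  F′ : ℕ → ℝ → ℝ
  F′ t x = ℝ[X].horner (ℝ[X].horner (fromℚ ∘ coeff t) x) x ⌊ t /2⌋

  ascending≃F′ : ∀ t N x → ⌊ t /2⌋ ℕ.< N → ascending (λ i → suc i · ascCoeff t i) N x ≃ F′ t x
  ascending≃F′ t N x m<N = ≃-trans
    (subst (λ k → ascending a k x ≃ ascending a (suc ⌊ t /2⌋) x) (ℕ.m+[n∸m]≡n m<N)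
      (ℝ[X].ascending-truncate a (suc ⌊ t /2⌋) (N ∸ suc ⌊ t /2⌋) x
        (λ i h → pointwise λ n → trans (seq-· (suc i) (ascCoeff t i) n)
          (trans (cong (λ e → nat (suc i) * nat e) (E-high t i h)) (*-zeroʳ (nat (suc i)))))))
    (≃-trans (ℝ[X].derivative≈horner² (ascCoeff t) ⌊ t /2⌋ x)
      (ℝ[X].horner-cong ⌊ t /2⌋ (λ k k≤m → ℝ[X].horner-cong k
        (λ j j≤k → ascCoeff≃coeff t j (ℕ.≤-trans j≤k k≤m)) ≃-refl) ≃-refl))
    where
    a : ℕ → ℝ
    a i = suc i · ascCoeff t i

  -- The polynomials involved may differ in degree, so all are written as ascending sums of one
  -- common length, where `E-rec` applies coefficient by coefficient.
  F-rec : ∀ t x → F (2 ℕ.+ t) x ≃ F′ (1 ℕ.+ t) x +ᴿ (3 ℕ.+ t) · (x *ᴿ F t x)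
  F-rec t x = begin
    F (2 ℕ.+ t) x
      ≈⟨ ascending≃F (2 ℕ.+ t) (suc N) x (s≤s (ℕ.⌊n/2⌋≤n (2 ℕ.+ t))) ⟨
    ascending (ascCoeff (2 ℕ.+ t)) (suc N) x
      ≈⟨ ℝ[X].ascending-cong (suc N) x recurrence ⟩
    ascending (λ i → suc i · ascCoeff (1 ℕ.+ t) i +ᴿ (3 ℕ.+ t) · g i) (suc N) x
      ≈⟨ ℝ[X].ascending-+ (λ i → suc i · ascCoeff (1 ℕ.+ t) i) (λ i → (3 ℕ.+ t) · g i) (suc N) x ⟩
    ascending (λ i → suc i · ascCoeff (1 ℕ.+ t) i) (suc N) x +ᴿ ascending (λ i → (3 ℕ.+ t) · g i) (suc N) x
      ≈⟨ +ᴿ-cong (ascending≃F′ (1 ℕ.+ t) (suc N) x (s≤s (ℕ.m≤n⇒m≤1+n (ℕ.⌊n/2⌋≤n (1 ℕ.+ t)))))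
           (ℝ[X].ascending-· (3 ℕ.+ t) g (suc N) x) ⟩
    F′ (1 ℕ.+ t) x +ᴿ (3 ℕ.+ t) · ascending g (suc N) x
      ≈⟨ +ᴿ-cong ≃-refl (·-cong (3 ℕ.+ t) shift) ⟩
    F′ (1 ℕ.+ t) x +ᴿ (3 ℕ.+ t) · (x *ᴿ F t x) ∎
    where
    open import Relation.Binary.Reasoning.Setoid (CommutativeRing.setoid ℝ-ring)
    N : ℕ
    N = 2 ℕ.+ t
    g : ℕ → ℝ
    g i = fromℚ (nat (E (2 ℕ.+ t) i))
    ·-cong : ∀ k {x y} → x ≃ y → k · x ≃ k · y
    ·-cong zero    e = ≃-refl
    ·-cong (suc k) e = +ᴿ-cong e (·-cong k e)
    recurrence : ∀ i → ascCoeff (2 ℕ.+ t) i ≃ suc i · ascCoeff (1 ℕ.+ t) i +ᴿ (3 ℕ.+ t) · g i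
    recurrence i = pointwise λ n → trans (cong nat (E-rec (3 ℕ.+ t) i))
      (trans (nat-+ (suc i ℕ.* E (3 ℕ.+ t) (suc i)) ((3 ℕ.+ t) ℕ.* E (2 ℕ.+ t) i))
        (cong₂ _+_ (trans (nat-* (suc i) (E (3 ℕ.+ t) (suc i))) (sym (seq-· (suc i) (ascCoeff (1 ℕ.+ t) i) n)))
          (trans (nat-* (3 ℕ.+ t) (E (2 ℕ.+ t) i)) (sym (seq-· (3 ℕ.+ t) (g i) n)))))
    -- The constant term `g 0` counts partitions into no blocks and is zero, which lets the factor
    -- `x` out.
    shift : ascending g (suc N) x ≃ x *ᴿ F t x
    shift = ≃-trans (pointwise λ n → +-identityˡ _)
      (*ᴿ-cong (≃-refl {x}) (ascending≃F t N x (s≤s (ℕ.m≤n⇒m≤1+n (ℕ.⌊n/2⌋≤n t)))))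

  -- The leading coefficient is a positive integer; being at least one, it keeps Cauchy's bound free
  -- of division.
  coeff₀≥1 : ∀ t → 1ℚ ≤ coeff t 0
  coeff₀≥1 t = nat-mono (E-pos t)

  F-at-0 : ∀ t → F t 0ᴿ ≃ 1ᴿ
  F-at-0 t = pointwise λ n → trans (seq-eval (coeff t) ⌊ t /2⌋ 0ᴿ n)
    (trans (at-0 ⌊ t /2⌋) (cong nat (trans (cong (E (2 ℕ.+ t)) (trans (ℕ.+-∸-assoc 1 {⌊ t /2⌋} ℕ.≤-refl)
      (cong suc (ℕ.n∸n≡0 ⌊ t /2⌋)))) (E-one t))))
    where
    at-0 : ∀ {p} m → horner p 0ℚ m ≡ p m
    at-0 zero            = refl
    at-0 {p} (suc m) = trans (cong (_+ p (suc m)) (*-zeroˡ (horner p 0ℚ m))) (+-identityˡ (p (suc m)))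

  0∷ : (ℕ → ℝ) → ℕ → ℝ
  0∷ z zero    = 0ᴿ
  0∷ z (suc i) = z i

  -- Interlacing is kept as the signs of `F t` at the roots of `F (suc t)`, so the roots of `F t`
  -- are never named.
  record Interlaced (t : ℕ) : Set where
    m : ℕ
    m = ⌊ suc t /2⌋
    field
      z          : ℕ → ℝ
      isRoot     : ∀ i → i ℕ.< m → F (suc t) (z i) ≃ 0ᴿ
      descending : Descending (0∷ z) m
      sign       : ∀ i → i ℕ.< m → Pos (σ i *ᴿ F t (z i))

    z-descending : ∀ i j → i ℕ.< j → j ℕ.< m → z j <ᴿ z i
    z-descending i j i<j j<m = descend {0∷ z} descending (s≤s i<j) j<m

    z<0 : ∀ i → i ℕ.< m → z i <ᴿ 0ᴿ
    z<0 i i<m = descend {0∷ z} descending (s≤s z≤n) i<m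

    roots : Roots (fromℚ ∘ coeff (suc t)) z m
    roots = descending⇒roots isRoot z-descending

  module Step {t : ℕ} (I : Interlaced t) where
    open Interlaced I

    Pos-· : ∀ k {x} → Pos x → Pos (suc k · x)
    Pos-· zero    {x} p = Pos-resp (pointwise λ n → sym (+-identityʳ (seq x n))) p
    Pos-· (suc k)     p = Pos-+ p (Pos-· k p)

    -- At a root of `F (suc t)` the term `F′` reduces to `z i *ᴿ G`, with `G` the derivative of
    -- `F (suc t)` there. The recurrence then has the common factor `z i`, which is negative, while
    -- both remaining summands have sign (-1)ⁱ.
    sign-at-root : ∀ i → i ℕ.< m → Pos (σ (suc i) *ᴿ F (2 ℕ.+ t) (z i))
    sign-at-root i i<m = at m refl i<m
      where
      -- The index `i` forces `m` to be a successor; exposing this names the degree `k` of the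
      -- quotient.
      at : ∀ k → m ≡ k → i ℕ.< k → Pos (σ (suc i) *ᴿ F (2 ℕ.+ t) (z i))
      at (suc k) m≡ i<k = Pos-resp
        (≃-trans (pointwise λ n → trans (lemma (seq (z i) n) (sgn i) (seq G n) (nat (3 ℕ.+ t)) (seq (F t (z i)) n))
            (cong (λ s → (- sgn i) * (seq (z i) n * seq G n + s)) (sym (seq-· (3 ℕ.+ t) (z i *ᴿ F t (z i)) n))))
          (*ᴿ-cong (≃-refl {σ (suc i)}) (≃-sym (≃-trans (F-rec t (z i)) (+ᴿ-cong F′≃ ≃-refl)))))
        (Pos-* (z<0 i i<m) (Pos-+ Gpos (Pos-resp {y = fromℚ (nat (3 ℕ.+ t)) *ᴿ (σ i *ᴿ F t (z i))}
          (pointwise λ n → seq-· (3 ℕ.+ t) (σ i *ᴿ F t (z i)) n) (Pos-· (2 ℕ.+ t) (sign i i<m)))))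
        where
        p : ℕ → ℝ
        p = fromℚ ∘ coeff (suc t)
        G : ℝ
        G = ℝ[X].horner (ℝ[X].horner p (z i)) (z i) k
        rootₖ : ∀ j → j ℕ.< suc k → ℝ[X].horner p (z j) (suc k) ≃ 0ᴿ
        rootₖ j j<k = subst (λ k → ℝ[X].horner p (z j) k ≃ 0ᴿ) m≡ (isRoot j (subst (j ℕ.<_) (sym m≡) j<k))
        Gpos : Pos (σ i *ᴿ G)
        Gpos = quotient-sign {p} {z} {k} i i<k (Pos-fromℚ (<-≤-trans 0<1 (coeff₀≥1 (suc t)))) rootₖ
          (λ a b a<b b<k → z-descending a b a<b (subst (b ℕ.<_) (sym m≡) b<k))
        F′≃ : F′ (suc t) (z i) ≃ z i *ᴿ G
        F′≃ = subst (λ k′ → ℝ[X].horner (ℝ[X].horner p (z i)) (z i) k′ ≃ z i *ᴿ G) (sym m≡)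
          (≃-trans (+ᴿ-cong (≃-refl {z i *ᴿ G}) (rootₖ i i<k)) (pointwise λ n → +-identityʳ _))
        lemma : ∀ z s g k f → (0ℚ - z) * (s * g + k * (s * f)) ≡ (- s) * (z * g + k * (z * f))
        lemma = solve-∀ ℚ-ring

    m⁺ : ℕ
    m⁺ = ⌊ 2 ℕ.+ t /2⌋

    sign-at-grid : ∀ i → i ℕ.≤ m → Pos (σ i *ᴿ F (2 ℕ.+ t) (0∷ z i))
    sign-at-grid zero    _   = Pos-resp (≃-trans (pointwise λ n → sym (*-identityˡ 1ℚ))
      (*ᴿ-cong (≃-refl {σ 0}) (≃-sym (F-at-0 (2 ℕ.+ t))))) (Pos-fromℚ 0<1)
    sign-at-grid (suc i) i<m = sign-at-root i i<m

    -- The degree grows at every second step only. This record hides which case occurs: an extra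
    -- point on the far left is present exactly when the degree grows, and the bounds relating `m`
    -- and `m⁺` serve both cases.
    record Grid : Set where
      field
        y           : ℕ → ℝ
        y≡          : ∀ i → i ℕ.≤ m → y i ≡ 0∷ z i
        descends    : Descending y m⁺
        alternates  : Alternating (coeff (2 ℕ.+ t)) m⁺ y
        m≤m⁺        : m ℕ.≤ m⁺
        m⁺≤1+m      : m⁺ ℕ.≤ suc m

    grid-same : m ≡ m⁺ → Grid
    grid-same m≡m⁺ = record
      { y          = 0∷ z
      ; y≡         = λ _ _ → refl
      ; descends   = λ i i<m⁺ → descending i (subst (i ℕ.<_) (sym m≡m⁺) i<m⁺)
      ; alternates = λ i i≤m⁺ → sign-at-grid i (subst (i ℕ.≤_) (sym m≡m⁺) i≤m⁺)
      ; m≤m⁺       = ℕ.≤-reflexive m≡m⁺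
      ; m⁺≤1+m     = ℕ.m≤n⇒m≤1+n (ℕ.≤-reflexive (sym m≡m⁺))
      }

    grid-grow : suc m ≡ m⁺ → Grid
    grid-grow 1+m≡m⁺ = record
      { y          = y
      ; y≡         = y≡
      ; descends   = λ i i<m⁺ → descends i (subst (i ℕ.<_) (sym 1+m≡m⁺) i<m⁺)
      ; alternates = λ i i≤m⁺ → alternates i (subst (i ℕ.≤_) (sym 1+m≡m⁺) i≤m⁺)
      ; m≤m⁺       = ℕ.<⇒≤ (ℕ.≤-reflexive 1+m≡m⁺)
      ; m⁺≤1+m     = ℕ.≤-reflexive (sym 1+m≡m⁺)
      }
      where
      last : ∃[ y ] (y <ᴿ 0∷ z m × Pos (σ m⁺ *ᴿ F (2 ℕ.+ t) y))
      last = far-left (coeff (2 ℕ.+ t)) m⁺ (0∷ z m) (coeff₀≥1 (2 ℕ.+ t))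
      y : ℕ → ℝ
      y i with i ℕ.≤? m
      ... | yes _ = 0∷ z i
      ... | no  _ = proj₁ last
      y≡ : ∀ i → i ℕ.≤ m → y i ≡ 0∷ z i
      y≡ i i≤m with i ℕ.≤? m
      ... | yes _   = refl
      ... | no  i≰m = ⊥-elim (i≰m i≤m)
      y-last : y (suc m) ≡ proj₁ last
      y-last with suc m ℕ.≤? m
      ... | yes 1+m≤m = ⊥-elim (ℕ.1+n≰n 1+m≤m)
      ... | no  _     = refl
      descends : Descending y (suc m)
      descends i (s≤s i≤m) with ℕ.m≤n⇒m<n∨m≡n i≤m
      ... | inj₁ i<m  = subst₂ _<ᴿ_ (sym (y≡ (suc i) i<m)) (sym (y≡ i i≤m)) (descending i i<m)
      ... | inj₂ refl = subst₂ _<ᴿ_ (sym y-last) (sym (y≡ i i≤m)) (proj₁ (proj₂ last))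
      alternates : ∀ i → i ℕ.≤ suc m → Pos (σ i *ᴿ F (2 ℕ.+ t) (y i))
      alternates i i≤1+m with ℕ.m≤n⇒m<n∨m≡n i≤1+m
      ... | inj₁ (s≤s i≤m) = subst (λ x → Pos (σ i *ᴿ F (2 ℕ.+ t) x)) (sym (y≡ i i≤m)) (sign-at-grid i i≤m)
      ... | inj₂ refl = subst₂ (λ k x → Pos (σ k *ᴿ F (2 ℕ.+ t) x)) (sym 1+m≡m⁺) (sym y-last) (proj₂ (proj₂ last))

    half-step : ∀ t → ⌊ suc t /2⌋ ≡ suc ⌊ t /2⌋ ⊎ suc ⌊ suc t /2⌋ ≡ suc ⌊ t /2⌋
    half-step zero          = inj₂ refl
    half-step (suc zero)    = inj₁ refl
    half-step (suc (suc t)) with half-step t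
    ... | inj₁ e = inj₁ (cong suc e)
    ... | inj₂ e = inj₂ (cong suc e)

    grid : Grid
    grid with half-step t
    ... | inj₁ e = grid-same e
    ... | inj₂ e = grid-grow e

    open Grid grid

    next : Interlaced (suc t)
    next = record
      { z          = w
      ; isRoot     = λ i i<m⁺ → proj₂ (proj₂ (spec i i<m⁺))
      ; descending = w-descending
      ; sign       = w-sign
      }
      where
      ws : Σ[ w ∈ (ℕ → ℝ) ] (∀ i → i ℕ.< m⁺ → y (suc i) <ᴿ w i × w i <ᴿ y i × F (2 ℕ.+ t) (w i) ≃ 0ᴿ)
      ws = alternating-roots (coeff (2 ℕ.+ t)) m⁺ y descends alternates
      w : ℕ → ℝ
      w = proj₁ ws
      spec : ∀ i → i ℕ.< m⁺ → y (suc i) <ᴿ w i × w i <ᴿ y i × F (2 ℕ.+ t) (w i) ≃ 0ᴿ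
      spec = proj₂ ws
      w-descending : Descending (0∷ w) m⁺
      w-descending zero    0<m⁺ = subst (w 0 <ᴿ_) (y≡ 0 z≤n) (proj₁ (proj₂ (spec 0 0<m⁺)))
      w-descending (suc i) i<m⁺ = <ᴿ-trans {w (suc i)} {y (suc i)} {w i}
        (proj₁ (proj₂ (spec (suc i) i<m⁺))) (proj₁ (spec i (ℕ.<⇒≤ i<m⁺)))
      w<z : ∀ i → i ℕ.< m⁺ → ∀ j → j ℕ.< i → w i <ᴿ z j
      w<z i i<m⁺ j j<i = subst (w i <ᴿ_) (y≡ (suc j) (ℕ.≤-trans j<i (ℕ.≤-pred (ℕ.≤-trans i<m⁺ m⁺≤1+m)))) w<y
        where
        w<y : w i <ᴿ y (suc j)
        w<y with ℕ.m≤n⇒m<n∨m≡n j<i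
        ... | inj₁ 1+j<i = <ᴿ-trans {w i} {y i} {y (suc j)} (proj₁ (proj₂ (spec i i<m⁺)))
          (descend {y} descends 1+j<i (ℕ.<⇒≤ i<m⁺))
        ... | inj₂ refl  = proj₁ (proj₂ (spec i i<m⁺))
      z<w : ∀ i → i ℕ.< m⁺ → ∀ j → i ℕ.≤ j → j ℕ.< m → z j <ᴿ w i
      z<w i i<m⁺ j i≤j j<m = subst (_<ᴿ w i) (y≡ (suc j) j<m) y<w
        where
        y<w : y (suc j) <ᴿ w i
        y<w with ℕ.m≤n⇒m<n∨m≡n i≤j
        ... | inj₁ i<j  = <ᴿ-trans {y (suc j)} {y (suc i)} {w i}
          (descend {y} descends (s≤s i<j) (ℕ.≤-trans j<m m≤m⁺)) (proj₁ (spec i i<m⁺))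
        ... | inj₂ refl = proj₁ (spec i i<m⁺)
      -- Lying between consecutive grid points, `w i` has exactly the `z j` with `j < i` on its
      -- right, so the factorisation of `F (suc t)` shows the sign.
      w-sign : ∀ i → i ℕ.< m⁺ → Pos (σ i *ᴿ F (suc t) (w i))
      w-sign i i<m⁺ = Pos-resp
        (≃-trans (pointwise λ n → lemma (coeff (suc t) 0) (sgn i) (seq (prod z m (w i)) n))
          (*ᴿ-cong (≃-refl {σ i}) (≃-sym (ℝ[X].factor roots (w i)))))
        (Pos-* (Pos-fromℚ (<-≤-trans 0<1 (coeff₀≥1 (suc t))))
          (prod-sign z m i (w i) (ℕ.≤-pred (ℕ.≤-trans i<m⁺ m⁺≤1+m)) (w<z i i<m⁺) (z<w i i<m⁺)))
        where
        lemma : ∀ p s q → p * (s * q) ≡ s * (p * q)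
        lemma = solve-∀ ℚ-ring

  interlaced : ∀ t → Interlaced t
  -- `F 1` is constant: `m` is zero and every condition is vacuous.
  interlaced zero    = record { z = λ _ → 0ᴿ ; isRoot = λ _ () ; descending = λ _ () ; sign = λ _ () }
  interlaced (suc t) = Step.next (interlaced t)

-- From roots of `F` to all zeros of `Dpoly`

module Zeros where

  open import Defs hiding (_≤_)
  open CauchySequences using (ℚ-ring; half-pos; ∣∣p∣-∣q∣∣≤∣p-q∣)
  open import Algebra.Definitions.RawMonoid using () renaming (_×_ to multiple)
  open import Algebra.Structures using (IsCommutativeRing)
  open import Data.Empty using (⊥-elim)
  open import Data.Nat.Base as ℕ using (ℕ; zero; suc; _∸_; ⌊_/2⌋; z≤n; s≤s)
  import Data.Nat.Properties as ℕ
  open import Data.Product.Base using (_×_; _,_; proj₁; proj₂)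
  open import Data.Rational.Base hiding (_≃_; _÷_)
  open import Data.Rational.Properties hiding (≃-sym)
  open import Data.Sum.Base using (inj₁; inj₂)
  open import Function.Base using (_∘_)
  open import Level using (0ℓ)
  open import Relation.Binary.PropositionalEquality
  open import Relation.Nullary using (¬_)
  open import Tactic.RingSolver using (solve-∀)
  open Counting using (E; D≡E; E-pos)
  open RealAnalysis
  open Interlacing
  open ℝ[X] using (prod; Roots; mkRoots; e₁; e₂; p₂)

  module _ {c ℓ} (R : CommutativeRing c ℓ) where
    private
      module A = CommutativeRing R
      module P = Horner R

    intCoeff : ℕ → ℕ → A.Carrier
    intCoeff t j = multiple A.+-rawMonoid (E (2 ℕ.+ t) (suc ⌊ t /2⌋ ∸ j)) A.1#

    -- One computation for all commutative rings, used for ℝ and for ℂ; `E-high` cuts the sum off at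
    -- the true degree.
    Dpoly≈x*horner : ∀ t x →
      Dpoly (Semiring.rawSemiring A.semiring) (2 ℕ.+ t) x A.≈ x A.* P.horner (intCoeff t) x ⌊ t /2⌋
    Dpoly≈x*horner t x = A.trans (P.sum≈ascending n (D n ∘ suc) (λ i → x ^ suc i) x (λ _ → A.refl))
      (A.*-cong (A.*-identityʳ x)
        (A.trans (P.ascending-cong n x (λ i → A.reflexive (cong (λ k → multiple A.+-rawMonoid k A.1#) (D≡E n (suc i)))))
          (A.trans (A.reflexive (cong (λ k → P.ascending a k x) (sym (ℕ.m+[n∸m]≡n m<n))))
            (A.trans (P.ascending-truncate a (suc ⌊ t /2⌋) (n ∸ suc ⌊ t /2⌋) x
                (λ i h → A.reflexive (cong (λ k → multiple A.+-rawMonoid k A.1#) (E-high t i h))))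
              (A.trans (P.ascending≈horner a ⌊ t /2⌋ x)
                (P.horner-cong ⌊ t /2⌋ (λ j j≤m → A.reflexive (cong (λ k → multiple A.+-rawMonoid (E n k) A.1#)
                  (sym (ℕ.+-∸-assoc 1 j≤m)))) A.refl))))))
      where
      open import Algebra.Definitions.RawSemiring (Semiring.rawSemiring A.semiring) using (_^_)
      n : ℕ
      n = 2 ℕ.+ t
      a : ℕ → A.Carrier
      a i = multiple A.+-rawMonoid (E n (suc i)) A.1#
      m<n : ⌊ t /2⌋ ℕ.< n
      m<n = s≤s (ℕ.m≤n⇒m≤1+n (ℕ.⌊n/2⌋≤n t))

  intCoeff≃coeff : ∀ t j → intCoeff ℝ-ring t j ≃ fromℚ (coeff t j)
  intCoeff≃coeff t j = pointwise λ n → trans (seq-· (E (2 ℕ.+ t) (suc ⌊ t /2⌋ ∸ j)) 1ᴿ n) (*-identityʳ _)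

  Dpoly≃x*F : ∀ t x → Dpoly ℝ-rawSemiring (2 ℕ.+ t) x ≃ x *ᴿ F t x
  Dpoly≃x*F t x = ≃-trans (Dpoly≈x*horner ℝ-ring t x) (*ᴿ-cong (≃-refl {x})
    (ℝ[X].horner-cong ⌊ t /2⌋ (λ j _ → intCoeff≃coeff t j) (≃-refl {x})))

  -- Complex numbers and reality of the zeros

  infix 4 _≈ᶜ_
  _≈ᶜ_ : ℂ → ℂ → Set
  w ≈ᶜ z = re w ≃ re z × im w ≃ im z

  _+ᶜ_ _*ᶜ_ : ℂ → ℂ → ℂ
  w +ᶜ z = mkℂ (re w +ᴿ re z) (im w +ᴿ im z)
  w *ᶜ z = mkℂ (re w *ᴿ re z -ᴿ im w *ᴿ im z) (re w *ᴿ im z +ᴿ im w *ᴿ re z)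

  -ᶜ_ : ℂ → ℂ
  -ᶜ w = mkℂ (-ᴿ re w) (-ᴿ im w)

  ι : ℝ → ℂ
  ι x = mkℂ x 0ᴿ

  pointwiseᶜ : ∀ {w z} → (∀ n → seq (re w) n ≡ seq (re z) n) → (∀ n → seq (im w) n ≡ seq (im z) n) → w ≈ᶜ z
  pointwiseᶜ e f = pointwise e , pointwise f

  ℂ-isCommutativeRing : IsCommutativeRing _≈ᶜ_ _+ᶜ_ _*ᶜ_ -ᶜ_ (ι 0ᴿ) (ι 1ᴿ)
  ℂ-isCommutativeRing = record
    { isRing = record
      { +-isAbelianGroup = record
        { isGroup = record
          { isMonoid = record
            { isSemigroup = record
              { isMagma = record
                { isEquivalence = record
                  { refl  = ≃-refl , ≃-refl
                  ; sym   = λ (a , b) → ≃-sym a , ≃-sym b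
                  ; trans = λ (a , b) (c , d) → ≃-trans a c , ≃-trans b d }
                ; ∙-cong = λ (a , b) (c , d) → +ᴿ-cong a c , +ᴿ-cong b d }
              ; assoc = λ u v w → pointwiseᶜ (λ n → +-assoc (seq (re u) n) (seq (re v) n) (seq (re w) n))
                                             (λ n → +-assoc (seq (im u) n) (seq (im v) n) (seq (im w) n)) }
            ; identity = (λ u → pointwiseᶜ (λ n → +-identityˡ (seq (re u) n)) (λ n → +-identityˡ (seq (im u) n)))
                       , (λ u → pointwiseᶜ (λ n → +-identityʳ (seq (re u) n)) (λ n → +-identityʳ (seq (im u) n))) }
          ; inverse = (λ u → pointwiseᶜ (λ n → +-inverseˡ (seq (re u) n)) (λ n → +-inverseˡ (seq (im u) n)))
                    , (λ u → pointwiseᶜ (λ n → +-inverseʳ (seq (re u) n)) (λ n → +-inverseʳ (seq (im u) n)))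
          ; ⁻¹-cong = λ (a , b) → -ᴿ-cong a , -ᴿ-cong b }
        ; comm = λ u v → pointwiseᶜ (λ n → +-comm (seq (re u) n) (seq (re v) n)) (λ n → +-comm (seq (im u) n) (seq (im v) n)) }
      ; *-cong = λ (a , b) (c , d) → +ᴿ-cong (*ᴿ-cong a c) (-ᴿ-cong (*ᴿ-cong b d)) , +ᴿ-cong (*ᴿ-cong a d) (*ᴿ-cong b c)
      ; *-assoc = λ u v w → pointwiseᶜ
          (λ n → assoc-re (seq (re u) n) (seq (im u) n) (seq (re v) n) (seq (im v) n) (seq (re w) n) (seq (im w) n))
          (λ n → assoc-im (seq (re u) n) (seq (im u) n) (seq (re v) n) (seq (im v) n) (seq (re w) n) (seq (im w) n))
      ; *-identity = (λ u → pointwiseᶜ (λ n → id-reˡ (seq (re u) n) (seq (im u) n)) (λ n → id-imˡ (seq (re u) n) (seq (im u) n)))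
                   , (λ u → pointwiseᶜ (λ n → id-reʳ (seq (re u) n) (seq (im u) n)) (λ n → id-imʳ (seq (re u) n) (seq (im u) n)))
      ; distrib = (λ u v w → pointwiseᶜ
            (λ n → distrib-reˡ (seq (re u) n) (seq (im u) n) (seq (re v) n) (seq (im v) n) (seq (re w) n) (seq (im w) n))
            (λ n → distrib-imˡ (seq (re u) n) (seq (im u) n) (seq (re v) n) (seq (im v) n) (seq (re w) n) (seq (im w) n)))
        , (λ u v w → pointwiseᶜ
            (λ n → distrib-reʳ (seq (re u) n) (seq (im u) n) (seq (re v) n) (seq (im v) n) (seq (re w) n) (seq (im w) n))
            (λ n → distrib-imʳ (seq (re u) n) (seq (im u) n) (seq (re v) n) (seq (im v) n) (seq (re w) n) (seq (im w) n))) }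
    ; *-comm = λ u v → pointwiseᶜ
        (λ n → comm-re (seq (re u) n) (seq (im u) n) (seq (re v) n) (seq (im v) n))
        (λ n → comm-im (seq (re u) n) (seq (im u) n) (seq (re v) n) (seq (im v) n)) }
    where
    assoc-re : ∀ a b c d e f → (a * c - b * d) * e - (a * d + b * c) * f ≡ a * (c * e - d * f) - b * (c * f + d * e)
    assoc-re = solve-∀ ℚ-ring
    assoc-im : ∀ a b c d e f → (a * c - b * d) * f + (a * d + b * c) * e ≡ a * (c * f + d * e) + b * (c * e - d * f)
    assoc-im = solve-∀ ℚ-ring
    id-reˡ : ∀ a b → 1ℚ * a - 0ℚ * b ≡ a
    id-reˡ = solve-∀ ℚ-ring
    id-imˡ : ∀ a b → 1ℚ * b + 0ℚ * a ≡ b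
    id-imˡ = solve-∀ ℚ-ring
    id-reʳ : ∀ a b → a * 1ℚ - b * 0ℚ ≡ a
    id-reʳ = solve-∀ ℚ-ring
    id-imʳ : ∀ a b → a * 0ℚ + b * 1ℚ ≡ b
    id-imʳ = solve-∀ ℚ-ring
    distrib-reˡ : ∀ a b c d e f → a * (c + e) - b * (d + f) ≡ (a * c - b * d) + (a * e - b * f)
    distrib-reˡ = solve-∀ ℚ-ring
    distrib-imˡ : ∀ a b c d e f → a * (d + f) + b * (c + e) ≡ (a * d + b * c) + (a * f + b * e)
    distrib-imˡ = solve-∀ ℚ-ring
    distrib-reʳ : ∀ a b c d e f → (c + e) * a - (d + f) * b ≡ (c * a - d * b) + (e * a - f * b)
    distrib-reʳ = solve-∀ ℚ-ring
    distrib-imʳ : ∀ a b c d e f → (c + e) * b + (d + f) * a ≡ (c * b + d * a) + (e * b + f * a)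
    distrib-imʳ = solve-∀ ℚ-ring
    comm-re : ∀ a b c d → a * c - b * d ≡ c * a - d * b
    comm-re = solve-∀ ℚ-ring
    comm-im : ∀ a b c d → a * d + b * c ≡ c * b + d * a
    comm-im = solve-∀ ℚ-ring

  ℂ-ring : CommutativeRing 0ℓ 0ℓ
  ℂ-ring = record { isCommutativeRing = ℂ-isCommutativeRing }

  module ℂ[X] = Horner ℂ-ring
  module ℂ-ring = CommutativeRing ℂ-ring

  ι-+ : ∀ x y → ι (x +ᴿ y) ≈ᶜ ι x +ᶜ ι y
  ι-+ x y = pointwiseᶜ (λ _ → refl) (λ _ → refl)

  ι-* : ∀ x y → ι (x *ᴿ y) ≈ᶜ ι x *ᶜ ι y
  ι-* x y = pointwiseᶜ (λ n → lemma₁ (seq x n) (seq y n)) (λ n → lemma₂ (seq x n) (seq y n))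
    where
    lemma₁ : ∀ x y → x * y ≡ x * y - 0ℚ * 0ℚ
    lemma₁ = solve-∀ ℚ-ring
    lemma₂ : ∀ x y → 0ℚ ≡ x * 0ℚ + 0ℚ * y
    lemma₂ = solve-∀ ℚ-ring

  ι-cong : ∀ {x y} → x ≃ y → ι x ≈ᶜ ι y
  ι-cong e = e , ≃-refl

  ι-· : ∀ k → multiple ℂ-ring.+-rawMonoid k (ι 1ᴿ) ≈ᶜ ι (k · 1ᴿ)
  ι-· zero    = ℂ-ring.refl
  ι-· (suc k) = ℂ-ring.trans (ℂ-ring.+-congˡ {ι 1ᴿ} (ι-· k)) (ℂ-ring.sym (ι-+ 1ᴿ (k · 1ᴿ)))

  ι-horner : ∀ t x m → ℂ[X].horner (intCoeff ℂ-ring t) (ι x) m ≈ᶜ ι (ℝ[X].horner (fromℚ ∘ coeff t) x m)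
  ι-horner t x m = ℂ-ring.trans (step m) (ι-cong (ℝ[X].horner-cong m (λ j _ → intCoeff≃coeff t j) (≃-refl {x})))
    where
    coeff-ι : ∀ j → intCoeff ℂ-ring t j ≈ᶜ ι (intCoeff ℝ-ring t j)
    coeff-ι j = ι-· (E (2 ℕ.+ t) (suc ⌊ t /2⌋ ∸ j))
    step : ∀ m → ℂ[X].horner (intCoeff ℂ-ring t) (ι x) m ≈ᶜ ι (ℝ[X].horner (intCoeff ℝ-ring t) x m)
    step zero    = coeff-ι 0
    step (suc m) = ℂ-ring.trans (ℂ-ring.+-cong (ℂ-ring.*-congˡ {ι x} (step m)) (coeff-ι (suc m)))
      (ℂ-ring.sym (ℂ-ring.trans (ι-+ (x *ᴿ h) (intCoeff ℝ-ring t (suc m))) (ℂ-ring.+-congʳ (ι-* x h))))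
      where
      h : ℝ
      h = ℝ[X].horner (intCoeff ℝ-ring t) x m

  -- A real factor acts on real and imaginary parts separately.
  ι-cancellable : ∀ x y → ℝ[X].Cancellable (x -ᴿ y) → ℂ[X].Cancellable (ι x +ᶜ (-ᶜ ι y))
  ι-cancellable x y can b (e , f) =
      can (re b) (≃-trans (pointwise λ n → lemma₁ (seq x n - seq y n) (seq (re b) n) (seq (im b) n)) e)
    , can (im b) (≃-trans (pointwise λ n → lemma₂ (seq x n - seq y n) (seq (re b) n) (seq (im b) n)) f)
    where
    lemma₁ : ∀ d a b → d * a ≡ d * a - (0ℚ + - 0ℚ) * b
    lemma₁ = solve-∀ ℚ-ring
    lemma₂ : ∀ d a b → d * b ≡ d * b + (0ℚ + - 0ℚ) * a
    lemma₂ = solve-∀ ℚ-ring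

  -- The squared modulus: multiplicative, and free of square roots.
  norm : ℂ → ℝ
  norm w = re w *ᴿ re w +ᴿ im w *ᴿ im w

  norm-* : ∀ w z → norm (w *ᶜ z) ≃ norm w *ᴿ norm z
  norm-* w z = pointwise λ n → lemma (seq (re w) n) (seq (im w) n) (seq (re z) n) (seq (im z) n)
    where
    lemma : ∀ a b c d → (a * c - b * d) * (a * c - b * d) + (a * d + b * c) * (a * d + b * c) ≡ (a * a + b * b) * (c * c + d * d)
    lemma = solve-∀ ℚ-ring

  norm-cong : ∀ {w z} → w ≈ᶜ z → norm w ≃ norm z
  norm-cong (e , f) = +ᴿ-cong (*ᴿ-cong e e) (*ᴿ-cong f f)

  Pos-norm : ∀ w → Pos (im w *ᴿ im w) → Pos (norm w)
  Pos-norm w = Pos-mono λ n → ≤-by _ (0≤p² (seq (re w) n)) (+-comm (seq (im w) n * seq (im w) n) (seq (re w) n * seq (re w) n))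

  -- Refuting positivity gives x² ≤ 0, hence eventually x² < ε², and so |x| < ε for every ε.
  ¬Pos²⇒≃0 : ∀ x → ¬ Pos (x *ᴿ x) → x ≃ 0ᴿ
  ¬Pos²⇒≃0 x ¬pos = mk≃ λ ε 0<ε → eventually-map (λ n x²<ε² → go ε 0<ε (seq x n) x²<ε²)
    (Defs._≤_.below x²≤0 (ε * ε) (0<* 0<ε 0<ε))
    where
    x²≤0 : (x *ᴿ x) Defs.≤ 0ᴿ
    x²≤0 = ¬Pos⇒≤ (x *ᴿ x) 0ᴿ (λ p → ¬pos (Pos-resp (pointwise λ n → +-identityʳ _) p))
    go : ∀ ε → 0ℚ < ε → ∀ x → x * x < 0ℚ + ε * ε → ∣ x - 0ℚ ∣ < ε
    go ε 0<ε x x²<ε² = ≰⇒> λ ε≤∣x∣ → <-irrefl refl (<-≤-trans x²<ε²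
      (subst₂ _≤_ (sym (+-identityˡ (ε * ε))) (trans (sym (∣p*q∣≡∣p∣*∣q∣ x x)) (0≤p⇒∣p∣≡p (0≤p² x)))
        (*-mono-≤ (<⇒≤ 0<ε) (ε≤ ε≤∣x∣) (<⇒≤ 0<ε) (ε≤ ε≤∣x∣))))
      where
      ε≤ : ε ≤ ∣ x - 0ℚ ∣ → ε ≤ ∣ x ∣
      ε≤ = subst (λ t → ε ≤ ∣ t ∣) (+-identityʳ x)

  module RootSet {t : ℕ} (I : Interlaced t) where
    open Interlaced I

    n : ℕ
    n = 3 ℕ.+ t

    -- The roots are real, so `w` and all `w` - `z j` share one imaginary part. Were its square
    -- positive, every factor would have positive norm and the product could not vanish.
    allZerosReal : AllZerosReal n
    allZerosReal w zero-w = ¬Pos²⇒≃0 (im w) λ pos → Pos⇒≄0 (value-pos pos) (≃-trans (norm-cong value≈0)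
        (pointwise λ _ → refl))
      where
      rootsᶜ : ℂ[X].Roots (intCoeff ℂ-ring (suc t)) (ι ∘ z) m
      rootsᶜ = ℂ[X].mkRoots
        (λ j j<m → ℂ-ring.trans (ι-horner (suc t) (z j) m) (ι-cong (isRoot j j<m)))
        (λ i j i<j j<m → ι-cancellable (z i) (z j) (Roots.cancellable roots i j i<j j<m))
      value : ℂ
      value = w *ᶜ (intCoeff ℂ-ring (suc t) 0 *ᶜ ℂ[X].prod (ι ∘ z) m w)
      value≈0 : value ≈ᶜ ι 0ᴿ
      value≈0 = ℂ-ring.trans (ℂ-ring.*-congˡ {w} (ℂ-ring.sym (ℂ[X].factor rootsᶜ w)))
        (ℂ-ring.trans (ℂ-ring.sym (Dpoly≈x*horner ℂ-ring (suc t) w)) zero-w)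
      coeff-pos : Pos (norm (intCoeff ℂ-ring (suc t) 0))
      coeff-pos = Pos-resp (≃-trans (pointwise λ n → lemma (coeff (suc t) 0))
          -- At degree zero `horner` is just the leading coefficient, so `ι-horner` carries it over
          -- to ℂ.
          (norm-cong (ℂ-ring.sym (ι-horner (suc t) 0ᴿ 0))))
        (Pos-* (Pos-fromℚ 0<c) (Pos-fromℚ 0<c))
        where
        0<c : 0ℚ < coeff (suc t) 0
        0<c = <-≤-trans 0<1 (coeff₀≥1 (suc t))
        lemma : ∀ c → c * c ≡ c * c + 0ℚ * 0ℚ
        lemma = solve-∀ ℚ-ring
      module _ (pos : Pos (im w *ᴿ im w)) where
        prod-pos : ∀ k → Pos (norm (ℂ[X].prod (ι ∘ z) k w))
        prod-pos zero    = Pos-resp (pointwise λ _ → refl) (Pos-fromℚ 0<1)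
        prod-pos (suc k) = Pos-resp (≃-sym (norm-* (ℂ[X].prod (ι ∘ z) k w) (w +ᶜ (-ᶜ ι (z k)))))
          (Pos-* (prod-pos k) (Pos-norm (w +ᶜ (-ᶜ ι (z k)))
            (Pos-resp (pointwise λ n → lemma (seq (im w) n)) pos)))
          where
          lemma : ∀ b → b * b ≡ (b + - 0ℚ) * (b + - 0ℚ)
          lemma = solve-∀ ℚ-ring
        value-pos : Pos (norm value)
        value-pos = Pos-resp (≃-sym (norm-* w (intCoeff ℂ-ring (suc t) 0 *ᶜ ℂ[X].prod (ι ∘ z) m w)))
          (Pos-* (Pos-norm w pos)
            (Pos-resp (≃-sym (norm-* (intCoeff ℂ-ring (suc t) 0) (ℂ[X].prod (ι ∘ z) m w)))
              (Pos-* coeff-pos (prod-pos m))))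

    -- To the left of `z k` all factors are negative, the factor `w` included; `value w` is D_n(`w`)
    -- times the sign that makes this positive.
    leftmost : ∀ k → m ≡ suc k → IsLeftmostZero n (z k)
    leftmost k m≡ = mkIsLeftmostZero
      (≃-trans (Dpoly≃x*F (suc t) (z k)) (≃-trans (*ᴿ-cong (≃-refl {z k}) (isRoot k k<m)) (pointwise λ n → *-zeroʳ (seq (z k) n))))
      λ w zero-w → ¬Pos⇒≤ (z k) w λ w<zₖ → Pos⇒≄0 (value-pos w w<zₖ) (value≃0 w zero-w)
      where
      k<m : k ℕ.< m
      k<m = ℕ.≤-reflexive (sym m≡)
      value : ℝ → ℝ
      value w = (0ᴿ -ᴿ w) *ᴿ (fromℚ (coeff (suc t) 0) *ᴿ (σ m *ᴿ prod z m w))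
      value-pos : ∀ w → w <ᴿ z k → Pos (value w)
      value-pos w w<zₖ = Pos-* (<ᴿ-trans {w} {z k} {0ᴿ} w<zₖ (z<0 k k<m))
        (Pos-* (Pos-fromℚ (<-≤-trans 0<1 (coeff₀≥1 (suc t))))
          (prod-sign z m m w ℕ.≤-refl w<z (λ j m≤j j<m → ⊥-elim (ℕ.<⇒≱ j<m m≤j))))
        where
        w<z : ∀ j → j ℕ.< m → w <ᴿ z j
        w<z j j<m with ℕ.m≤n⇒m<n∨m≡n (ℕ.≤-pred (subst (j ℕ.<_) m≡ j<m))
        ... | inj₁ j<k  = <ᴿ-trans {w} {z k} {z j} w<zₖ (z-descending j k j<k k<m)
        ... | inj₂ refl = w<zₖ
      value≃0 : ∀ w → IsZero ℝ-rawSemiring n w → value w ≃ 0ᴿ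
      value≃0 w zero-w = ≃-trans
        (pointwise λ n → lemma (seq w n) (coeff (suc t) 0) (sgn m) (seq (prod z m w) n))
        (≃-trans (*ᴿ-cong (≃-refl {fromℚ (- sgn m)}) (≃-trans (*ᴿ-cong (≃-refl {w}) (≃-sym (ℝ[X].factor roots w)))
          (≃-trans (≃-sym (Dpoly≃x*F (suc t) w)) zero-w))) (pointwise λ _ → *-zeroʳ (- sgn m)))
        where
        lemma : ∀ w c s p → (0ℚ - w) * (c * (s * p)) ≡ (- s) * (w * (c * p))
        lemma = solve-∀ ℚ-ring

  -- Cauchy-Schwarz and Samuelson's inequality

  -- The expanded form of Σ (z j - a)².
  0≤sum-of-squares : ∀ z k n a → 0ℚ ≤ seq (p₂ z k) n - (a + a) * seq (e₁ z k) n + nat k * (a * a)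
  0≤sum-of-squares z zero    n a = ≤-reflexive (lemma a)
    where
    lemma : ∀ a → 0ℚ ≡ 0ℚ - (a + a) * 0ℚ + 0ℚ * (a * a)
    lemma = solve-∀ ℚ-ring
  0≤sum-of-squares z (suc k) n a = subst (0ℚ ≤_) (lemma (seq (p₂ z k) n) (seq (e₁ z k) n) (nat k) (seq (z k) n) a)
    (0≤+ (0≤sum-of-squares z k n a) (0≤p² (seq (z k) n - a)))
    where
    lemma : ∀ q s k x a → (q - (a + a) * s + k * (a * a)) + (x - a) * (x - a)
      ≡ (q + x * x) - (a + a) * (s + x) + (1ℚ + k) * (a * a)
    lemma = solve-∀ ℚ-ring

  -- Lagrange's identity: the difference is the sum of (z i - z j)² over pairs, and a new entry adds
  -- its squared distances to the earlier ones.
  cauchy-schwarz : ∀ z k n → 0ℚ ≤ nat k * seq (p₂ z k) n - seq (e₁ z k) n * seq (e₁ z k) n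
  cauchy-schwarz z zero    n = ≤-refl
  cauchy-schwarz z (suc k) n = subst (0ℚ ≤_) (lemma (seq (p₂ z k) n) (seq (e₁ z k) n) (nat k) (seq (z k) n))
    (0≤+ (cauchy-schwarz z k n) (0≤sum-of-squares z k n (seq (z k) n)))
    where
    lemma : ∀ q s k x → (k * q - s * s) + (q - (x + x) * s + k * (x * x))
      ≡ (1ℚ + k) * (q + x * x) - (s + x) * (s + x)
    lemma = solve-∀ ℚ-ring

  -- The zero at the origin joins the `k` entries: it leaves both sums unchanged, raises the count
  -- by one, and adds its squared distances.
  cauchy-schwarz⁺ : ∀ z k n → 0ℚ ≤ nat (suc k) * seq (p₂ z k) n - seq (e₁ z k) n * seq (e₁ z k) n
  cauchy-schwarz⁺ z k n = subst (0ℚ ≤_) (lemma (seq (p₂ z k) n) (seq (e₁ z k) n) (nat k))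
    (0≤+ (cauchy-schwarz z k n) (0≤sum-of-squares z k n 0ℚ))
    where
    lemma : ∀ q s k → (k * q - s * s) + (q - (0ℚ + 0ℚ) * s + k * (0ℚ * 0ℚ)) ≡ (1ℚ + k) * q - s * s
    lemma = solve-∀ ℚ-ring

  nonNeg⇒¬Pos-neg : ∀ {x} → (∀ n → 0ℚ ≤ seq x n) → ¬ Pos (-ᴿ x)
  nonNeg⇒¬Pos-neg {x} 0≤x (mkPos ε 0<ε (N , h)) =
    <-irrefl refl (<-≤-trans (<-trans 0<ε (h N ℕ.≤-refl)) (neg-antimono-≤ (0≤x N)))

  ≃⇐≤≥ : ∀ {x y} → x Defs.≤ y → y Defs.≤ x → x ≃ y
  ≃⇐≤≥ {x} {y} p q = mk≃ λ ε 0<ε → eventually-map₂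
    (λ n a b → ∣p∣<⁺ (<-by _ (p<q⇒0<q-p a) (lemma₁ (seq x n) (seq y n) ε)) (<-by _ (p<q⇒0<q-p b) (lemma₂ (seq x n) (seq y n) ε)))
    (Defs._≤_.below p ε 0<ε) (Defs._≤_.below q ε 0<ε)
    where
    lemma₁ : ∀ x y ε → (x - y) + ((y + ε) - x) ≡ ε
    lemma₁ = solve-∀ ℚ-ring
    lemma₂ : ∀ x y ε → - (x - y) + ((x + ε) - y) ≡ ε
    lemma₂ = solve-∀ ℚ-ring

  ≤-respˡ-≃ : ∀ {x y w} → x ≃ y → y Defs.≤ w → x Defs.≤ w
  ≤-respˡ-≃ {x} {y} {w} e p = mk≤ λ ε 0<ε → eventually-map₂
    (λ n a b → <-by _ (0<+ (p<q⇒0<q-p (≤-<-trans (p≤∣p∣ (seq x n - seq y n)) a)) (p<q⇒0<q-p b))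
      (lemma (seq x n) (seq y n) (seq w n) ε))
    (_≃_.close e (½ * ε) (half-pos 0<ε)) (Defs._≤_.below p (½ * ε) (half-pos 0<ε))
    where
    lemma : ∀ x y w ε → x + ((½ * ε - (x - y)) + ((w + ½ * ε) - y)) ≡ w + ε
    lemma = solve-∀ ℚ-ring

  ∣∣ᴿ-cong : ∀ {x y} → x ≃ y → ∣ x ∣ᴿ ≃ ∣ y ∣ᴿ
  ∣∣ᴿ-cong {x} {y} e = mk≃ λ ε 0<ε → eventually-map
    (λ n → ≤-<-trans (∣∣p∣-∣q∣∣≤∣p-q∣ (seq x n) (seq y n))) (_≃_.close e ε 0<ε)

  ∣neg∣ᴿ : ∀ {x} → x <ᴿ 0ᴿ → ∣ x ∣ᴿ ≃ -ᴿ x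
  ∣neg∣ᴿ {x} (mkPos δ 0<δ h) = mk≃ λ ε 0<ε → eventually-map (λ n δ< → subst (_< ε)
    (sym (trans (cong (λ t → ∣ t - - seq x n ∣) (trans (sym (∣-p∣≡∣p∣ (seq x n)))
        (0≤p⇒∣p∣≡p (subst (0ℚ ≤_) (+-identityˡ (- seq x n)) (<⇒≤ (<-trans 0<δ δ<))))))
      (cong ∣_∣ (+-inverseʳ (- seq x n))))) 0<ε) h

  -- Samuelson's inequality for the roots z 0, …, z k and the additional root 0,
  -- of which there are d = k + 2 in total; μ = d − 1.
  module Samuelson (z : ℕ → ℝ) (k : ℕ) (r₁ r₂ : ℚ)
    (r₁≃ : fromℚ r₁ +ᴿ e₁ z (suc k) ≃ 0ᴿ) (r₂≃ : fromℚ r₂ ≃ e₂ z (suc k))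
    (q : ℚ) (q-eq : nat (suc k) * (nat (suc k) * q) ≡ nat (suc k) * (nat (suc k) * (r₁ * r₁)) - nat (suc k) * ((1ℚ + nat (suc k)) * (r₂ + r₂))) where

    μ : ℚ
    μ = nat (suc k)

    0<μ : 0ℚ < μ
    0<μ = 0<nat {suc k} (s≤s z≤n)

    -- `T` is the leftmost zero, and `S` and `Q` are power sums of the others. `u` is d times the
    -- distance from `T` up to the mean of all d zeros; `defect` is d times the Cauchy-Schwarz
    -- difference of the others.
    T S Q u defect : ℝ
    T = z k
    S = e₁ z k
    Q = p₂ z k
    u = S -ᴿ fromℚ μ *ᴿ T
    defect = fromℚ (1ℚ + μ) *ᴿ (fromℚ μ *ᴿ Q -ᴿ S *ᴿ S)

    0≤defect : ∀ n → 0ℚ ≤ seq defect n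
    0≤defect n = 0≤* (0≤+ (<⇒≤ 0<1) (<⇒≤ 0<μ)) (cauchy-schwarz⁺ z k n)

    -r₁≃ : fromℚ r₁ ≃ -ᴿ (S +ᴿ T)
    -r₁≃ = ≃-trans (pointwise λ n → lemma r₁ (seq S n + seq T n))
      (≃-trans (+ᴿ-cong r₁≃ (≃-refl { -ᴿ (S +ᴿ T) })) (pointwise λ n → +-identityˡ _))
      where
      lemma : ∀ r s → r ≡ (r + s) + - s
      lemma = solve-∀ ℚ-ring

    2r₂≃ : fromℚ (r₂ + r₂) ≃ (S +ᴿ T) *ᴿ (S +ᴿ T) -ᴿ (Q +ᴿ T *ᴿ T)
    2r₂≃ = ≃-trans (pointwise λ n → refl) (≃-trans (+ᴿ-cong r₂≃ r₂≃)
      (≃-trans (pointwise λ n → lemma (seq (p₂ z (suc k)) n) (seq (e₂ z (suc k)) n))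
        (+ᴿ-cong (≃-sym (ℝ[X].newton₂ z (suc k))) (≃-refl { -ᴿ (Q +ᴿ T *ᴿ T) }))))
      where
      lemma : ∀ q e → e + e ≡ (q + (e + e)) + - q
      lemma = solve-∀ ℚ-ring

    -- Samuelson's inequality as an identity: the nonnegative `defect` is the excess of μ² q over
    -- u². Both the nonnegativity of `q` and the bound follow.
    μ²q≃ : fromℚ (μ * (μ * q)) ≃ u *ᴿ u +ᴿ defect
    μ²q≃ = ≃-trans (pointwise λ n → q-eq)
      (≃-trans (+ᴿ-cong (*ᴿ-cong (≃-refl {fromℚ μ}) (*ᴿ-cong (≃-refl {fromℚ μ}) (*ᴿ-cong -r₁≃ -r₁≃)))
          (-ᴿ-cong (*ᴿ-cong (≃-refl {fromℚ μ}) (*ᴿ-cong (≃-refl {fromℚ (1ℚ + μ)}) 2r₂≃))))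
        (pointwise λ n → lemma μ (seq S n) (seq T n) (seq Q n)))
      where
      lemma : ∀ μ S T Q → μ * (μ * ((- (S + T)) * (- (S + T)))) + - (μ * ((1ℚ + μ) * ((S + T) * (S + T) + - (Q + T * T))))
        ≡ (S - μ * T) * (S - μ * T) + (1ℚ + μ) * (μ * Q - S * S)
      lemma = solve-∀ ℚ-ring

    0≤q : 0ℚ ≤ q
    0≤q = ≮⇒≥ λ q<0 → nonNeg⇒¬Pos-neg {u *ᴿ u +ᴿ defect} (λ n → 0≤+ (0≤p² (seq u n)) (0≤defect n))
      (Pos-resp (-ᴿ-cong μ²q≃) (Pos-resp (pointwise λ n → lemma μ q)
        (Pos-fromℚ (0<* 0<μ (0<* 0<μ (p<q⇒0<q-p q<0))))))
      where
      lemma : ∀ μ q → μ * (μ * (0ℚ - q)) ≡ - (μ * (μ * q))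
      lemma = solve-∀ ℚ-ring

    -- Multiplied by d = 1 + μ, the opposite strict inequality says that `u` exceeds `v`, which is
    -- entrywise nonnegative. Then u² - v² would be positive, but it equals -`defect`.
    bound : ∀ s A B → s *ᴿ s ≃ fromℚ q → (∀ n → 0ℚ ≤ seq s n) →
      A * (1ℚ + μ) ≡ r₁ → B * (1ℚ + μ) ≡ μ → (-ᴿ T) Defs.≤ (fromℚ A +ᴿ fromℚ B *ᴿ s)
    bound s A B s² 0≤s A-eq B-eq = ¬Pos⇒≤ _ _ λ pos →
      nonNeg⇒¬Pos-neg 0≤defect (Pos-resp square-gap (Pos-* (gap pos)
        (Pos-mono (λ n → ≤-by _ (0≤+ (0≤* (<⇒≤ 0<μ) (0≤s n)) (0≤* (<⇒≤ 0<μ) (0≤s n))) (lemma₁ (seq u n) (μ * seq s n))) (gap pos))))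
      where
      v : ℝ
      v = fromℚ μ *ᴿ s
      lemma₁ : ∀ u v → (u - v) + (v + v) ≡ u + v
      lemma₁ = solve-∀ ℚ-ring
      gap : Pos (-ᴿ T -ᴿ (fromℚ A +ᴿ fromℚ B *ᴿ s)) → Pos (u -ᴿ v)
      gap pos = Pos-resp
        (≃-trans (pointwise λ n → trans (lemma₂ (1ℚ + μ) (seq T n) A B (seq s n))
            (cong₂ (λ a b → ((1ℚ + μ) * (- seq T n) - a) - b * seq s n) A-eq B-eq))
          (≃-trans (+ᴿ-cong (+ᴿ-cong (≃-refl {fromℚ (1ℚ + μ) *ᴿ (-ᴿ T)}) (-ᴿ-cong -r₁≃)) (≃-refl { -ᴿ v }))
            (pointwise λ n → cong (_- μ * seq s n) (lemma₃ μ (seq S n) (seq T n)))))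
        (Pos-* (Pos-fromℚ (0<+ 0<1 0<μ)) pos)
        where
        lemma₂ : ∀ d T A B s → d * (- T - (A + B * s)) ≡ (d * (- T) - A * d) - (B * d) * s
        lemma₂ = solve-∀ ℚ-ring
        lemma₃ : ∀ μ S T → (1ℚ + μ) * (- T) - (- (S + T)) ≡ S - μ * T
        lemma₃ = solve-∀ ℚ-ring
      square-gap : (u -ᴿ v) *ᴿ (u +ᴿ v) ≃ -ᴿ defect
      square-gap = ≃-trans (pointwise λ n → lemma₄ μ (seq u n) (seq s n))
        (≃-trans (+ᴿ-cong (≃-refl {u *ᴿ u}) (-ᴿ-cong (*ᴿ-cong (≃-refl {fromℚ μ}) (*ᴿ-cong (≃-refl {fromℚ μ}) s²))))
          (≃-trans (+ᴿ-cong (≃-refl {u *ᴿ u}) (-ᴿ-cong (≃-trans (pointwise λ _ → refl) μ²q≃))) (pointwise λ n → lemma₅ (seq u n) (seq defect n))))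
        where
        lemma₄ : ∀ μ u s → (u - μ * s) * (u + μ * s) ≡ u * u - μ * (μ * (s * s))
        lemma₄ = solve-∀ ℚ-ring
        lemma₅ : ∀ u e → u * u - (u * u + e) ≡ - e
        lemma₅ = solve-∀ ℚ-ring

  *-cancelʳ : ∀ {a b c} → 0ℚ < c → a * c ≡ b * c → a ≡ b
  *-cancelʳ {a} {b} {c} 0<c e = ≤-antisym
    (*-cancelʳ-≤-pos c {{positive 0<c}} (≤-reflexive e)) (*-cancelʳ-≤-pos c {{positive 0<c}} (≤-reflexive (sym e)))

  -- The bound for the leftmost zero of D_n

  module Main (u : ℕ) where
    -- With these shifts `F (suc t)` belongs to n = 3 + `t`, has `m` = d - 1 roots, and its leftmost
    -- root has index `k` = d - 2.
    t k m n : ℕ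
    t = suc u
    k = ⌊ u /2⌋
    m = suc k
    n = 4 ℕ.+ u

    I : Interlaced t
    I = interlaced t

    open Interlaced I using (z; isRoot; roots; z<0)
    open RootSet I using (allZerosReal; leftmost)

    d : ℕ
    d = suc m

    r₁ r₂ q c : ℚ
    r₁ = D n m ÷ D n d
    r₂ = D n k ÷ D n d
    q  = r₁ * r₁ - ((2 ℕ.* d) ÷ m) * r₂
    c  = coeff (suc t) 0

    0<Dd : 0 ℕ.< D n d
    0<Dd = subst (0 ℕ.<_) (sym (D≡E n d)) (E-pos (suc t))

    0<c : 0ℚ < c
    0<c = <-≤-trans 0<1 (coeff₀≥1 (suc t))

    nat-Dd : nat (D n d) ≡ c
    nat-Dd = cong nat (D≡E n d)

    r₁-eq : r₁ * c ≡ coeff (suc t) 1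
    r₁-eq = trans (cong (r₁ *_) (sym nat-Dd)) (trans (÷-* (D n m) {D n d} 0<Dd) (cong nat (D≡E n m)))

    r₂-eq : r₂ * c ≡ coeff (suc t) 2
    r₂-eq = trans (cong (r₂ *_) (sym nat-Dd)) (trans (÷-* (D n k) {D n d} 0<Dd) (cong nat (D≡E n k)))

    -- For `m` = 1, that is for n equal to 4 or 5, this covers the entry at index 2, which is
    -- D(n,0).
    coeff-high : ∀ j → m ℕ.< j → fromℚ (coeff (suc t) j) ≃ 0ᴿ
    coeff-high j m<j = pointwise λ _ → cong (λ i → nat (E n i)) (ℕ.m≤n⇒m∸n≡0 m<j)

    -- `vieta` keeps the leading coefficient as a factor; cancelling `c` passes to the ratio.
    r₁≃ : fromℚ r₁ +ᴿ e₁ z m ≃ 0ᴿ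
    r₁≃ = Pos-cancel (fromℚ r₁ +ᴿ e₁ z m) (Pos-fromℚ 0<c)
      (≃-trans (pointwise λ i → trans (lemma c r₁ (seq (e₁ z m) i)) (cong (_+ c * seq (e₁ z m) i) r₁-eq))
        (proj₁ (ℝ[X].vieta roots coeff-high)))
      where
      lemma : ∀ c r e → c * (r + e) ≡ r * c + c * e
      lemma = solve-∀ ℚ-ring

    r₂≃ : fromℚ r₂ ≃ e₂ z m
    r₂≃ = ≃-trans (pointwise λ i → lemma₁ r₂ (seq (e₂ z m) i))
      (≃-trans (+ᴿ-cong (Pos-cancel (fromℚ r₂ -ᴿ e₂ z m) (Pos-fromℚ 0<c)
          (≃-trans (pointwise λ i → trans (lemma₂ c r₂ (seq (e₂ z m) i)) (cong (_- c * seq (e₂ z m) i) r₂-eq))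
            (≃-trans (+ᴿ-cong (proj₂ (ℝ[X].vieta roots coeff-high)) (≃-refl { -ᴿ (fromℚ c *ᴿ e₂ z m) }))
              (pointwise λ i → +-inverseʳ (c * seq (e₂ z m) i)))))
        (≃-refl {e₂ z m})) (pointwise λ i → +-identityˡ _))
      where
      lemma₁ : ∀ r e → r ≡ (r - e) + e
      lemma₁ = solve-∀ ℚ-ring
      lemma₂ : ∀ c r e → c * (r - e) ≡ r * c - c * e
      lemma₂ = solve-∀ ℚ-ring

    q-eq : nat m * (nat m * q) ≡ nat m * (nat m * (r₁ * r₁)) - nat m * ((1ℚ + nat m) * (r₂ + r₂))
    q-eq = trans (lemma₁ (nat m) r₁ ((2 ℕ.* d) ÷ m) r₂)
      (trans (cong (λ g → nat m * (nat m * (r₁ * r₁)) - nat m * (g * r₂)) (trans (÷-* (2 ℕ.* d) {m} (s≤s z≤n)) (nat-* 2 d)))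
        (lemma₂ (nat m) r₁ r₂))
      where
      lemma₁ : ∀ μ r g s → μ * (μ * (r * r - g * s)) ≡ μ * (μ * (r * r)) - μ * ((g * μ) * s)
      lemma₁ = solve-∀ ℚ-ring
      lemma₂ : ∀ μ r s → μ * (μ * (r * r)) - μ * (((1ℚ + (1ℚ + 0ℚ)) * (1ℚ + μ)) * s)
        ≡ μ * (μ * (r * r)) - μ * ((1ℚ + μ) * (s + s))
      lemma₂ = solve-∀ ℚ-ring

    A-eq : (D n m ÷ (d ℕ.* D n d)) * (1ℚ + nat m) ≡ r₁
    A-eq = *-cancelʳ 0<c (trans (*-assoc (D n m ÷ (d ℕ.* D n d)) (1ℚ + nat m) c)
      (trans (cong ((D n m ÷ (d ℕ.* D n d)) *_) (trans (cong ((1ℚ + nat m) *_) (sym nat-Dd)) (sym (nat-* d (D n d)))))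
        (trans (÷-* (D n m) {d ℕ.* D n d} (ℕ.*-mono-≤ {1} {d} (s≤s z≤n) 0<Dd))
          (trans (cong nat (D≡E n m)) (sym r₁-eq)))))

    open Samuelson z k r₁ r₂ r₁≃ r₂≃ q q-eq using (0≤q; bound)

    s : ℝ
    s = proj₁ (sqrt 0≤q)

    zₖ-leftmost : IsLeftmostZero n (z k)
    zₖ-leftmost = leftmost k refl

    -- Two leftmost zeros lie below each other, so `x` equals `z k`, which is negative.
    ∣leftmost∣≤ : ∀ x → IsLeftmostZero n x →
      ∣ x ∣ᴿ Defs.≤ (fromℚ (D n m ÷ (d ℕ.* D n d)) +ᴿ fromℚ (m ÷ d) *ᴿ s)
    ∣leftmost∣≤ x lx = ≤-respˡ-≃ ∣x∣≃ zₖ-bound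
      where
      zₖ-bound : (-ᴿ z k) Defs.≤ (fromℚ (D n m ÷ (d ℕ.* D n d)) +ᴿ fromℚ (m ÷ d) *ᴿ s)
      zₖ-bound = bound s _ _ (_IsSqrtOf_.square (proj₁ (proj₂ (sqrt 0≤q)))) (proj₂ (proj₂ (sqrt 0≤q)))
        A-eq (÷-* m {d} (s≤s z≤n))
      ∣x∣≃ : ∣ x ∣ᴿ ≃ -ᴿ z k
      ∣x∣≃ = ≃-trans (∣∣ᴿ-cong (≃⇐≤≥ (IsLeftmostZero.leftmost lx (z k) (IsLeftmostZero.isZero zₖ-leftmost))
        (IsLeftmostZero.leftmost zₖ-leftmost x (IsLeftmostZero.isZero lx)))) (∣neg∣ᴿ (z<0 k ℕ.≤-refl))

open import Defs
open import Data.Nat.Base as ℕ using (ℕ; suc; s≤s; z≤n; _∸_; ⌊_/2⌋)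
open import Data.Product.Base using (∃-syntax; _×_; _,_; proj₁; proj₂)
open import Data.Rational.Base as ℚ using (ℚ)
open RealAnalysis using (sqrt)
open Interlacing using (module Interlaced)
open Zeros using (module RootSet; module Samuelson; module Main)

mainTheorem4 : ∀ (n : ℕ) → 4 ℕ.≤ n →
    let d  = ⌊ n /2⌋
        r₁ = D n (d ∸ 1) ÷ D n d
        r₂ = D n (d ∸ 2) ÷ D n d
    in AllZerosReal n
       × (∃[ z ] IsLeftmostZero n z)
       × (∃[ s ] (s IsSqrtOf fromℚ (r₁ ℚ.* r₁ ℚ.- ((2 ℕ.* d) ÷ (d ∸ 1)) ℚ.* r₂)
           × (∀ z → IsLeftmostZero n z →
                ∣ z ∣ᴿ ≤ fromℚ (D n (d ∸ 1) ÷ (d ℕ.* D n d)) +ᴿ fromℚ ((d ∸ 1) ÷ d) *ᴿ s)))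
mainTheorem4 (suc (suc (suc (suc u)))) (s≤s (s≤s (s≤s (s≤s z≤n)))) =
    allZerosReal
  , (z k , zₖ-leftmost)
  , s , proj₁ (proj₂ (sqrt 0≤q)) , ∣leftmost∣≤
  where
  -- For n = 4 + `u` the half of n reduces to `suc (suc k)`, so the truncated subtractions in the
  -- statement compute to `m` and `k`.
  open Main u
  open Interlaced I using (z)
  open RootSet I using (allZerosReal)
  open Samuelson z k r₁ r₂ r₁≃ r₂≃ q q-eq using (0≤q)
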